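{- Let $F$ be a field of characteristic $2$, let $m \geq 1$ be an integer, let $p$ be an odd prime, and set $n := 2p^m$. Let $x_1, \dots, x_n$ be independent variables over $F$, let $K_n := F(x_1, \dots, x_n)^{S_n}$ and $L_n := F(x_1, \dots, x_n)^{S_{n-1}}$. Then there is no $y \in L_n \setminus K_n$ such that $\mathrm{Tr}(y) = \mathrm{Tr}(y^2) = \dots = \mathrm{Tr}(y^p) = 0$.
   Context: The symmetric group $S_n$ acts on the rational function field $F(x_1,\dots,x_n)$ by permuting $x_1,\dots,x_n$, and $S_{n-1}\subset S_n$ is the subgroup permuting $x_2,\dots,x_n$ (fixing $x_1$). Thus $K_n = F(a_1,\dots,a_n)$ with $a_i$ the $i$-th elementary symmetric polynomial in $x_1,\dots,x_n$, and $L_n = K_n(x_1)$ is a separable field extension of $K_n$ of degree $n$. For $z\in L_n$, $\mathrm{Tr}(z)\in K_n$ denotes the trace of the $K_n$-linear map $L_n\to L_n$, $w\mapsto zw$ (i.e. the field trace of $L_n/K_n$). -}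

module Defs where

open import Level using (Level; _⊔_) renaming (suc to lsuc)
open import Algebra.Bundles using (CommutativeRing)
open import Data.Nat as ℕ using (ℕ; zero; suc)
open import Data.Fin as Fin using (Fin; zero; suc)
open import Data.Fin.Permutation using (Permutation′; _⟨$⟩ʳ_; _⟨$⟩ˡ_)
open import Data.Vec using (Vec; tabulate; lookup; zipWith; replicate)
open import Data.Vec.Properties using (≡-dec)
open import Data.List using (List; []; _∷_; _++_; map; concatMap)
open import Data.Bool using (if_then_else_)
open import Data.Product using (_×_; _,_; ∃; proj₁; proj₂)
open import Relation.Nullary using (¬_; yes; no; does)
open import Relation.Binary.PropositionalEquality using (_≡_)

record Field (c ℓ : Level) : Set (lsuc (c ⊔ ℓ)) where
  field
    commutativeRing : CommutativeRing c ℓ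
  open CommutativeRing commutativeRing public
  field
    0≉1     : ¬ (0# ≈ 1#)
    inverse : ∀ x → ¬ (x ≈ 0#) → ∃ λ y → x * y ≈ 1#

Char2 : ∀ {c ℓ} → Field c ℓ → Set ℓ
Char2 F = 1# + 1# ≈ 0#  where open Field F

-- Rational functions in the variables x₀ … x_k (n = suc k variables) over F.
-- The variable x₀ (index zero) plays the role of x₁ in the paper.
module RatFuns {c ℓ} (F : Field c ℓ) (k : ℕ) where
  open Field F using (Carrier; _≈_; _+_; _*_; 0#; 1#)

  n : ℕ
  n = suc k

  Exp : Set
  Exp = Vec ℕ n

  -- a polynomial is a finite formal sum of terms  a · x^e
  MPoly : Set c
  MPoly = List (Carrier × Exp)

  coeff : MPoly → Exp → Carrier
  coeff [] e = 0#
  coeff ((a , e′) ∷ p) e with ≡-dec ℕ._≟_ e′ e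
  ... | yes _ = a + coeff p e
  ... | no  _ = coeff p e

  _≈ₚ_ : MPoly → MPoly → Set ℓ
  p ≈ₚ q = ∀ e → coeff p e ≈ coeff q e

  0ₚ 1ₚ : MPoly
  0ₚ = []
  1ₚ = (1# , replicate n 0) ∷ []

  _+ₚ_ : MPoly → MPoly → MPoly
  p +ₚ q = p ++ q

  _*ₚ_ : MPoly → MPoly → MPoly
  p *ₚ q = concatMap (λ t → map (λ s → (proj₁ t * proj₁ s , zipWith ℕ._+_ (proj₂ t) (proj₂ s))) q) p

  varₚ : Fin n → MPoly
  varₚ i = (1# , tabulate (λ j → if does (i Fin.≟ j) then 1 else 0)) ∷ []

  -- action of σ ∈ S_n: x_i ↦ x_{σ(i)}, i.e. exponent e ↦ e ∘ σ⁻¹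
  renₚ : Permutation′ n → MPoly → MPoly
  renₚ σ = map (λ t → (proj₁ t , tabulate (λ j → lookup (proj₂ t) (σ ⟨$⟩ˡ j))))

  -- rational functions  num / den  (den required to be nonzero via WF)
  record RatFun : Set c where
    constructor _/_
    field
      num den : MPoly
  open RatFun public

  WF : RatFun → Set ℓ
  WF r = ¬ (den r ≈ₚ 0ₚ)

  -- equality of fractions (meaningful for nonzero denominators)
  _≈ᵣ_ : RatFun → RatFun → Set ℓ
  r ≈ᵣ s = (num r *ₚ den s) ≈ₚ (num s *ₚ den r)

  0ᵣ 1ᵣ : RatFun
  0ᵣ = 0ₚ / 1ₚ
  1ᵣ = 1ₚ / 1ₚ

  _+ᵣ_ : RatFun → RatFun → RatFun
  r +ᵣ s = ((num r *ₚ den s) +ₚ (num s *ₚ den r)) / (den r *ₚ den s)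

  _*ᵣ_ : RatFun → RatFun → RatFun
  r *ᵣ s = (num r *ₚ num s) / (den r *ₚ den s)

  _^ᵣ_ : RatFun → ℕ → RatFun
  r ^ᵣ zero  = 1ᵣ
  r ^ᵣ suc j = r *ᵣ (r ^ᵣ j)

  renᵣ : Permutation′ n → RatFun → RatFun
  renᵣ σ r = renₚ σ (num r) / renₚ σ (den r)

  Σᵣ : ∀ {j} → (Fin j → RatFun) → RatFun
  Σᵣ {zero}  f = 0ᵣ
  Σᵣ {suc j} f = f zero +ᵣ Σᵣ (λ i → f (suc i))

  x₁ : RatFun
  x₁ = varₚ zero / 1ₚ

  InK : RatFun → Set ℓ
  InK r = ∀ (σ : Permutation′ n) → renᵣ σ r ≈ᵣ r

  InL : RatFun → Set ℓ
  InL r = ∀ (σ : Permutation′ n) → σ ⟨$⟩ʳ zero ≡ zero → renᵣ σ r ≈ᵣ r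

  -- Tr_{L_n/K_n}(z) = t : t is the trace of the K_n-linear map w ↦ z w,
  -- computed in the K_n-basis 1, x₁, …, x₁^{n-1} of L_n = K_n(x₁):
  -- z · x₁^i = Σ_j C i j · x₁^j with C i j ∈ K_n, and t = Σ_i C i i.
  TraceIs : RatFun → RatFun → Set (c ⊔ ℓ)
  TraceIs z t =
    ∃ λ (C : Fin n → Fin n → RatFun) →
      (∀ i j → WF (C i j) × InK (C i j)) ×
      (∀ i → (z *ᵣ (x₁ ^ᵣ Fin.toℕ i)) ≈ᵣ Σᵣ (λ j → C i j *ᵣ (x₁ ^ᵣ Fin.toℕ j))) ×
      (t ≈ᵣ Σᵣ (λ i → C i i))

{-# OPTIONS --safe #-}
module Submission where

open import Level using (Level; _⊔_) renaming (suc to lsuc)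
open import Algebra.Bundles using (CommutativeSemiring; CommutativeMonoid)
import Algebra.Properties.Semiring.Exp
import Algebra.Properties.CommutativeSemiring.Exp
import Algebra.Properties.Semiring.Sum
import Relation.Binary.Reasoning.Setoid
open import Data.Nat as ℕ using (ℕ; zero; suc; s≤s; z≤n; _%_; _/_; NonZero)
import Data.Nat.Properties as ℕ
open import Data.Fin as Fin using (Fin; zero; suc; combine; remQuot)
open import Relation.Binary.PropositionalEquality as ≡ using (_≡_; _≢_)
open import Function using (_∘_; id)
open import Data.List using (List; []; _∷_; _++_; map; concatMap; length; allFin; cartesianProduct)
open import Data.Product using (_×_; _,_; ∃; ∃-syntax; proj₁; proj₂)
open import Data.Sum using (_⊎_; inj₁; inj₂)
open import Data.Empty using (⊥; ⊥-elim)
open import Relation.Nullary using (¬_; yes; no; does; contradiction)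
open import Relation.Binary using (DecidableEquality; Trichotomous; tri<; tri≈; tri>; IsEquivalence)
open import Data.Nat.Induction using (<-wellFounded; <-rec)
open import Data.Vec using (Vec; []; _∷_; zipWith; replicate; lookup; tabulate)
import Data.Vec.Properties as Vec
open import Data.Vec.Relation.Binary.Lex.Strict as Lex using (Lex-<)
open import Data.Vec.Relation.Binary.Pointwise.Inductive using (Pointwise-≡⇒≡; ≡⇒Pointwise-≡)
open import Induction.WellFounded using (WellFounded; Acc; acc)
import Algebra.Properties.CommutativeMonoid.Sum
import Data.Fin.Properties as Fin
open import Data.Nat.DivMod
open import Data.Nat.GCD using (module Bézout)
open import Data.Nat.Coprimality using (coprime-Bézout; prime⇒coprime)
open import Data.Nat.Primality using (Prime; prime⇒nonZero; prime⇒nonTrivial)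
open import Data.Nat.GeneralisedArithmetic using (fold)
open import Data.List.Membership.Propositional using (_∈_; _∉_)
open import Data.List.Relation.Unary.Any using (here; there)
open import Data.List.Membership.Propositional.Properties using (∈-cartesianProduct⁺; ∈-allFin; ∈-++⁺ˡ; ∈-++⁺ʳ)
open import Data.List.Relation.Unary.Unique.Propositional using (Unique)
import Data.List.Relation.Unary.Unique.Propositional.Properties as Unique
import Data.List.Relation.Unary.All as All
open import Data.List.Relation.Unary.AllPairs using ([]; _∷_)
open import Data.Product.Properties using (≡-dec)
open import Relation.Nullary.Decidable using (¬?)
open import Data.Bool using (if_then_else_)
open import Data.Fin.Permutation using (Permutation′; _⟨$⟩ʳ_; _⟨$⟩ˡ_; inverseˡ; inverseʳ; permutation; transpose; _∘ₚ_; flip)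
import Algebra.Solver.Ring.NaturalCoefficients.Default
open import Defs
open import Relation.Nullary.Negation using (¬¬-map)
import Data.List.Membership.DecPropositional as DecMembership

-- Let y₁, …, yₙ be the conjugates of y. Lagrange interpolation at x₁, …, xₙ turns the trace
-- hypotheses into Σ yᵢʲ ≈ 0 for 1 ≤ j ≤ p; as n is even these relations survive yᵢ ↦ yᵢ + s.
-- The group A = (ℤ/p)^m × (ℤ/p)^m permutes the indices, each factor acting regularly on one half.
-- After multiplication by an A-invariant common denominator the yᵢ become polynomials fᵢ.
-- Adjoin a root of unity ζ of order p, and for each generator g of A a variable α_g scaled by g with
-- weight ζ⁻¹; replace the xᵢ by polynomials uᵢ in the α_g that are A-equivariant and specialise
-- to xᵢ at α = 1. If the fᵢ(u) were not all equal, the lowest coefficient at which they differ would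
-- be a non-constant vector a with a_{g i} = ζ^{r_g} a_i and Σ aᵢ = Σ (aᵢ + s)ᵖ = 0. When all the
-- ζ^{r_g} are 1, a takes one value on each half and Σ aᵢ = 0 equates them. Otherwise some generator
-- acts nontrivially, a vanishes on the half that it fixes and aᵖ is constant on the other half,
-- which has odd size; so aᵖ = 0 and a = 0. Hence the fᵢ agree and y is symmetric.
--
-- Equality in F is not decidable, but the claim is a negation, so F is used with the
-- double negation of its equality.

-- The obstacle is that each g in A moves not only the index of fᵢ but also the ring in which fᵢ
-- lives. The variables α_g separate the two: inside uᵢ the permutation by g has become a rescaling
-- of α_g, the xᵢ are mere constants, and passing to one coefficient in α_g trades the automorphism
-- g for a scalar, a power of ζ. Removing the generators one after the other ends over a ring on
-- which A acts trivially, so that only vectors twisted by p-th roots of unity remain. The shifts by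
-- s keep this induction alive: the part below degree d that the fᵢ share has to be subtracted
-- without losing the equation for p-th powers. The ring with ζ need not be a domain, because the
-- cyclotomic polynomial may factor over F. The base case therefore works with two weaker properties
-- that survive: a square is zero only if its root is, and 1 + ζ^r is not a zero divisor unless p
-- divides r. Specialising to α = 1 recovers the original polynomials, and so carries equality of
-- the specialised vector back to the fᵢ.

-- Rings of characteristic 2: here x is its own negative, so a semiring structure is enough.
record Ring₂ (c ℓ : Level) : Set (lsuc (c ⊔ ℓ)) where
  field
    commutativeSemiring : CommutativeSemiring c ℓ
  open CommutativeSemiring commutativeSemiring public hiding (zero)
  field
    x+x≈0 : ∀ x → x + x ≈ 0#
  open Algebra.Properties.Semiring.Exp semiring public
  open Algebra.Properties.CommutativeSemiring.Exp commutativeSemiring public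
    using (^-distrib-*)
  open Algebra.Properties.Semiring.Sum semiring public
    using (sum; sum-cong-≋; ∑-distrib-+; ∑-comm; *-distribˡ-sum; *-distribʳ-sum; sum-permute)
  module ≈-Reasoning = Relation.Binary.Reasoning.Setoid setoid

  ≈⇒+≈0 : ∀ {x y} → x ≈ y → x + y ≈ 0#
  ≈⇒+≈0 {x} {y} x≈y = trans (+-congʳ x≈y) (x+x≈0 y)

  +≈0⇒≈ : ∀ {x y} → x + y ≈ 0# → x ≈ y
  +≈0⇒≈ {x} {y} x+y≈0 = begin
    x            ≈⟨ +-identityʳ x ⟨
    x + 0#       ≈⟨ +-congˡ (x+x≈0 y) ⟨
    x + (y + y)  ≈⟨ +-assoc x y y ⟨
    (x + y) + y  ≈⟨ +-congʳ x+y≈0 ⟩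
    0# + y       ≈⟨ +-identityˡ y ⟩
    y            ∎
    where open ≈-Reasoning

  +-interchange : ∀ w x y z → (w + x) + (y + z) ≈ (w + y) + (x + z)
  +-interchange w x y z = begin
    (w + x) + (y + z)  ≈⟨ +-assoc w x (y + z) ⟩
    w + (x + (y + z))  ≈⟨ +-congˡ (+-assoc x y z) ⟨
    w + ((x + y) + z)  ≈⟨ +-congˡ (+-congʳ (+-comm x y)) ⟩
    w + ((y + x) + z)  ≈⟨ +-congˡ (+-assoc y x z) ⟩
    w + (y + (x + z))  ≈⟨ +-assoc w y (x + z) ⟨
    (w + y) + (x + z)  ∎
    where open ≈-Reasoning

  *-interchange : ∀ w x y z → (w * x) * (y * z) ≈ (w * y) * (x * z)
  *-interchange w x y z = begin
    (w * x) * (y * z)  ≈⟨ *-assoc w x (y * z) ⟩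
    w * (x * (y * z))  ≈⟨ *-congˡ (*-assoc x y z) ⟨
    w * ((x * y) * z)  ≈⟨ *-congˡ (*-congʳ (*-comm x y)) ⟩
    w * ((y * x) * z)  ≈⟨ *-congˡ (*-assoc y x z) ⟩
    w * (y * (x * z))  ≈⟨ *-assoc w y (x * z) ⟨
    (w * y) * (x * z)  ∎
    where open ≈-Reasoning

  x*[y*z]≈y*[x*z] : ∀ x y z → x * (y * z) ≈ y * (x * z)
  x*[y*z]≈y*[x*z] x y z = begin
    x * (y * z)  ≈⟨ *-assoc x y z ⟨
    (x * y) * z  ≈⟨ *-congʳ (*-comm x y) ⟩
    (y * x) * z  ≈⟨ *-assoc y x z ⟩
    y * (x * z)  ∎
    where open ≈-Reasoning

  freshman : ∀ x y → (x + y) * (x + y) ≈ x * x + y * y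
  freshman x y = begin
    (x + y) * (x + y)                  ≈⟨ distribʳ (x + y) x y ⟩
    x * (x + y) + y * (x + y)          ≈⟨ +-cong (distribˡ x x y) (distribˡ y x y) ⟩
    (x * x + x * y) + (y * x + y * y)  ≈⟨ +-congˡ (+-comm _ _) ⟩
    (x * x + x * y) + (y * y + y * x)  ≈⟨ +-interchange _ _ _ _ ⟩
    (x * x + y * y) + (x * y + y * x)  ≈⟨ +-congˡ (≈⇒+≈0 (*-comm x y)) ⟩
    (x * x + y * y) + 0#               ≈⟨ +-identityʳ _ ⟩
    x * x + y * y                      ∎
    where open ≈-Reasoning

  Reduced : Set (c ⊔ ℓ)
  Reduced = ∀ x → x * x ≈ 0# → x ≈ 0#

  1^n≈1 : ∀ n → 1# ^ n ≈ 1#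
  1^n≈1 zero    = refl
  1^n≈1 (suc n) = trans (*-identityˡ _) (1^n≈1 n)

  sum-0 : ∀ {n} (t : Fin n → Carrier) → (∀ i → t i ≈ 0#) → sum t ≈ 0#
  sum-0 {zero}  t t≈0 = refl
  sum-0 {suc n} t t≈0 = trans (+-cong (t≈0 zero) (sum-0 (t ∘ suc) (t≈0 ∘ suc))) (+-identityˡ 0#)

  sum-single : ∀ {n} (t : Fin n → Carrier) j → (∀ i → i ≢ j → t i ≈ 0#) → sum t ≈ t j
  sum-single {suc n} t zero t≈0 =
    trans (+-congˡ (sum-0 (t ∘ suc) (λ i → t≈0 (suc i) λ ()))) (+-identityʳ _)
  sum-single {suc n} t (suc j) t≈0 =
    trans (+-cong (t≈0 zero λ ()) (sum-single (t ∘ suc) j (λ i i≢j → t≈0 (suc i) λ { ≡.refl → i≢j ≡.refl })))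
          (+-identityˡ _)

  sum-cong : ∀ {n} {s t : Fin n → Carrier} → (∀ i → s i ≈ t i) → sum s ≈ sum t
  sum-cong = sum-cong-≋

  -- `Reduced` speaks of squares only. As `n < 2 ^ n`, the vanishing passes to the exponent `2 ^ n`,
  -- from which `n` successive square roots lead down to `x`.
  reduced⇒powers : Reduced → ∀ n x → x ^ n ≈ 0# → x ≈ 0#
  reduced⇒powers red n x xⁿ≈0 = descend n (begin
    x ^ (2 ℕ.^ n)                      ≡⟨ ≡.cong (x ^_) (≡.sym (ℕ.m+[n∸m]≡n (ℕ.<⇒≤ (n<2^n n)))) ⟩
    x ^ (n ℕ.+ (2 ℕ.^ n ℕ.∸ n))        ≈⟨ ^-homo-* x n _ ⟩
    x ^ n * x ^ (2 ℕ.^ n ℕ.∸ n)        ≈⟨ *-congʳ xⁿ≈0 ⟩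
    0# * x ^ (2 ℕ.^ n ℕ.∸ n)           ≈⟨ zeroˡ _ ⟩
    0#                                 ∎)
    where
    open ≈-Reasoning
    n<2^n : ∀ n → n ℕ.< 2 ℕ.^ n
    n<2^n zero    = s≤s z≤n
    n<2^n (suc n) = ℕ.+-mono-≤ (ℕ.≤-trans (s≤s z≤n) (n<2^n n))
      (≡.subst (suc n ℕ.≤_) (≡.sym (ℕ.+-identityʳ (2 ℕ.^ n))) (n<2^n n))
    descend : ∀ k → x ^ (2 ℕ.^ k) ≈ 0# → x ≈ 0#
    descend zero    x¹≈0 = trans (sym (*-identityʳ x)) x¹≈0
    descend (suc k) h = descend k (red _ (trans (sym (trans
      (≡.subst (λ e → x ^ e ≈ x ^ (2 ℕ.^ k ℕ.+ 2 ℕ.^ k))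
        (≡.cong (2 ℕ.^ k ℕ.+_) (≡.sym (ℕ.+-identityʳ (2 ℕ.^ k)))) refl)
      (^-homo-* x (2 ℕ.^ k) (2 ℕ.^ k)))) h))

record Hom {a ℓ₁ b ℓ₂} (A : Ring₂ a ℓ₁) (B : Ring₂ b ℓ₂) : Set (a ⊔ ℓ₁ ⊔ b ⊔ ℓ₂) where
  private
    module A = Ring₂ A
    module B = Ring₂ B
  field
    ⟦_⟧    : A.Carrier → B.Carrier
    cong   : ∀ {x y} → x A.≈ y → ⟦ x ⟧ B.≈ ⟦ y ⟧
    +-homo : ∀ x y → ⟦ x A.+ y ⟧ B.≈ ⟦ x ⟧ B.+ ⟦ y ⟧
    *-homo : ∀ x y → ⟦ x A.* y ⟧ B.≈ ⟦ x ⟧ B.* ⟦ y ⟧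
    0-homo : ⟦ A.0# ⟧ B.≈ B.0#
    1-homo : ⟦ A.1# ⟧ B.≈ B.1#

  ^-homo : ∀ x n → ⟦ x A.^ n ⟧ B.≈ ⟦ x ⟧ B.^ n
  ^-homo x zero    = 1-homo
  ^-homo x (suc n) = B.trans (*-homo x _) (B.*-congˡ (^-homo x n))

  sum-homo : ∀ {n} (t : Fin n → A.Carrier) → ⟦ A.sum t ⟧ B.≈ B.sum (⟦_⟧ ∘ t)
  sum-homo {zero}  t = 0-homo
  sum-homo {suc n} t = B.trans (+-homo _ _) (B.+-congˡ (sum-homo (t ∘ suc)))

idHom : ∀ {a ℓ} (A : Ring₂ a ℓ) → Hom A A
idHom A = record
  { ⟦_⟧ = id ; cong = id ; +-homo = λ _ _ → refl ; *-homo = λ _ _ → refl ; 0-homo = refl ; 1-homo = refl }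
  where open Ring₂ A

infixr 9 _∘ʰ_
_∘ʰ_ : ∀ {a ℓ₁ b ℓ₂ c ℓ₃} {A : Ring₂ a ℓ₁} {B : Ring₂ b ℓ₂} {C : Ring₂ c ℓ₃} →
       Hom B C → Hom A B → Hom A C
_∘ʰ_ {C = C} g f = record
  { ⟦_⟧    = g.⟦_⟧ ∘ f.⟦_⟧
  ; cong   = g.cong ∘ f.cong
  ; +-homo = λ x y → trans (g.cong (f.+-homo x y)) (g.+-homo _ _)
  ; *-homo = λ x y → trans (g.cong (f.*-homo x y)) (g.*-homo _ _)
  ; 0-homo = trans (g.cong f.0-homo) g.0-homo
  ; 1-homo = trans (g.cong f.1-homo) g.1-homo
  }
  where
  module f = Hom f
  module g = Hom g
  open Ring₂ C

-- Monoid algebras in characteristic 2.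

record DecMonoid : Set₁ where
  infixl 7 _∙_
  infix 4 _≟_
  field
    Carrier   : Set
    _∙_       : Carrier → Carrier → Carrier
    ε         : Carrier
    assoc     : ∀ x y z → (x ∙ y) ∙ z ≡ x ∙ (y ∙ z)
    comm      : ∀ x y → x ∙ y ≡ y ∙ x
    identityˡ : ∀ x → ε ∙ x ≡ x
    _≟_       : DecidableEquality Carrier

module MonoidAlgebra {c ℓ} (R : Ring₂ c ℓ) (M : DecMonoid) where
  private
    module R = Ring₂ R
    module M = DecMonoid M
  open M using (_∙_; ε)

  Alg : Set c
  Alg = List (R.Carrier × M.Carrier)

  infixl 7 _*ᴬ_
  _*ᴬ_ : Alg → Alg → Alg
  p *ᴬ q = concatMap (λ t → map (λ s → (proj₁ t R.* proj₁ s , proj₂ t ∙ proj₂ s)) q) p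

  δ : M.Carrier → M.Carrier → R.Carrier
  δ e m with e M.≟ m
  ... | yes _ = R.1#
  ... | no  _ = R.0#

  δ-refl : ∀ e → δ e e R.≈ R.1#
  δ-refl e with e M.≟ e
  ... | yes _  = R.refl
  ... | no e≢e = contradiction ≡.refl e≢e

  δ-≢ : ∀ {e m} → e ≢ m → δ e m R.≈ R.0#
  δ-≢ {e} {m} e≢m with e M.≟ m
  ... | yes e≡m = contradiction e≡m e≢m
  ... | no  _   = R.refl

  _∖_ : Alg → M.Carrier → Alg
  []            ∖ m = []
  ((a , x) ∷ p) ∖ m with m M.≟ x
  ... | yes _ = p ∖ m
  ... | no  _ = (a , x) ∷ (p ∖ m)

  length-∖ : ∀ p m → length (p ∖ m) ℕ.≤ length p
  length-∖ []            m = z≤n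
  length-∖ ((a , x) ∷ p) m with m M.≟ x
  ... | yes _ = ℕ.m≤n⇒m≤1+n (length-∖ p m)
  ... | no  _ = s≤s (length-∖ p m)

  module LinearBasics {d ℓ′} {T : Ring₂ d ℓ′} (h : Hom R T) where
    private
      module T = Ring₂ T
      module h = Hom h
    open T using (_≈_; _+_; _*_; 0#; 1#)

    -- Coefficients and evaluations are both of this form, so that their laws reduce to those of
    -- linear extension.
    lin : (M.Carrier → T.Carrier) → Alg → T.Carrier
    lin φ []            = 0#
    lin φ ((a , m) ∷ p) = h.⟦ a ⟧ * φ m + lin φ p

    lin-++ : ∀ φ p q → lin φ (p ++ q) ≈ lin φ p + lin φ q
    lin-++ φ []            q = T.sym (T.+-identityˡ _)
    lin-++ φ ((a , m) ∷ p) q = T.trans (T.+-congˡ (lin-++ φ p q)) (T.sym (T.+-assoc _ _ _))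

    lin-cong : ∀ {φ ψ} → (∀ m → φ m ≈ ψ m) → ∀ p → lin φ p ≈ lin ψ p
    lin-cong φ≈ψ []            = T.refl
    lin-cong φ≈ψ ((a , m) ∷ p) = T.+-cong (T.*-congˡ (φ≈ψ m)) (lin-cong φ≈ψ p)

    lin-0 : ∀ p → lin (λ _ → 0#) p ≈ 0#
    lin-0 []            = T.refl
    lin-0 ((a , m) ∷ p) = T.trans (T.+-cong (T.zeroʳ _) (lin-0 p)) (T.+-identityˡ 0#)

    lin-+ : ∀ φ ψ p → lin (λ m → φ m + ψ m) p ≈ lin φ p + lin ψ p
    lin-+ φ ψ []            = T.sym (T.+-identityˡ 0#)
    lin-+ φ ψ ((a , m) ∷ p) =
      T.trans (T.+-cong (T.distribˡ _ _ _) (lin-+ φ ψ p)) (T.+-interchange _ _ _ _)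

    lin-*ˡ : ∀ b φ p → lin (λ m → b * φ m) p ≈ b * lin φ p
    lin-*ˡ b φ []            = T.sym (T.zeroʳ b)
    lin-*ˡ b φ ((a , m) ∷ p) =
      T.trans (T.+-cong (T.x*[y*z]≈y*[x*z] _ _ _) (lin-*ˡ b φ p)) (T.sym (T.distribˡ _ _ _))

    lin-*ʳ : ∀ b φ p → lin (λ m → φ m * b) p ≈ lin φ p * b
    lin-*ʳ b φ p = T.trans (lin-cong (λ m → T.*-comm (φ m) b) p) (T.trans (lin-*ˡ b φ p) (T.*-comm _ _))

    lin-swap : ∀ (Φ : M.Carrier → M.Carrier → T.Carrier) p q →
               lin (λ s → lin (λ t → Φ s t) q) p ≈ lin (λ t → lin (λ s → Φ s t) p) q
    lin-swap Φ []            q = T.sym (lin-0 q)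
    lin-swap Φ ((a , m) ∷ p) q = T.trans
      (T.+-cong (T.sym (lin-*ˡ _ (Φ m) q)) (lin-swap Φ p q))
      (T.sym (lin-+ (λ t → h.⟦ a ⟧ * Φ m t) (λ t → lin (λ s → Φ s t) p) q))

    lin-* : ∀ φ p q → lin φ (p *ᴬ q) ≈ lin (λ s → lin (λ t → φ (s ∙ t)) q) p
    lin-* φ []            q = T.refl
    lin-* φ ((a , m) ∷ p) q =
      T.trans (lin-++ φ (map _ q) (p *ᴬ q)) (T.+-cong (term q) (lin-* φ p q))
      where
      term : ∀ q → lin φ (map (λ s → (a R.* proj₁ s , m ∙ proj₂ s)) q) ≈ h.⟦ a ⟧ * lin (λ t → φ (m ∙ t)) q
      term []            = T.sym (T.zeroʳ _)
      term ((b , x) ∷ q) = T.trans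
        (T.+-cong (T.trans (T.*-congʳ (h.*-homo a b)) (T.*-assoc _ _ _)) (term q))
        (T.sym (T.distribˡ _ _ _))

  coeff : Alg → M.Carrier → R.Carrier
  coeff p e = LinearBasics.lin (idHom R) (δ e) p

  coeff-++ : ∀ p q e → coeff (p ++ q) e R.≈ coeff p e R.+ coeff q e
  coeff-++ p q e = LinearBasics.lin-++ (idHom R) (δ e) p q

  infix 4 _≈ᴬ_
  record _≈ᴬ_ (p q : Alg) : Set ℓ where
    constructor coeffs
    field coeff≈ : ∀ e → coeff p e R.≈ coeff q e
  open _≈ᴬ_ public

  module LinearSplitting {d ℓ′} {T : Ring₂ d ℓ′} (h : Hom R T) where
    private
      module T = Ring₂ T
      module h = Hom h
    open T using (_≈_; _+_; _*_; 0#; 1#)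
    open LinearBasics h public

    lin-split : ∀ φ m p → lin φ p ≈ h.⟦ coeff p m ⟧ * φ m + lin φ (p ∖ m)
    lin-split φ m [] = T.sym (T.trans (T.+-identityʳ _) (T.trans (T.*-congʳ h.0-homo) (T.zeroˡ _)))
    lin-split φ m ((a , x) ∷ p) with m M.≟ x
    ... | yes ≡.refl = begin
      h.⟦ a ⟧ * φ m + lin φ p                                        ≈⟨ T.+-congˡ (lin-split φ m p) ⟩
      h.⟦ a ⟧ * φ m + (h.⟦ coeff p m ⟧ * φ m + lin φ (p ∖ m))        ≈⟨ T.+-assoc _ _ _ ⟨
      (h.⟦ a ⟧ * φ m + h.⟦ coeff p m ⟧ * φ m) + lin φ (p ∖ m)        ≈⟨ T.+-congʳ (T.distribʳ _ _ _) ⟨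
      (h.⟦ a ⟧ + h.⟦ coeff p m ⟧) * φ m + lin φ (p ∖ m)              ≈⟨ T.+-congʳ (T.*-congʳ (h.+-homo _ _)) ⟨
      h.⟦ a R.+ coeff p m ⟧ * φ m + lin φ (p ∖ m)                    ≈⟨ T.+-congʳ (T.*-congʳ (h.cong (R.+-congʳ (R.*-identityʳ a)))) ⟨
      h.⟦ a R.* R.1# R.+ coeff p m ⟧ * φ m + lin φ (p ∖ m)           ∎
      where open T.≈-Reasoning
    ... | no _ = begin
      h.⟦ a ⟧ * φ x + lin φ p                                        ≈⟨ T.+-congˡ (lin-split φ m p) ⟩
      h.⟦ a ⟧ * φ x + (h.⟦ coeff p m ⟧ * φ m + lin φ (p ∖ m))        ≈⟨ T.+-assoc _ _ _ ⟨
      (h.⟦ a ⟧ * φ x + h.⟦ coeff p m ⟧ * φ m) + lin φ (p ∖ m)        ≈⟨ T.+-congʳ (T.+-comm _ _) ⟩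
      (h.⟦ coeff p m ⟧ * φ m + h.⟦ a ⟧ * φ x) + lin φ (p ∖ m)        ≈⟨ T.+-assoc _ _ _ ⟩
      h.⟦ coeff p m ⟧ * φ m + (h.⟦ a ⟧ * φ x + lin φ (p ∖ m))        ≈⟨ T.+-congʳ (T.*-congʳ (h.cong (R.trans (R.+-congʳ (R.zeroʳ a)) (R.+-identityˡ _)))) ⟨
      h.⟦ a R.* R.0# R.+ coeff p m ⟧ * φ m + (h.⟦ a ⟧ * φ x + lin φ (p ∖ m)) ∎
      where open T.≈-Reasoning

  coeff-∖ : ∀ p m → (∀ e → coeff p e R.≈ R.0#) → ∀ e → coeff (p ∖ m) e R.≈ R.0#
  coeff-∖ p m p≈0 e = begin
    coeff (p ∖ m) e                              ≈⟨ R.+-identityˡ _ ⟨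
    R.0# R.+ coeff (p ∖ m) e                     ≈⟨ R.+-congʳ (R.trans (R.*-congʳ (p≈0 m)) (R.zeroˡ _)) ⟨
    coeff p m R.* δ e m R.+ coeff (p ∖ m) e      ≈⟨ LinearSplitting.lin-split (idHom R) (δ e) m p ⟨
    coeff p e                                    ≈⟨ p≈0 e ⟩
    R.0#                                         ∎
    where open R.≈-Reasoning

  module Linear {d ℓ′} {T : Ring₂ d ℓ′} (h : Hom R T) where
    private
      module T = Ring₂ T
      module h = Hom h
    open T using (_≈_; _+_; _*_; 0#; 1#)
    open LinearSplitting h public

    -- Lists cannot be normalised without deciding equality in `R`. Instead all terms with the
    -- monomial of the head are split off at once: their total coefficient is zero, and the
    -- remaining list is shorter and still has zero coefficients.
    lin-vanish : ∀ φ p → (∀ e → coeff p e R.≈ R.0#) → lin φ p ≈ 0#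
    lin-vanish φ p = go (length p) p ℕ.≤-refl
      where
      go : ∀ k p → length p ℕ.≤ k → (∀ e → coeff p e R.≈ R.0#) → lin φ p ≈ 0#
      go k       []                _       _   = T.refl
      go (suc k) p@((a , m) ∷ p′) (s≤s l) p≈0 = begin
        lin φ p                                     ≈⟨ lin-split φ m p ⟩
        h.⟦ coeff p m ⟧ * φ m + lin φ (p ∖ m)       ≈⟨ T.+-cong
                                                         (T.trans (T.*-congʳ (T.trans (h.cong (p≈0 m)) h.0-homo)) (T.zeroˡ _))
                                                         (go k (p ∖ m) shorter (coeff-∖ p m p≈0)) ⟩
        0# + 0#                                     ≈⟨ T.+-identityˡ 0# ⟩
        0#                                          ∎
        where
        open T.≈-Reasoning
        shorter : length (p ∖ m) ℕ.≤ k
        shorter with m M.≟ m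
        ... | yes _  = ℕ.≤-trans (length-∖ p′ m) l
        ... | no m≢m = contradiction ≡.refl m≢m

    lin-resp : ∀ φ {p q} → p ≈ᴬ q → lin φ p ≈ lin φ q
    lin-resp φ {p} {q} (coeffs p≈q) = T.+≈0⇒≈ (T.trans (T.sym (lin-++ φ p q))
      (lin-vanish φ (p ++ q) λ e → R.trans (coeff-++ p q e) (R.≈⇒+≈0 (p≈q e))))

  private
    module L = Linear (idHom R)

  *ᴬ-comm : ∀ p q → (p *ᴬ q) ≈ᴬ (q *ᴬ p)
  *ᴬ-comm p q = coeffs λ e → begin
    coeff (p *ᴬ q) e                            ≈⟨ L.lin-* (δ e) p q ⟩
    L.lin (λ s → L.lin (λ t → δ e (s ∙ t)) q) p ≈⟨ L.lin-swap _ p q ⟩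
    L.lin (λ t → L.lin (λ s → δ e (s ∙ t)) p) q ≈⟨ L.lin-cong (λ t → L.lin-cong (λ s → R.reflexive (≡.cong (δ e) (M.comm s t))) p) q ⟩
    L.lin (λ t → L.lin (λ s → δ e (t ∙ s)) p) q ≈⟨ L.lin-* (δ e) q p ⟨
    coeff (q *ᴬ p) e                            ∎
    where open R.≈-Reasoning

  *ᴬ-congʳ : ∀ {p p′} q → p ≈ᴬ p′ → (p *ᴬ q) ≈ᴬ (p′ *ᴬ q)
  *ᴬ-congʳ {p} {p′} q p≈p′ = coeffs λ e →
    R.trans (L.lin-* (δ e) p q) (R.trans (L.lin-resp _ p≈p′) (R.sym (L.lin-* (δ e) p′ q)))

  ≈ᴬ-trans : ∀ {p q r} → p ≈ᴬ q → q ≈ᴬ r → p ≈ᴬ r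
  ≈ᴬ-trans (coeffs f) (coeffs g) = coeffs λ e → R.trans (f e) (g e)

  *ᴬ-cong : ∀ {p p′ q q′} → p ≈ᴬ p′ → q ≈ᴬ q′ → (p *ᴬ q) ≈ᴬ (p′ *ᴬ q′)
  *ᴬ-cong {p} {p′} {q} {q′} p≈p′ q≈q′ = ≈ᴬ-trans (*ᴬ-congʳ q p≈p′)
    (≈ᴬ-trans (*ᴬ-comm p′ q) (≈ᴬ-trans (*ᴬ-congʳ p′ q≈q′) (*ᴬ-comm q′ p′)))

  *ᴬ-assoc : ∀ p q r → ((p *ᴬ q) *ᴬ r) ≈ᴬ (p *ᴬ (q *ᴬ r))
  *ᴬ-assoc p q r = coeffs λ e → begin
    coeff ((p *ᴬ q) *ᴬ r) e
      ≈⟨ L.lin-* (δ e) (p *ᴬ q) r ⟩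
    L.lin (λ u → L.lin (λ v → δ e (u ∙ v)) r) (p *ᴬ q)
      ≈⟨ L.lin-* _ p q ⟩
    L.lin (λ s → L.lin (λ t → L.lin (λ v → δ e (s ∙ t ∙ v)) r) q) p
      ≈⟨ L.lin-cong (λ s → L.lin-cong (λ t → L.lin-cong (λ v → R.reflexive (≡.cong (δ e) (M.assoc s t v))) r) q) p ⟩
    L.lin (λ s → L.lin (λ t → L.lin (λ v → δ e (s ∙ (t ∙ v))) r) q) p
      ≈⟨ L.lin-cong (λ s → L.lin-* (λ w → δ e (s ∙ w)) q r) p ⟨
    L.lin (λ s → L.lin (λ w → δ e (s ∙ w)) (q *ᴬ r)) p
      ≈⟨ L.lin-* (δ e) p (q *ᴬ r) ⟨
    coeff (p *ᴬ (q *ᴬ r)) e ∎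
    where open R.≈-Reasoning

  ++-comm : ∀ p q → (p ++ q) ≈ᴬ (q ++ p)
  ++-comm p q = coeffs λ e →
    R.trans (coeff-++ p q e) (R.trans (R.+-comm _ _) (R.sym (coeff-++ q p e)))

  ++-cong : ∀ {p p′ q q′} → p ≈ᴬ p′ → q ≈ᴬ q′ → (p ++ q) ≈ᴬ (p′ ++ q′)
  ++-cong {p} {p′} {q} {q′} (coeffs f) (coeffs g) = coeffs λ e →
    R.trans (coeff-++ p q e) (R.trans (R.+-cong (f e) (g e)) (R.sym (coeff-++ p′ q′ e)))

  *ᴬ-identityˡ : ∀ p → (((R.1# , ε) ∷ []) *ᴬ p) ≈ᴬ p
  *ᴬ-identityˡ p = coeffs λ e → begin
    coeff (((R.1# , ε) ∷ []) *ᴬ p) e                    ≈⟨ L.lin-* (δ e) ((R.1# , ε) ∷ []) p ⟩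
    R.1# R.* L.lin (λ t → δ e (ε ∙ t)) p R.+ R.0#       ≈⟨ R.trans (R.+-identityʳ _) (R.*-identityˡ _) ⟩
    L.lin (λ t → δ e (ε ∙ t)) p                         ≈⟨ L.lin-cong (λ t → R.reflexive (≡.cong (δ e) (M.identityˡ t))) p ⟩
    coeff p e                                           ∎
    where open R.≈-Reasoning

  *ᴬ-distribʳ : ∀ r p q → ((p ++ q) *ᴬ r) ≈ᴬ ((p *ᴬ r) ++ (q *ᴬ r))
  *ᴬ-distribʳ r p q = coeffs λ e → begin
    coeff ((p ++ q) *ᴬ r) e                       ≈⟨ L.lin-* (δ e) (p ++ q) r ⟩
    L.lin _ (p ++ q)                              ≈⟨ L.lin-++ _ p q ⟩
    L.lin _ p R.+ L.lin _ q                       ≈⟨ R.+-cong (L.lin-* (δ e) p r) (L.lin-* (δ e) q r) ⟨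
    coeff (p *ᴬ r) e R.+ coeff (q *ᴬ r) e         ≈⟨ coeff-++ (p *ᴬ r) (q *ᴬ r) e ⟨
    coeff ((p *ᴬ r) ++ (q *ᴬ r)) e                ∎
    where open R.≈-Reasoning

  algebra : Ring₂ c ℓ
  algebra = record
    { commutativeSemiring = record
      { Carrier = Alg ; _≈_ = _≈ᴬ_ ; _+_ = _++_ ; _*_ = _*ᴬ_ ; 0# = [] ; 1# = (R.1# , ε) ∷ []
      ; isCommutativeSemiring = isCommutativeSemiringˡ record
        { +-isCommutativeMonoid = record
          { isMonoid = record
            { isSemigroup = record
              { isMagma = record
                { isEquivalence = record
                  { refl = coeffs λ _ → R.refl ; sym = λ p≈q → coeffs λ e → R.sym (coeff≈ p≈q e) ; trans = ≈ᴬ-trans }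
                ; ∙-cong = ++-cong }
              ; assoc = λ p q r → coeffs λ e → R.reflexive (≡.cong (λ s → coeff s e) (++-assoc p q r)) }
            ; identity = (λ p → coeffs λ _ → R.refl) ,
                         (λ p → coeffs λ e → R.reflexive (≡.cong (λ s → coeff s e) (++-identityʳ p))) }
          ; comm = ++-comm }
        ; *-isCommutativeMonoid = record
          { isMonoid = record
            { isSemigroup = record
              { isMagma = record
                { isEquivalence = record
                  { refl = coeffs λ _ → R.refl ; sym = λ p≈q → coeffs λ e → R.sym (coeff≈ p≈q e) ; trans = ≈ᴬ-trans }
                ; ∙-cong = *ᴬ-cong }
              ; assoc = *ᴬ-assoc }
            ; identity = *ᴬ-identityˡ , λ p → ≈ᴬ-trans (*ᴬ-comm p _) (*ᴬ-identityˡ p) }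
          ; comm = *ᴬ-comm }
        ; distribʳ = *ᴬ-distribʳ
        ; zeroˡ = λ _ → coeffs λ _ → R.refl
        } }
    ; x+x≈0 = λ p → coeffs λ e → R.trans (coeff-++ p p e) (R.x+x≈0 _)
    }
    where
    open import Data.List.Properties using (++-assoc; ++-identityʳ)
    open import Algebra.Structures.Biased _≈ᴬ_ using (isCommutativeSemiringˡ; IsCommutativeSemiringˡ)

  private
    module A = Ring₂ algebra

  const : Hom R algebra
  const = record
    { ⟦_⟧    = λ a → (a , ε) ∷ []
    ; cong   = λ a≈b → coeffs λ e → R.+-congʳ (R.*-congʳ a≈b)
    ; +-homo = λ a b → coeffs λ e → R.trans (R.+-congʳ (R.distribʳ _ a b)) (R.+-assoc _ _ _)
    ; *-homo = λ a b → coeffs λ e → R.+-congʳ (R.*-congˡ (R.reflexive (≡.cong (δ e) (≡.sym (M.identityˡ ε)))))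
    ; 0-homo = coeffs λ e → R.trans (R.+-identityʳ _) (R.zeroˡ _)
    ; 1-homo = A.refl
    }

  mono : M.Carrier → Alg
  mono m = (R.1# , m) ∷ []

  mono-∙ : ∀ m m′ → mono (m ∙ m′) A.≈ mono m A.* mono m′
  mono-∙ m m′ = coeffs λ e → R.+-congʳ (R.*-congʳ (R.sym (R.*-identityˡ _)))

  coeff-term : ∀ a m e → coeff ((a , m) ∷ []) e R.≈ a R.* δ e m
  coeff-term a m e = R.+-identityʳ _

  coeff-const* : ∀ a p e → coeff (Hom.⟦ const ⟧ a A.* p) e R.≈ a R.* coeff p e
  coeff-const* a p e = begin
    coeff (Hom.⟦ const ⟧ a A.* p) e               ≈⟨ L.lin-* (δ e) (Hom.⟦ const ⟧ a) p ⟩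
    a R.* L.lin (λ t → δ e (ε ∙ t)) p R.+ R.0#    ≈⟨ R.+-identityʳ _ ⟩
    a R.* L.lin (λ t → δ e (ε ∙ t)) p             ≈⟨ R.*-congˡ (L.lin-cong (λ t → R.reflexive (≡.cong (δ e) (M.identityˡ t))) p) ⟩
    a R.* coeff p e                               ∎
    where open R.≈-Reasoning

  term≈const*mono : ∀ a m → ((a , m) ∷ []) A.≈ Hom.⟦ const ⟧ a A.* mono m
  term≈const*mono a m = coeffs λ e → begin
    coeff ((a , m) ∷ []) e                     ≈⟨ coeff-term a m e ⟩
    a R.* δ e m                                ≈⟨ R.*-congˡ (R.trans (coeff-term R.1# m e) (R.*-identityˡ _)) ⟨
    a R.* coeff (mono m) e                     ≈⟨ coeff-const* a (mono m) e ⟨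
    coeff (Hom.⟦ const ⟧ a A.* mono m) e       ∎
    where open R.≈-Reasoning

  sum-coeff : ∀ {n} (t : Fin n → Alg) e → coeff (A.sum t) e R.≈ R.sum (λ i → coeff (t i) e)
  sum-coeff {zero}  t e = R.refl
  sum-coeff {suc n} t e = R.trans (coeff-++ (t zero) _ e) (R.+-congˡ (sum-coeff (t ∘ suc) e))

  module Evaluation {d ℓ′} {T : Ring₂ d ℓ′} (h : Hom R T) (φ : M.Carrier → Ring₂.Carrier T)
    (φ-ε : Ring₂._≈_ T (φ ε) (Ring₂.1# T))
    (φ-∙ : ∀ m m′ → Ring₂._≈_ T (φ (m ∙ m′)) (Ring₂._*_ T (φ m) (φ m′))) where
    private
      module T = Ring₂ T
      module h = Hom h
    open Linear h

    eval : Hom algebra T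
    eval = record
      { ⟦_⟧    = lin φ
      ; cong   = lin-resp φ
      ; +-homo = lin-++ φ
      ; *-homo = λ p q → begin
          lin φ (p *ᴬ q)                             ≈⟨ lin-* φ p q ⟩
          lin (λ s → lin (λ t → φ (s ∙ t)) q) p      ≈⟨ lin-cong (λ s → lin-cong (φ-∙ s) q) p ⟩
          lin (λ s → lin (λ t → φ s T.* φ t) q) p    ≈⟨ lin-cong (λ s → lin-*ˡ (φ s) φ q) p ⟩
          lin (λ s → φ s T.* lin φ q) p              ≈⟨ lin-*ʳ (lin φ q) φ p ⟩
          lin φ p T.* lin φ q                        ∎
      ; 0-homo = T.refl
      ; 1-homo = T.trans (T.+-identityʳ _) (T.trans (T.*-cong h.1-homo φ-ε) (T.*-identityˡ T.1#))
      }
      where open T.≈-Reasoning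

    eval-const : ∀ a → lin φ (Hom.⟦ const ⟧ a) T.≈ h.⟦ a ⟧
    eval-const a = T.trans (T.+-identityʳ _) (T.trans (T.*-congˡ φ-ε) (T.*-identityʳ _))

    eval-mono : ∀ m → lin φ (mono m) T.≈ φ m
    eval-mono m = T.trans (T.+-identityʳ _) (T.trans (T.*-congʳ h.1-homo) (T.*-identityˡ _))

  squares : Alg → Alg
  squares = map (λ t → (proj₁ t R.* proj₁ t , proj₂ t ∙ proj₂ t))

  -- Frobenius: the mixed products occur in pairs and cancel.
  p*p≈squares : ∀ p → p A.* p A.≈ squares p
  p*p≈squares []      = A.refl
  p*p≈squares (t ∷ p) = A.trans (A.freshman (t ∷ []) p) (A.+-congˡ (p*p≈squares p))

  module _ (∙-injective : ∀ {m m′} → m ∙ m ≡ m′ ∙ m′ → m ≡ m′) where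

    -- Doubling of exponents is injective, so the terms at `e ∙ e` are exactly the squares of the
    -- terms at `e`, and squaring is additive.
    coeff-squares : ∀ p e → coeff (squares p) (e ∙ e) R.≈ coeff p e R.* coeff p e
    coeff-squares []            e = R.sym (R.zeroˡ _)
    coeff-squares ((a , m) ∷ p) e = R.trans
      (R.+-cong (R.trans (R.*-congˡ δ²) (R.*-interchange _ _ _ _)) (coeff-squares p e))
      (R.sym (R.freshman _ _))
      where
      δ² : δ (e ∙ e) (m ∙ m) R.≈ δ e m R.* δ e m
      δ² with e M.≟ m
      ... | yes ≡.refl = R.trans (δ-refl (e ∙ e)) (R.sym (R.*-identityˡ _))
      ... | no  e≢m    = R.trans (δ-≢ (e≢m ∘ ∙-injective)) (R.sym (R.zeroˡ _))

    -- Serves twice: for exponent vectors, when the variables xᵢ are adjoined, and for ℤ/p with odd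
    -- `p`, when ζ is.
    algebra-reduced : R.Reduced → A.Reduced
    algebra-reduced red p p²≈0 = coeffs λ e → red _
      (R.trans (R.sym (coeff-squares p e))
        (R.trans (R.sym (coeff≈ (p*p≈squares p) (e ∙ e))) (coeff≈ p²≈0 (e ∙ e))))

-- Ordered monoids and lowest terms.

record MonoidOrder (M : DecMonoid) : Set₁ where
  open DecMonoid M
  infix 4 _<_
  field
    _<_           : Carrier → Carrier → Set
    compare       : Trichotomous _≡_ _<_
    <-trans       : ∀ {x y z} → x < y → y < z → x < z
    ∙-monoˡ-<     : ∀ {x y} z → x < y → x ∙ z < y ∙ z
    wellFounded   : WellFounded _<_

  <-irrefl : ∀ {x} → ¬ (x < x)
  <-irrefl {x} x<x with compare x x
  ... | tri< _ x≢x _ = x≢x ≡.refl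
  ... | tri≈ x≮x _ _ = x≮x x<x
  ... | tri> _ x≢x _ = x≢x ≡.refl

  ∙-monoʳ-< : ∀ {x y} z → x < y → z ∙ x < z ∙ y
  ∙-monoʳ-< {x} {y} z x<y rewrite comm z x | comm z y = ∙-monoˡ-< z x<y

  -- By strict monotonicity the least product of exponents is reached only at the corner; this
  -- isolates the lowest coefficient of a product.
  ∙-≮ : ∀ {s d t d′} → ¬ (s < d) → ¬ (t < d′) → (s ≡ d × t ≡ d′) ⊎ (d ∙ d′ < s ∙ t)
  ∙-≮ {s} {d} {t} {d′} s≮d t≮d′ with compare s d | compare t d′
  ... | tri< s<d _ _    | _               = contradiction s<d s≮d
  ... | tri≈ _ _ _      | tri< t<d′ _ _   = contradiction t<d′ t≮d′
  ... | tri≈ _ s≡d _    | tri≈ _ t≡d′ _   = inj₁ (s≡d , t≡d′)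
  ... | tri≈ _ ≡.refl _ | tri> _ _ d′<t   = inj₂ (∙-monoʳ-< d d′<t)
  ... | tri> _ _ d<s    | tri< t<d′ _ _   = contradiction t<d′ t≮d′
  ... | tri> _ _ d<s    | tri≈ _ ≡.refl _ = inj₂ (∙-monoˡ-< t d<s)
  ... | tri> _ _ d<s    | tri> _ _ d′<t   = inj₂ (<-trans (∙-monoˡ-< d′ d<s) (∙-monoʳ-< s d′<t))

module LowestTerms {c ℓ} (R : Ring₂ c ℓ) {M : DecMonoid} (O : MonoidOrder M) where
  private
    module R = Ring₂ R
    module M = DecMonoid M
    module O = MonoidOrder O
  open M using (_∙_)
  open O using (_<_)
  open MonoidAlgebra R M
  private
    module A = Ring₂ algebra
    module L = Linear (idHom R)

  VanishesBelow : Alg → M.Carrier → Set ℓ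
  VanishesBelow p d = ∀ e → e < d → coeff p e R.≈ R.0#

  private
    -- A list whose coefficients vanish below `d` may still contain terms there that cancel.
    -- Discarding them leaves a list on which `lin` meets no monomial below `d`.
    above : M.Carrier → Alg → Alg
    above d []            = []
    above d ((a , m) ∷ p) with O.compare m d
    ... | tri< _ _ _ = above d p
    ... | tri≈ _ _ _ = (a , m) ∷ above d p
    ... | tri> _ _ _ = (a , m) ∷ above d p

    coeff-above-< : ∀ d p e → e < d → coeff (above d p) e R.≈ R.0#
    coeff-above-< d []            e e<d = R.refl
    coeff-above-< d ((a , m) ∷ p) e e<d with O.compare m d
    ... | tri< _ _ _    = coeff-above-< d p e e<d
    ... | tri≈ _ m≡d _  = R.trans (R.+-cong (R.trans (R.*-congˡ (δ-≢ λ e≡m → O.<-irrefl (≡.subst (_< d) (≡.trans e≡m m≡d) e<d))) (R.zeroʳ a)) (coeff-above-< d p e e<d)) (R.+-identityˡ _)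
    ... | tri> m≮d _ _  = R.trans (R.+-cong (R.trans (R.*-congˡ (δ-≢ λ e≡m → m≮d (≡.subst (_< d) e≡m e<d))) (R.zeroʳ a)) (coeff-above-< d p e e<d)) (R.+-identityˡ _)

    coeff-above-≮ : ∀ d p e → ¬ (e < d) → coeff (above d p) e R.≈ coeff p e
    coeff-above-≮ d []            e e≮d = R.refl
    coeff-above-≮ d ((a , m) ∷ p) e e≮d with O.compare m d
    ... | tri< m<d _ _ = R.trans (coeff-above-≮ d p e e≮d) (R.sym (R.trans
            (R.+-congʳ (R.trans (R.*-congˡ (δ-≢ λ e≡m → e≮d (≡.subst (_< d) (≡.sym e≡m) m<d))) (R.zeroʳ a)))
            (R.+-identityˡ _)))
    ... | tri≈ _ _ _   = R.+-congˡ (coeff-above-≮ d p e e≮d)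
    ... | tri> _ _ _   = R.+-congˡ (coeff-above-≮ d p e e≮d)

    above≈ : ∀ d p → VanishesBelow p d → above d p A.≈ p
    above≈ d p v = coeffs agree
      where
      agree : ∀ e → coeff (above d p) e R.≈ coeff p e
      agree e with O.compare e d
      ... | tri< e<d _ _ = R.trans (coeff-above-< d p e e<d) (R.sym (v e e<d))
      ... | tri≈ e≮d _ _ = coeff-above-≮ d p e e≮d
      ... | tri> e≮d _ _ = coeff-above-≮ d p e e≮d

    lin-above-cong : ∀ d {φ ψ} → (∀ m → ¬ (m < d) → φ m R.≈ ψ m) → ∀ p → L.lin φ (above d p) R.≈ L.lin ψ (above d p)
    lin-above-cong d φ≈ψ []            = R.refl
    lin-above-cong d φ≈ψ ((a , m) ∷ p) with O.compare m d
    ... | tri< _ _ _   = lin-above-cong d φ≈ψ p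
    ... | tri≈ m≮d _ _ = R.+-cong (R.*-congˡ (φ≈ψ m m≮d)) (lin-above-cong d φ≈ψ p)
    ... | tri> m≮d _ _ = R.+-cong (R.*-congˡ (φ≈ψ m m≮d)) (lin-above-cong d φ≈ψ p)

    lin-cong-above : ∀ d {φ ψ} → (∀ m → ¬ (m < d) → φ m R.≈ ψ m) →
                     ∀ p → VanishesBelow p d → L.lin φ p R.≈ L.lin ψ p
    lin-cong-above d {φ} {ψ} φ≈ψ p v = R.trans (L.lin-resp φ (A.sym (above≈ d p v)))
      (R.trans (lin-above-cong d φ≈ψ p) (L.lin-resp ψ (above≈ d p v)))

    coeff-*-via : ∀ {p d q d′} → VanishesBelow p d → VanishesBelow q d′ → ∀ e (Φ : M.Carrier → M.Carrier → R.Carrier) →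
      (∀ s t → ¬ (s < d) → ¬ (t < d′) → δ e (s ∙ t) R.≈ Φ s t) →
      coeff (p A.* q) e R.≈ L.lin (λ s → L.lin (Φ s) q) p
    coeff-*-via {p} {d} {q} {d′} vp vq e Φ agree = R.trans (L.lin-* (δ e) p q)
      (lin-cong-above d (λ s s≮d → lin-cong-above d′ (λ t t≮d′ → agree s t s≮d t≮d′) q vq) p vp)

  -- On monomials that are not below the bounds, the indicator of `s ∙ t` being `d ∙ d′` factors
  -- into the indicators of `s` and of `t`.
  coeff-*-lowest : ∀ {p d q d′} → VanishesBelow p d → VanishesBelow q d′ →
                   coeff (p A.* q) (d ∙ d′) R.≈ coeff p d R.* coeff q d′
  coeff-*-lowest {p} {d} {q} {d′} vp vq = begin
    coeff (p A.* q) (d ∙ d′)                                ≈⟨ coeff-*-via {p} {d} {q} {d′} vp vq (d ∙ d′) _ agree ⟩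
    L.lin (λ s → L.lin (λ t → δ d s R.* δ d′ t) q) p        ≈⟨ L.lin-cong (λ s → L.lin-*ˡ (δ d s) (δ d′) q) p ⟩
    L.lin (λ s → δ d s R.* coeff q d′) p                    ≈⟨ L.lin-*ʳ (coeff q d′) (δ d) p ⟩
    coeff p d R.* coeff q d′                                ∎
    where
    open R.≈-Reasoning
    agree : ∀ s t → ¬ (s < d) → ¬ (t < d′) → δ (d ∙ d′) (s ∙ t) R.≈ δ d s R.* δ d′ t
    agree s t s≮d t≮d′ with O.∙-≮ s≮d t≮d′
    ... | inj₁ (≡.refl , ≡.refl) = R.trans (δ-refl (d ∙ d′)) (R.sym (R.trans (R.*-cong (δ-refl d) (δ-refl d′)) (R.*-identityˡ _)))
    ... | inj₂ dd′<st = R.trans (δ-≢ (λ eq → O.<-irrefl (≡.subst (_< s ∙ t) eq dd′<st))) (R.sym zero-product)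
      where
      zero-product : δ d s R.* δ d′ t R.≈ R.0#
      zero-product with d M.≟ s | d′ M.≟ t
      ... | yes ≡.refl | yes ≡.refl = contradiction dd′<st O.<-irrefl
      ... | yes _      | no _       = R.zeroʳ _
      ... | no  _      | _          = R.zeroˡ _

  *-vanishesBelow : ∀ {p d q d′} → VanishesBelow p d → VanishesBelow q d′ → VanishesBelow (p A.* q) (d ∙ d′)
  *-vanishesBelow {p} {d} {q} {d′} vp vq e e<dd′ = R.trans (coeff-*-via {p} {d} {q} {d′} vp vq e (λ _ _ → R.0#) agree)
    (R.trans (L.lin-cong (λ _ → L.lin-0 q) p) (L.lin-0 p))
    where
    agree : ∀ s t → ¬ (s < d) → ¬ (t < d′) → δ e (s ∙ t) R.≈ R.0#
    agree s t s≮d t≮d′ with O.∙-≮ s≮d t≮d′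
    ... | inj₁ (≡.refl , ≡.refl) = δ-≢ (λ e≡ → O.<-irrefl (≡.subst (_< d ∙ d′) e≡ e<dd′))
    ... | inj₂ dd′<st = δ-≢ (λ e≡ → O.<-irrefl (O.<-trans dd′<st (≡.subst (_< d ∙ d′) e≡ e<dd′)))

  module _ (stable : ∀ {x} → ¬ ¬ (x R.≈ R.0#) → x R.≈ R.0#)
           (cancel : ∀ {x y} → x R.* y R.≈ R.0# → ¬ (y R.≈ R.0#) → x R.≈ R.0#) where

    private
      -- In continuation form: vanishing of a coefficient is not decidable, so by well-founded
      -- descent a least nonvanishing exponent exists only up to double negation.
      lowest : ∀ p e → ¬ (coeff p e R.≈ R.0#) →
               (∀ d → ¬ (coeff p d R.≈ R.0#) → VanishesBelow p d → ⊥) → ⊥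
      lowest p e pₑ≉0 k = go e (O.wellFounded e) pₑ≉0
        where
        go : ∀ e → Acc _<_ e → ¬ (coeff p e R.≈ R.0#) → ⊥
        go e (acc rs) pₑ≉0 = k e pₑ≉0 λ e′ e′<e → stable (go e′ (rs e′<e))

    algebra-cancel : ∀ {p q} → p A.* q A.≈ A.0# → ¬ (q A.≈ A.0#) → p A.≈ A.0#
    algebra-cancel {p} {q} pq≈0 q≉0 = coeffs λ e → stable λ pₑ≉0 →
      q≉0 (coeffs λ e′ → stable λ qₑ≉0 →
        lowest p e pₑ≉0 λ d p_d≉0 vp →
        lowest q e′ qₑ≉0 λ d′ q_d≉0 vq →
        p_d≉0 (cancel (R.trans (R.sym (coeff-*-lowest {p} {d} {q} {d′} vp vq)) (coeff≈ pq≈0 (d ∙ d′))) q_d≉0))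

ℕ-monoid : DecMonoid
ℕ-monoid = record
  { Carrier = ℕ ; _∙_ = ℕ._+_ ; ε = 0 ; assoc = ℕ.+-assoc ; comm = ℕ.+-comm
  ; identityˡ = λ _ → ≡.refl ; _≟_ = ℕ._≟_ }

ℕ-order : MonoidOrder ℕ-monoid
ℕ-order = record
  { _<_ = ℕ._<_ ; compare = ℕ.<-cmp ; <-trans = ℕ.<-trans ; ∙-monoˡ-< = λ z x<y → ℕ.+-monoˡ-< z x<y ; wellFounded = <-wellFounded }

Vec-monoid : ℕ → DecMonoid
Vec-monoid n = record
  { Carrier = Vec ℕ n ; _∙_ = zipWith ℕ._+_ ; ε = replicate n 0
  ; assoc = Vec.zipWith-assoc ℕ.+-assoc ; comm = Vec.zipWith-comm ℕ.+-comm
  ; identityˡ = Vec.zipWith-identityˡ λ _ → ≡.refl ; _≟_ = Vec.≡-dec ℕ._≟_ }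

Vec-order : ∀ n → MonoidOrder (Vec-monoid n)
Vec-order n = record
  { _<_         = Lex-< _≡_ ℕ._<_
  ; compare     = compare
  ; <-trans     = Lex.<-trans (record { sym = ≡.sym ; trans = ≡.trans }) ℕ.<-resp₂-≡ ℕ.<-trans
  ; ∙-monoˡ-<   = mono
  ; wellFounded = Lex.<-wellFounded ≡.trans (proj₁ ℕ.<-resp₂-≡) <-wellFounded
  }
  where
  compare : ∀ {n} → Trichotomous _≡_ (Lex-< {A = ℕ} _≡_ ℕ._<_ {n} {n})
  compare x y with Lex.<-cmp ≡.sym ℕ.<-cmp x y
  ... | tri< x<y x≢y x≯y = tri< x<y (x≢y ∘ ≡⇒Pointwise-≡) x≯y
  ... | tri≈ x≮y x≡y x≯y = tri≈ x≮y (Pointwise-≡⇒≡ x≡y) x≯y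
  ... | tri> x≮y x≢y x>y = tri> x≮y (x≢y ∘ ≡⇒Pointwise-≡) x>y
  mono : ∀ {n} {x y : Vec ℕ n} z → Lex-< _≡_ ℕ._<_ x y → Lex-< _≡_ ℕ._<_ (zipWith ℕ._+_ x z) (zipWith ℕ._+_ y z)
  mono []      (Lex.base ())
  mono (z ∷ _) (Lex.this x<y _)         = Lex.this (ℕ.+-monoˡ-< z x<y) ≡.refl
  mono (z ∷ zs) (Lex.next ≡.refl xs<ys) = Lex.next ≡.refl (mono zs xs<ys)

∙-injective-Vec : ∀ {n} {x y : Vec ℕ n} → zipWith ℕ._+_ x x ≡ zipWith ℕ._+_ y y → x ≡ y
∙-injective-Vec {x = []}     {[]}     _  = ≡.refl
∙-injective-Vec {x = x ∷ xs} {y ∷ ys} eq = ≡.cong₂ _∷_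
  (double-injective x y (Vec.∷-injectiveˡ eq)) (∙-injective-Vec (Vec.∷-injectiveʳ eq))
  where
  double-injective : ∀ a b → a ℕ.+ a ≡ b ℕ.+ b → a ≡ b
  double-injective a b eq = ℕ.*-cancelˡ-≡ a b 2
    (≡.trans (≡.cong (a ℕ.+_) (ℕ.+-identityʳ a)) (≡.trans eq (≡.cong (b ℕ.+_) (≡.sym (ℕ.+-identityʳ b)))))

-- Cyclic sums, geometric sums and inverses modulo p.

module CyclicSum {c ℓ} (M : CommutativeMonoid c ℓ) where
  open CommutativeMonoid M
  open Algebra.Properties.CommutativeMonoid.Sum M

  sum-snoc : ∀ n (h : ℕ → Carrier) → sum {suc n} (λ k → h (Fin.toℕ k)) ≈ sum {n} (λ k → h (Fin.toℕ k)) ∙ h n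
  sum-snoc zero    h = comm (h 0) ε
  sum-snoc (suc n) h = trans (∙-congˡ (sum-snoc n (h ∘ suc))) (sym (assoc _ _ _))

  -- Holds in any commutative monoid, since it is applied both to Fourier sums and to products over
  -- an orbit.
  sum-cyclic : ∀ n (h : ℕ → Carrier) → h n ≈ h 0 → sum {n} (λ k → h (suc (Fin.toℕ k))) ≈ sum {n} (λ k → h (Fin.toℕ k))
  sum-cyclic zero    h hₙ≈h₀ = refl
  sum-cyclic (suc n) h hₙ≈h₀ = begin
    sum {suc n} (λ k → h (suc (Fin.toℕ k)))              ≈⟨ sum-snoc n (h ∘ suc) ⟩
    sum {n} (λ k → h (suc (Fin.toℕ k))) ∙ h (suc n)      ≈⟨ ∙-congˡ hₙ≈h₀ ⟩
    sum {n} (λ k → h (suc (Fin.toℕ k))) ∙ h 0            ≈⟨ comm _ _ ⟩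
    sum {suc n} (λ k → h (Fin.toℕ k))                    ∎
    where open import Relation.Binary.Reasoning.Setoid setoid

module GeometricSums {c ℓ} (R : Ring₂ c ℓ) where
  open Ring₂ R
  open CyclicSum +-commutativeMonoid

  -- The induction rests on 1 + x^(n+1) = (1 + x) + x (1 + x^n), where two copies of x cancel.
  1+x^n-factor : ∀ x n → ∃[ g ] 1# + x ^ n ≈ (1# + x) * g
  1+x^n-factor x zero    = 0# , trans (x+x≈0 1#) (sym (zeroʳ _))
  1+x^n-factor x (suc n) with g , eq ← 1+x^n-factor x n = 1# + x * g , (begin
    1# + x * x ^ n                        ≈⟨ +-congʳ (trans (+-assoc 1# x x) (trans (+-congˡ (x+x≈0 x)) (+-identityʳ 1#))) ⟨
    ((1# + x) + x) + x * x ^ n            ≈⟨ +-assoc _ _ _ ⟩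
    (1# + x) + (x + x * x ^ n)            ≈⟨ +-congˡ (+-congʳ (*-identityʳ x)) ⟨
    (1# + x) + (x * 1# + x * x ^ n)       ≈⟨ +-congˡ (distribˡ x 1# _) ⟨
    (1# + x) + x * (1# + x ^ n)           ≈⟨ +-congˡ (*-congˡ eq) ⟩
    (1# + x) + x * ((1# + x) * g)         ≈⟨ +-congˡ (x*[y*z]≈y*[x*z] x _ g) ⟩
    (1# + x) + (1# + x) * (x * g)         ≈⟨ +-congʳ (*-identityʳ _) ⟨
    (1# + x) * 1# + (1# + x) * (x * g)    ≈⟨ distribˡ _ 1# _ ⟨
    (1# + x) * (1# + x * g)               ∎)
    where open ≈-Reasoning

  -- Multiplication by `x` permutes the powers of `x` cyclically, so it fixes their sum.
  1+x*geometric : ∀ x n → x ^ n ≈ 1# → (1# + x) * sum {n} (λ a → x ^ Fin.toℕ a) ≈ 0#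
  1+x*geometric x n xⁿ≈1 = begin
    (1# + x) * s       ≈⟨ distribʳ s 1# x ⟩
    1# * s + x * s     ≈⟨ +-cong (*-identityˡ s) (trans (*-distribˡ-sum {n} x _) (sum-cyclic n (x ^_) xⁿ≈1)) ⟩
    s + s              ≈⟨ x+x≈0 s ⟩
    0#                 ∎
    where
    open ≈-Reasoning
    s = sum {n} (λ a → x ^ Fin.toℕ a)

  ^-periodic : ∀ {x} n .{{_ : NonZero n}} → x ^ n ≈ 1# → ∀ k → x ^ k ≈ x ^ (k % n)
  ^-periodic {x} n xⁿ≈1 k = begin
    x ^ k                              ≡⟨ ≡.cong (x ^_) (m≡m%n+[m/n]*n k n) ⟩
    x ^ (k % n ℕ.+ k / n ℕ.* n)        ≈⟨ ^-homo-* x (k % n) _ ⟩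
    x ^ (k % n) * x ^ (k / n ℕ.* n)    ≡⟨ ≡.cong (λ e → x ^ (k % n) * x ^ e) (ℕ.*-comm (k / n) n) ⟩
    x ^ (k % n) * x ^ (n ℕ.* (k / n))  ≈⟨ *-congˡ (^-assocʳ x n (k / n)) ⟨
    x ^ (k % n) * (x ^ n) ^ (k / n)    ≈⟨ *-congˡ (trans (^-congˡ (k / n) xⁿ≈1) (1^n≈1 (k / n))) ⟩
    x ^ (k % n) * 1#                   ≈⟨ *-identityʳ _ ⟩
    x ^ (k % n)                        ∎
    where open ≈-Reasoning

inverse-mod : ∀ {p} (pr : Prime p) r → let instance _ = prime⇒nonZero pr in
              r % p ≢ 0 → ∃[ s ] (r ℕ.* s) % p ≡ 1
inverse-mod {p} pr r r%p≢0 = from-Bézout (coprime-Bézout (prime⇒coprime pr {{ℕ.≢-nonZero r%p≢0}} (m%n<n r p)))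
  where
  instance _ = prime⇒nonZero pr
  1%p≡1 : 1 % p ≡ 1
  1%p≡1 = m<n⇒m%n≡m (ℕ.nonTrivial⇒n>1 p {{prime⇒nonTrivial pr}})
  reduce : ∀ s → (r % p ℕ.* s) % p ≡ 1 → (r ℕ.* s) % p ≡ 1
  reduce s eq = ≡.trans (%-distribˡ-* r s p)
    (≡.trans (≡.cong (λ t → (t ℕ.* (s % p)) % p) (≡.sym (m%n%n≡m%n r p)))
    (≡.trans (≡.sym (%-distribˡ-* (r % p) s p)) eq))
  from-Bézout : Bézout.Identity 1 p (r % p) → ∃[ s ] (r ℕ.* s) % p ≡ 1
  from-Bézout (Bézout.-+ x y eq) = y , reduce y
    (≡.trans (≡.cong (_% p) (≡.trans (ℕ.*-comm (r % p) y) (≡.sym eq)))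
      (≡.trans ([m+kn]%n≡m%n 1 x p) 1%p≡1))
  -- Here `suc w` is a multiple of `p`, so `w` is -1 modulo `p` and `w * w` is 1. As `w` is `y`
  -- times the residue of `r`, the inverse of `r` is `y * w`.
  from-Bézout (Bézout.+- x y eq) = y ℕ.* w , reduce (y ℕ.* w) (begin
    (r % p ℕ.* (y ℕ.* w)) % p             ≡⟨ ≡.cong (_% p) (≡.sym (ℕ.*-assoc (r % p) y w)) ⟩
    (r % p ℕ.* y ℕ.* w) % p               ≡⟨ ≡.cong (λ t → (t ℕ.* w) % p) (ℕ.*-comm (r % p) y) ⟩
    (w ℕ.* w) % p                         ≡⟨ [m+kn]%n≡m%n (w ℕ.* w) x p ⟨
    (w ℕ.* w ℕ.+ x ℕ.* p) % p             ≡⟨ ≡.cong (λ t → (w ℕ.* w ℕ.+ t) % p) (≡.sym eq) ⟩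
    (w ℕ.* w ℕ.+ suc w) % p               ≡⟨ ≡.cong (_% p) (≡.trans (ℕ.+-suc (w ℕ.* w) w) (≡.cong suc (ℕ.+-comm (w ℕ.* w) w))) ⟩
    (1 ℕ.+ suc w ℕ.* w) % p               ≡⟨ ≡.cong (λ t → (1 ℕ.+ t ℕ.* w) % p) eq ⟩
    (1 ℕ.+ x ℕ.* p ℕ.* w) % p             ≡⟨ ≡.cong (λ t → (1 ℕ.+ t) % p) (≡.trans (ℕ.*-assoc x p w) (≡.trans (≡.cong (x ℕ.*_) (ℕ.*-comm p w)) (≡.sym (ℕ.*-assoc x w p)))) ⟩
    (1 ℕ.+ x ℕ.* w ℕ.* p) % p             ≡⟨ [m+kn]%n≡m%n 1 (x ℕ.* w) p ⟩
    1 % p                                 ≡⟨ 1%p≡1 ⟩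
    1                                     ∎)
    where
    open ≡.≡-Reasoning
    w = y ℕ.* (r % p)

-- Adjoining a root of unity of order p.

-- With θ = 1 + ζ in R[ℤ/p] this kills 1 + ζ + … + ζ^(p-1), which makes ζ a root of unity of exact
-- order p without a choice of irreducible factor.
module Annihilator {c ℓ} (R : Ring₂ c ℓ) (θ : Ring₂.Carrier R) where
  private module R = Ring₂ R
  open R using (_*_; _+_; _≈_)

  infix 4 _≈θ_
  record _≈θ_ (x y : R.Carrier) : Set ℓ where
    constructor times
    field scaled : θ * x ≈ θ * y
  open _≈θ_ public

  private
    cong-from-R : ∀ {x y} → x ≈ y → x ≈θ y
    cong-from-R x≈y = times (R.*-congˡ x≈y)

    ≈θ-trans : ∀ {x y z} → x ≈θ y → y ≈θ z → x ≈θ z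
    ≈θ-trans (times f) (times g) = times (R.trans f g)

    *-congʳθ : ∀ {x y} z → x ≈θ y → x * z ≈θ y * z
    *-congʳθ {x} {y} z (times f) = times (R.trans (R.sym (R.*-assoc _ _ _)) (R.trans (R.*-congʳ f) (R.*-assoc _ _ _)))

  quotient : Ring₂ c ℓ
  quotient = record
    { commutativeSemiring = record
      { Carrier = R.Carrier ; _≈_ = _≈θ_ ; _+_ = R._+_ ; _*_ = R._*_ ; 0# = R.0# ; 1# = R.1#
      ; isCommutativeSemiring = isCommutativeSemiringˡ record
        { +-isCommutativeMonoid = record
          { isMonoid = record
            { isSemigroup = record
              { isMagma = record
                { isEquivalence = isEquivalence
                ; ∙-cong = λ f g → times (R.trans (R.distribˡ _ _ _) (R.trans (R.+-cong (scaled f) (scaled g)) (R.sym (R.distribˡ _ _ _)))) }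
              ; assoc = λ x y z → cong-from-R (R.+-assoc x y z) }
            ; identity = cong-from-R ∘ R.+-identityˡ , cong-from-R ∘ R.+-identityʳ }
          ; comm = λ x y → cong-from-R (R.+-comm x y) }
        ; *-isCommutativeMonoid = record
          { isMonoid = record
            { isSemigroup = record
              { isMagma = record
                { isEquivalence = isEquivalence
                ; ∙-cong = λ {x} {y} {u} {v} f g → ≈θ-trans (*-congʳθ u f)
                    (≈θ-trans (cong-from-R (R.*-comm y u)) (≈θ-trans (*-congʳθ y g) (cong-from-R (R.*-comm v y)))) }
              ; assoc = λ x y z → cong-from-R (R.*-assoc x y z) }
            ; identity = cong-from-R ∘ R.*-identityˡ , cong-from-R ∘ R.*-identityʳ }
          ; comm = λ x y → cong-from-R (R.*-comm x y) }
        ; distribʳ = λ x y z → cong-from-R (R.distribʳ x y z)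
        ; zeroˡ = λ x → cong-from-R (R.zeroˡ x)
        } }
    ; x+x≈0 = λ x → cong-from-R (R.x+x≈0 x)
    }
    where
    open import Algebra.Structures.Biased _≈θ_ using (isCommutativeSemiringˡ)
    isEquivalence : IsEquivalence _≈θ_
    isEquivalence = record
      { refl = times R.refl ; sym = λ f → times (R.sym (scaled f)) ; trans = ≈θ-trans }

  ≈θ0 : ∀ {x} → x ≈θ R.0# → θ * x ≈ R.0#
  ≈θ0 (times f) = R.trans f (R.zeroʳ θ)

  0≈θ : ∀ {x} → θ * x ≈ R.0# → x ≈θ R.0#
  0≈θ f = times (R.trans f (R.sym (R.zeroʳ θ)))

  projection : Hom R quotient
  projection = record
    { ⟦_⟧ = id ; cong = cong-from-R ; +-homo = λ _ _ → Q.refl ; *-homo = λ _ _ → Q.refl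
    ; 0-homo = Q.refl ; 1-homo = Q.refl }
    where module Q = Ring₂ quotient

  -- The square of `θ * x` is a multiple of `θ * (θ * x)`. Hence `θ` is not a zero divisor modulo
  -- its own annihilator.
  square-kill : R.Reduced → ∀ x → θ * (θ * x) ≈ R.0# → θ * x ≈ R.0#
  square-kill red x θθx≈0 = red _ (begin
    (θ * x) * (θ * x)  ≈⟨ R.*-assoc _ _ _ ⟩
    θ * (x * (θ * x))  ≈⟨ R.*-congˡ (R.x*[y*z]≈y*[x*z] _ _ _) ⟩
    θ * (θ * (x * x))  ≈⟨ R.trans (R.sym (R.*-assoc _ _ _)) (R.trans (R.sym (R.*-assoc _ _ _)) (R.*-congʳ (R.*-assoc _ _ _))) ⟩
    (θ * (θ * x)) * x  ≈⟨ R.*-congʳ θθx≈0 ⟩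
    R.0# * x           ≈⟨ R.zeroˡ x ⟩
    R.0#               ∎)
    where open R.≈-Reasoning

  -- The square of `θ * x` is also `θ` times `θ * (x * x)`, which vanishes when `x * x` does in the
  -- quotient.
  quotient-reduced : R.Reduced → Ring₂.Reduced quotient
  quotient-reduced red x x²≈0 = 0≈θ (red _ (begin
    (θ * x) * (θ * x)  ≈⟨ R.*-assoc _ _ _ ⟩
    θ * (x * (θ * x))  ≈⟨ R.*-congˡ (R.x*[y*z]≈y*[x*z] _ _ _) ⟩
    θ * (θ * (x * x))  ≈⟨ R.*-congˡ (≈θ0 x²≈0) ⟩
    θ * R.0#           ≈⟨ R.zeroʳ θ ⟩
    R.0#               ∎))
    where open R.≈-Reasoning

module _ (p : ℕ) .{{_ : NonZero p}} where

  toℕ-mod : ∀ a → Fin.toℕ (a mod p) ≡ a % p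
  toℕ-mod a = Fin.toℕ-fromℕ< (m%n<n a p)

  mod-cong : ∀ {a b} → a % p ≡ b % p → a mod p ≡ b mod p
  mod-cong {a} {b} eq = Fin.toℕ-injective (≡.trans (toℕ-mod a) (≡.trans eq (≡.sym (toℕ-mod b))))

  toℕ%-id : (i : Fin p) → Fin.toℕ i % p ≡ Fin.toℕ i
  toℕ%-id i = m<n⇒m%n≡m (Fin.toℕ<n i)

  toℕ-mod-id : (i : Fin p) → Fin.toℕ i mod p ≡ i
  toℕ-mod-id i = Fin.toℕ-injective (≡.trans (toℕ-mod (Fin.toℕ i)) (toℕ%-id i))

  %-absorbˡ : ∀ a b → (a % p ℕ.+ b) % p ≡ (a ℕ.+ b) % p
  %-absorbˡ a b = ≡.trans (%-distribˡ-+ (a % p) b p)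
    (≡.trans (≡.cong (λ t → (t ℕ.+ b % p) % p) (m%n%n≡m%n a p)) (≡.sym (%-distribˡ-+ a b p)))

  %-absorbʳ : ∀ a b → (a ℕ.+ b % p) % p ≡ (a ℕ.+ b) % p
  %-absorbʳ a b = ≡.trans (≡.cong (_% p) (ℕ.+-comm a (b % p)))
    (≡.trans (%-absorbˡ b a) (≡.cong (_% p) (ℕ.+-comm b a)))

  ℤ/-monoid : DecMonoid
  ℤ/-monoid = record
    { Carrier   = Fin p
    ; _∙_       = λ a b → (Fin.toℕ a ℕ.+ Fin.toℕ b) mod p
    ; ε         = 0 mod p
    ; assoc     = λ a b c → mod-cong (≡.trans
        (≡.trans (≡.cong (λ t → (t ℕ.+ Fin.toℕ c) % p) (toℕ-mod _)) (%-absorbˡ _ (Fin.toℕ c)))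
        (≡.trans (≡.cong (_% p) (ℕ.+-assoc (Fin.toℕ a) (Fin.toℕ b) (Fin.toℕ c)))
          (≡.sym (≡.trans (≡.cong (λ t → (Fin.toℕ a ℕ.+ t) % p) (toℕ-mod _)) (%-absorbʳ (Fin.toℕ a) _)))))
    ; comm      = λ a b → ≡.cong (_mod p) (ℕ.+-comm (Fin.toℕ a) (Fin.toℕ b))
    ; identityˡ = λ a → ≡.trans (mod-cong (≡.trans (≡.cong (λ t → (t ℕ.+ Fin.toℕ a) % p) (toℕ-mod 0)) (%-absorbˡ 0 (Fin.toℕ a))))
                               (toℕ-mod-id a)
    ; _≟_       = Fin._≟_
    }

  private module Z = DecMonoid ℤ/-monoid

  mod-∙ : ∀ a b → (a mod p) Z.∙ (b mod p) ≡ (a ℕ.+ b) mod p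
  mod-∙ a b = mod-cong (≡.trans (≡.cong₂ (λ s t → (s ℕ.+ t) % p) (toℕ-mod a) (toℕ-mod b)) (≡.sym (%-distribˡ-+ a b p)))

  -- (p+1)/2 inverts doubling modulo p.
  ∙-injective-ℤ/ : ∀ h → h ℕ.+ h ≡ suc p → ∀ {a b} → a Z.∙ a ≡ b Z.∙ b → a ≡ b
  ∙-injective-ℤ/ h 2h≡1+p {a} {b} eq = ≡.trans (≡.sym (halve a)) (≡.trans (≡.cong (λ c → (Fin.toℕ c ℕ.* h) mod p) eq) (halve b))
    where
    halve : ∀ a → (Fin.toℕ (a Z.∙ a) ℕ.* h) mod p ≡ a
    halve a = Fin.toℕ-injective (begin
      Fin.toℕ ((Fin.toℕ (a Z.∙ a) ℕ.* h) mod p)        ≡⟨ toℕ-mod _ ⟩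
      (Fin.toℕ (a Z.∙ a) ℕ.* h) % p                    ≡⟨ ≡.cong (λ t → (t ℕ.* h) % p) (toℕ-mod _) ⟩
      ((x ℕ.+ x) % p ℕ.* h) % p                        ≡⟨ %-distribˡ-* ((x ℕ.+ x) % p) h p ⟩
      ((x ℕ.+ x) % p % p ℕ.* (h % p)) % p              ≡⟨ ≡.cong (λ t → (t ℕ.* (h % p)) % p) (m%n%n≡m%n (x ℕ.+ x) p) ⟩
      ((x ℕ.+ x) % p ℕ.* (h % p)) % p                  ≡⟨ %-distribˡ-* (x ℕ.+ x) h p ⟨
      ((x ℕ.+ x) ℕ.* h) % p                            ≡⟨ ≡.cong (_% p) (≡.trans (ℕ.*-distribʳ-+ h x x) (≡.sym (ℕ.*-distribˡ-+ x h h))) ⟩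
      (x ℕ.* (h ℕ.+ h)) % p                            ≡⟨ ≡.cong (λ t → (x ℕ.* t) % p) 2h≡1+p ⟩
      (x ℕ.* suc p) % p                                ≡⟨ ≡.cong (_% p) (ℕ.*-suc x p) ⟩
      (x ℕ.+ x ℕ.* p) % p                              ≡⟨ [m+kn]%n≡m%n x x p ⟩
      x % p                                            ≡⟨ toℕ%-id a ⟩
      x                                                ∎)
      where
      open ≡.≡-Reasoning
      x = Fin.toℕ a

-- Exact order `p` is expressed by `regular`: in a ring that may have zero divisors, 1 + ζ^r has to
-- be cancellable and not merely nonzero.
record RootOfUnity {c ℓ} (B : Ring₂ c ℓ) (p : ℕ) .{{_ : NonZero p}} : Set (c ⊔ ℓ) where
  open Ring₂ B
  field
    ζ       : Carrier
    ζ^p≈1   : ζ ^ p ≈ 1#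
    regular : ∀ r x → r % p ≢ 0 → (1# + ζ ^ r) * x ≈ 0# → x ≈ 0#

  geometric : ∀ r → r % p ≢ 0 → sum {p} (λ a → (ζ ^ r) ^ Fin.toℕ a) ≈ 0#
  geometric r p∤r = regular r _ p∤r (GeometricSums.1+x*geometric B (ζ ^ r) p
    (trans (^-assocʳ ζ r p) (trans (^-congʳ ζ (ℕ.*-comm r p)) (trans (sym (^-assocʳ ζ p r))
      (trans (^-congˡ r ζ^p≈1) (1^n≈1 r))))))

module AnnihilatorRoot {c ℓ} (A : Ring₂ c ℓ) (red : Ring₂.Reduced A) {p} (pr : Prime p)
  (ζ : Ring₂.Carrier A) where
  private
    instance _ = prime⇒nonZero pr
    module A = Ring₂ A
  open A using (_*_; _+_; _^_; 1#; 0#; _≈_)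
  open Annihilator A (1# + ζ)
  private
    module π = Hom projection
    module Q = Ring₂ quotient

    θ = 1# + ζ

    -- As `r` is invertible modulo the prime `p`, ζ is a power of ζ^r, so `θ` is a multiple of 1 +
    -- ζ^r. Whatever 1 + ζ^r kills in the quotient is thus killed by `θ`, which is regular there by
    -- `square-kill`.
    regular-A : ζ ^ p ≈ 1# → ∀ r x → r % p ≢ 0 → θ * ((1# + ζ ^ r) * x) ≈ 0# → θ * x ≈ 0#
    regular-A ζ^p≈1 r x p∤r eq
      with s , rs≡1 ← inverse-mod pr r p∤r
      with g , factor ← GeometricSums.1+x^n-factor A (ζ ^ r) s =
      square-kill red x (begin
        θ * (θ * x)                     ≈⟨ A.*-congˡ (A.*-congʳ (A.+-congˡ ζ≈)) ⟩
        θ * ((1# + (ζ ^ r) ^ s) * x)    ≈⟨ A.*-congˡ (A.*-congʳ factor) ⟩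
        θ * (((1# + ζ ^ r) * g) * x)    ≈⟨ A.*-congˡ (A.trans (A.*-congʳ (A.*-comm _ g)) (A.*-assoc g _ x)) ⟩
        θ * (g * ((1# + ζ ^ r) * x))    ≈⟨ A.x*[y*z]≈y*[x*z] θ g _ ⟩
        g * (θ * ((1# + ζ ^ r) * x))    ≈⟨ A.*-congˡ eq ⟩
        g * 0#                          ≈⟨ A.zeroʳ g ⟩
        0#                              ∎)
      where
      open A.≈-Reasoning
      ζ≈ : ζ ≈ (ζ ^ r) ^ s
      ζ≈ = A.sym (A.trans (A.^-assocʳ ζ r s) (A.trans (GeometricSums.^-periodic A p ζ^p≈1 (r ℕ.* s))
        (A.trans (A.^-congʳ ζ rs≡1) (A.*-identityʳ ζ))))

  rootOfUnity : ζ ^ p ≈ 1# → RootOfUnity quotient p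
  rootOfUnity ζ^p≈1 = record
    { ζ       = ζ
    ; ζ^p≈1   = Q.trans (Q.sym (π.^-homo ζ p)) (π.cong ζ^p≈1)
    ; regular = λ r x p∤r eq → 0≈θ (regular-A ζ^p≈1 r x p∤r
        (≈θ0 (Q.trans (Q.*-congʳ (Q.+-congˡ (π.^-homo ζ r))) eq)))
    }

module Adjoin-ζ {c ℓ} (R : Ring₂ c ℓ) (red : Ring₂.Reduced R) {p} (pr : Prime p)
  (h : ℕ) (2h≡1+p : h ℕ.+ h ≡ suc p) where
  private
    instance _ = prime⇒nonZero pr
    module R = Ring₂ R
    1<p : 1 ℕ.< p
    1<p = ℕ.nonTrivial⇒n>1 p {{prime⇒nonTrivial pr}}
    0%p≡0 : 0 % p ≡ 0
    0%p≡0 = m<n⇒m%n≡m (ℕ.<-trans (s≤s z≤n) 1<p)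
  open MonoidAlgebra R (ℤ/-monoid p)
  private
    module A = Ring₂ algebra
    ζ = mono (1 mod p)
    A-reduced : A.Reduced
    A-reduced = algebra-reduced (∙-injective-ℤ/ p h 2h≡1+p) red
  open Annihilator algebra (A.1# A.+ ζ)

  private
    ζ^n : ∀ n → ζ A.^ n A.≈ mono (n mod p)
    ζ^n zero    = A.refl
    ζ^n (suc n) = A.trans (A.*-congˡ {x = ζ} {ζ A.^ n} {mono (n mod p)} (ζ^n n))
      (A.trans (A.sym (mono-∙ (1 mod p) (n mod p))) (A.reflexive (≡.cong mono (mod-∙ p 1 n))))

    ζ^p≈1 : ζ A.^ p A.≈ A.1#
    ζ^p≈1 = A.trans (ζ^n p) (A.reflexive (≡.cong mono (mod-cong p (≡.trans (n%n≡0 p) (≡.sym 0%p≡0)))))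

  extension : Ring₂ c ℓ
  extension = quotient

  extension-reduced : Ring₂.Reduced extension
  extension-reduced = quotient-reduced A-reduced

  extension-root : RootOfUnity extension p
  extension-root = AnnihilatorRoot.rootOfUnity algebra A-reduced pr ζ ζ^p≈1

  embed : Hom R extension
  embed = projection ∘ʰ const

  -- The coefficient of a (1 + ζ) at the neutral element of ℤ/p is `a`, because 0 and 1 differ
  -- modulo `p`.
  embed-injective : ∀ a → Ring₂._≈_ extension (Hom.⟦ embed ⟧ a) (Ring₂.0# extension) → a R.≈ R.0#
  embed-injective a a≈0 = begin
    a                                                     ≈⟨ R.*-identityʳ a ⟨
    a R.* R.1#                                            ≈⟨ R.*-congˡ coeff-θ ⟨
    a R.* coeff θ (0 mod p)                               ≈⟨ coeff-const* a θ (0 mod p) ⟨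
    coeff (Hom.⟦ const ⟧ a A.* θ) (0 mod p)               ≈⟨ coeff≈ (A.trans (A.*-comm (Hom.⟦ const ⟧ a) θ) (≈θ0 a≈0)) (0 mod p) ⟩
    R.0#                                                  ∎
    where
    open R.≈-Reasoning
    θ = A.1# A.+ ζ
    0≢1 : 0 mod p ≢ 1 mod p
    0≢1 eq with () ← ≡.trans (≡.sym 0%p≡0) (≡.trans (≡.sym (toℕ-mod p 0)) (≡.trans (≡.cong Fin.toℕ eq) (≡.trans (toℕ-mod p 1) (m<n⇒m%n≡m 1<p))))
    coeff-θ : coeff θ (0 mod p) R.≈ R.1#
    coeff-θ = R.trans (R.+-cong (R.trans (R.*-identityˡ _) (δ-refl (0 mod p)))
      (R.trans (R.+-identityʳ _) (R.trans (R.*-identityˡ _) (δ-≢ 0≢1)))) (R.+-identityʳ _)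

fold-inner : ∀ {a} {A : Set a} (f : A → A) k x → fold (f x) f k ≡ f (fold x f k)
fold-inner f zero    x = ≡.refl
fold-inner f (suc k) x = ≡.cong f (fold-inner f k x)

module ConstantSums {c ℓ} (R : Ring₂ c ℓ) where
  open Ring₂ R

  sum-const-odd : ∀ n x → n % 2 ≡ 1 → sum {n} (λ _ → x) ≈ x
  sum-const-odd (suc zero)    x _   = +-identityʳ x
  sum-const-odd (suc (suc n)) x odd = trans (trans (sym (+-assoc x x _)) (trans (+-congʳ (x+x≈0 x)) (+-identityˡ _)))
    (sum-const-odd n x odd)

  sum-const-even : ∀ n x → n % 2 ≡ 0 → sum {n} (λ _ → x) ≈ 0#
  sum-const-even zero          x _    = refl
  sum-const-even (suc (suc n)) x even = trans (trans (sym (+-assoc x x _)) (trans (+-congʳ (x+x≈0 x)) (+-identityˡ _)))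
    (sum-const-even n x even)

-- Rigidity of twisted equivariant vectors, and the adjunction of the variables α.

module Equivariance {c ℓ : Level} (n p : ℕ) (G : Set) (τ : G → Fin n → Fin n) where

  -- The property carried through the adjunctions. All twists `r` are allowed because a coefficient
  -- of α^d picks up the factor ζ^(w g * d) when α is scaled. The shift `s` ranges over the whole
  -- ring so that it can absorb the part of a vector below a given degree.
  Rigid : (S : Ring₂ c ℓ) → Ring₂.Carrier S → (G → Hom S S) → Set (c ⊔ ℓ)
  Rigid S ζ σ = ∀ (r : G → ℕ) (f : Fin n → Carrier) →
    (∀ g i → f (τ g i) ≈ ζ ^ r g * Hom.⟦ σ g ⟧ (f i)) →
    (∀ s → sum (λ i → (f i + s) ^ p) ≈ 0#) →
    sum f ≈ 0# →
    ∀ i j → f i ≈ f j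
    where open Ring₂ S

  module AdjoinVariable (S : Ring₂ c ℓ) (ζ : Ring₂.Carrier S) (σ : G → Hom S S) (w : G → ℕ) where
    private module S = Ring₂ S
    open MonoidAlgebra S ℕ-monoid public
    open LowestTerms S ℕ-order
    private
      module A = Ring₂ algebra
      module const = Hom const

    private
      φ : G → ℕ → Alg
      φ g d = const.⟦ ζ S.^ (w g ℕ.* d) ⟧ A.* mono d

      φ-∙ : ∀ g d e → φ g (d ℕ.+ e) A.≈ φ g d A.* φ g e
      φ-∙ g d e = A.trans
        (A.*-cong (A.trans (const.cong (S.trans (S.^-congʳ ζ (ℕ.*-distribˡ-+ (w g) d e)) (S.^-homo-* ζ (w g ℕ.* d) (w g ℕ.* e))))
                    (const.*-homo (ζ S.^ (w g ℕ.* d)) (ζ S.^ (w g ℕ.* e))))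
                  (mono-∙ d e))
        (A.*-interchange const.⟦ ζ S.^ (w g ℕ.* d) ⟧ const.⟦ ζ S.^ (w g ℕ.* e) ⟧ (mono d) (mono e))

      φ-ε : ∀ g → φ g 0 A.≈ A.1#
      φ-ε g = A.trans (A.*-identityʳ const.⟦ ζ S.^ (w g ℕ.* 0) ⟧) (const.cong (S.^-congʳ ζ (ℕ.*-zeroʳ (w g))))

      module Ev g = Evaluation (const ∘ʰ σ g) (φ g) (φ-ε g) (φ-∙ g)

    -- σ′ g applies σ g to the coefficients and multiplies the variable by ζ ^ w g.
    σ′ : G → Hom algebra algebra
    σ′ g = Ev.eval g

    σ′-const : ∀ g a → Hom.⟦ σ′ g ⟧ const.⟦ a ⟧ A.≈ const.⟦ Hom.⟦ σ g ⟧ a ⟧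
    σ′-const g a = Ev.eval-const g a

    σ′-mono : ∀ g d → Hom.⟦ σ′ g ⟧ (mono d) A.≈ const.⟦ ζ S.^ (w g ℕ.* d) ⟧ A.* mono d
    σ′-mono g d = Ev.eval-mono g d

    coeff-σ′ : ∀ g f d → coeff (Hom.⟦ σ′ g ⟧ f) d S.≈ ζ S.^ (w g ℕ.* d) S.* Hom.⟦ σ g ⟧ (coeff f d)
    coeff-σ′ g []            d = S.sym (S.trans (S.*-congˡ (Hom.0-homo (σ g))) (S.zeroʳ _))
    coeff-σ′ g ((a , m) ∷ f) d = begin
      coeff (Hom.⟦ σ′ g ⟧ ((a , m) ∷ f)) d
        ≈⟨ coeff-++ (const.⟦ σᵍ a ⟧ A.* φ g m) (Hom.⟦ σ′ g ⟧ f) d ⟩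
      coeff (const.⟦ σᵍ a ⟧ A.* φ g m) d S.+ coeff (Hom.⟦ σ′ g ⟧ f) d
        ≈⟨ S.+-cong (coeff-const* (σᵍ a) (φ g m) d) (coeff-σ′ g f d) ⟩
      σᵍ a S.* coeff (φ g m) d S.+ ζ S.^ (w g ℕ.* d) S.* σᵍ (coeff f d)
        ≈⟨ S.+-congʳ (S.*-congˡ (S.trans (coeff-const* _ (mono m) d) (S.trans (S.*-congˡ (S.trans (coeff-term S.1# m d) (S.*-identityˡ _))) shift-δ))) ⟩
      σᵍ a S.* (ζ S.^ (w g ℕ.* d) S.* σᵍ (δ d m)) S.+ ζ S.^ (w g ℕ.* d) S.* σᵍ (coeff f d)
        ≈⟨ S.+-congʳ (S.trans (S.x*[y*z]≈y*[x*z] _ _ _) (S.*-congˡ (S.sym (Hom.*-homo (σ g) a (δ d m))))) ⟩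
      ζ S.^ (w g ℕ.* d) S.* σᵍ (a S.* δ d m) S.+ ζ S.^ (w g ℕ.* d) S.* σᵍ (coeff f d)
        ≈⟨ S.distribˡ _ _ _ ⟨
      ζ S.^ (w g ℕ.* d) S.* (σᵍ (a S.* δ d m) S.+ σᵍ (coeff f d))
        ≈⟨ S.*-congˡ (Hom.+-homo (σ g) _ _) ⟨
      ζ S.^ (w g ℕ.* d) S.* σᵍ (a S.* δ d m S.+ coeff f d) ∎
      where
      open S.≈-Reasoning
      σᵍ = Hom.⟦ σ g ⟧
      shift-δ : ζ S.^ (w g ℕ.* m) S.* δ d m S.≈ ζ S.^ (w g ℕ.* d) S.* σᵍ (δ d m)
      shift-δ with d ℕ.≟ m
      ... | yes ≡.refl = S.*-congˡ (S.sym (Hom.1-homo (σ g)))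
      ... | no  _      = S.trans (S.zeroʳ _) (S.sym (S.trans (S.*-congˡ (Hom.0-homo (σ g))) (S.zeroʳ _)))

    private
      power-vanishesBelow : ∀ x d k → VanishesBelow x d → VanishesBelow (x A.^ k) (k ℕ.* d)
      power-vanishesBelow x d zero    v e ()
      power-vanishesBelow x d (suc k) v = *-vanishesBelow {x} {d} {x A.^ k} {k ℕ.* d} v (power-vanishesBelow x d k v)

      coeff-power : ∀ x d k → VanishesBelow x d → coeff (x A.^ k) (k ℕ.* d) S.≈ coeff x d S.^ k
      coeff-power x d zero    v = S.trans (coeff-term S.1# 0 0) (S.*-identityˡ _)
      coeff-power x d (suc k) v = S.trans
        (coeff-*-lowest {x} {d} {x A.^ k} {k ℕ.* d} v (power-vanishesBelow x d k v))
        (S.*-congˡ (coeff-power x d k v))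

    -- If f i and f j agree below degree d, then f i + f j + s α^d starts in degree d,
    -- and the coefficient of α^(p d) in its p-th power only sees degree d.
    rigid : Rigid S ζ σ → Rigid algebra const.⟦ ζ ⟧ σ′
    rigid S-rigid r f equi powers sum-f i j = coeffs λ d → agree d i j
      where
      agree : ∀ d i j → coeff (f i) d S.≈ coeff (f j) d
      agree = <-rec _ step
        where
        step : ∀ d → (∀ {e} → e ℕ.< d → ∀ i j → coeff (f i) e S.≈ coeff (f j) e) →
               ∀ i j → coeff (f i) d S.≈ coeff (f j) d
        step d below i j = S-rigid (λ g → r g ℕ.+ w g ℕ.* d) (λ i → coeff (f i) d) equi-d powers-d
          (S.trans (S.sym (sum-coeff f d)) (coeff≈ sum-f d)) i j
          where
          equi-d : ∀ g i → coeff (f (τ g i)) d S.≈ ζ S.^ (r g ℕ.+ w g ℕ.* d) S.* Hom.⟦ σ g ⟧ (coeff (f i) d)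
          equi-d g i = begin
            coeff (f (τ g i)) d
              ≈⟨ coeff≈ (equi g i) d ⟩
            coeff (const.⟦ ζ ⟧ A.^ r g A.* Hom.⟦ σ′ g ⟧ (f i)) d
              ≈⟨ coeff≈ (A.*-congʳ {Hom.⟦ σ′ g ⟧ (f i)} (const.^-homo ζ (r g))) d ⟨
            coeff (const.⟦ ζ S.^ r g ⟧ A.* Hom.⟦ σ′ g ⟧ (f i)) d
              ≈⟨ coeff-const* (ζ S.^ r g) (Hom.⟦ σ′ g ⟧ (f i)) d ⟩
            ζ S.^ r g S.* coeff (Hom.⟦ σ′ g ⟧ (f i)) d
              ≈⟨ S.*-congˡ (coeff-σ′ g (f i) d) ⟩
            ζ S.^ r g S.* (ζ S.^ (w g ℕ.* d) S.* Hom.⟦ σ g ⟧ (coeff (f i) d))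
              ≈⟨ S.*-assoc _ _ _ ⟨
            ζ S.^ r g S.* ζ S.^ (w g ℕ.* d) S.* Hom.⟦ σ g ⟧ (coeff (f i) d)
              ≈⟨ S.*-congʳ (S.^-homo-* ζ (r g) (w g ℕ.* d)) ⟨
            ζ S.^ (r g ℕ.+ w g ℕ.* d) S.* Hom.⟦ σ g ⟧ (coeff (f i) d) ∎
            where open S.≈-Reasoning

          powers-d : ∀ s → S.sum (λ i → (coeff (f i) d S.+ s) S.^ p) S.≈ S.0#
          powers-d s = begin
            S.sum (λ i → (coeff (f i) d S.+ s) S.^ p)      ≈⟨ S.sum-cong (λ i → S.^-congˡ p (coeff-x-d i)) ⟨
            S.sum (λ i → coeff (x i) d S.^ p)              ≈⟨ S.sum-cong (λ i → coeff-power (x i) d p (x-below i)) ⟨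
            S.sum (λ i → coeff (x i A.^ p) (p ℕ.* d))      ≈⟨ sum-coeff (λ i → x i A.^ p) (p ℕ.* d) ⟨
            coeff (A.sum (λ i → x i A.^ p)) (p ℕ.* d)      ≈⟨ coeff≈ (powers y) (p ℕ.* d) ⟩
            S.0#                                           ∎
            where
            open S.≈-Reasoning
            y : Alg
            -- The extra `coeff (f j) d` cancels the one inside `f j`, so `y` has coefficient
            -- exactly `s` in degree `d` and `x i` has `coeff (f i) d + s` there.
            y = f j A.+ ((s S.+ coeff (f j) d , d) ∷ [])
            x : Fin n → Alg
            x i = f i A.+ y
            coeff-y : ∀ e → coeff y e S.≈ coeff (f j) e S.+ (s S.+ coeff (f j) d) S.* δ e d
            coeff-y e = S.trans (coeff-++ (f j) _ e) (S.+-congˡ (coeff-term _ d e))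
            x-below : ∀ i → VanishesBelow (x i) d
            x-below i e e<d = S.trans (coeff-++ (f i) y e) (S.≈⇒+≈0 (S.trans (below e<d i j) (S.sym
              (S.trans (coeff-y e) (S.trans (S.+-congˡ (S.trans (S.*-congˡ (δ-≢ (ℕ.<⇒≢ e<d))) (S.zeroʳ _))) (S.+-identityʳ _))))))
            coeff-x-d : ∀ i → coeff (x i) d S.≈ coeff (f i) d S.+ s
            coeff-x-d i = S.trans (coeff-++ (f i) y d) (S.+-congˡ (S.trans (coeff-y d)
              (S.trans (S.+-congˡ (S.trans (S.*-congˡ (δ-refl d)) (S.trans (S.*-identityʳ _) (S.+-comm s _))))
                (S.trans (S.sym (S.+-assoc _ _ s)) (S.trans (S.+-congʳ (S.x+x≈0 _)) (S.+-identityˡ s))))))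

  -- S is B with one variable adjoined for each generator in gs; spec sets these variables to 1.
  module Generic (B : Ring₂ c ℓ) .{{_ : NonZero p}} (root : RootOfUnity B p) (x : Fin n → Ring₂.Carrier B) where
    private module B = Ring₂ B
    open RootOfUnity root

    record Stage (gs : List G) : Set (lsuc (c ⊔ ℓ)) where
      field
        S         : Ring₂ c ℓ
        ι         : Hom B S
        spec      : Hom S B
        σ         : G → Hom S S
      open Ring₂ S using (_≈_)
      field
        spec-ι    : ∀ b → Hom.⟦ spec ⟧ (Hom.⟦ ι ⟧ b) B.≈ b
        σ-ι       : ∀ g b → Hom.⟦ σ g ⟧ (Hom.⟦ ι ⟧ b) ≈ Hom.⟦ ι ⟧ b
        -- Before its variable is adjoined, a generator acts as the identity on `S`; this makes its
        -- Fourier components satisfy a twisted equivariance under it, with only a scalar factor.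
        σ-trivial : ∀ {g} → g ∉ gs → ∀ s → Hom.⟦ σ g ⟧ s ≈ s
        u         : Fin n → Ring₂.Carrier S
        spec-u    : ∀ i → Hom.⟦ spec ⟧ (u i) B.≈ x i
        u-equi    : ∀ {g} → g ∈ gs → ∀ i → u (τ g i) ≈ Hom.⟦ σ g ⟧ (u i)
        rigid     : Rigid S (Hom.⟦ ι ⟧ ζ) σ

    initial : Rigid B ζ (λ _ → idHom B) → Stage []
    initial B-rigid = record
      { S = B ; ι = idHom B ; spec = idHom B ; σ = λ _ → idHom B
      ; spec-ι = λ _ → B.refl ; σ-ι = λ _ _ → B.refl ; σ-trivial = λ _ _ → B.refl
      ; u = x ; spec-u = λ _ → B.refl ; u-equi = λ () ; rigid = B-rigid }

    module Extend (_≟_ : DecidableEquality G) (g₀ : G) (p-odd : p % 2 ≡ 1)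
      (τ^p : ∀ i → fold i (τ g₀) p ≡ i)
      (τ-comm : ∀ g i → τ g₀ (τ g i) ≡ τ g (τ g₀ i))
      {gs : List G} (g₀∉gs : g₀ ∉ gs) (stage : Stage gs) where
      open Stage stage
      private
        module S = Ring₂ S
        module ι = Hom ι

        w : G → ℕ
        w g with g₀ ≟ g
        -- Stands for the weight -1 modulo `p`, so that α^a is scaled by the eigenvalue ζ^(-a) of
        -- `v a`.
        ... | yes _ = ℕ.pred p
        ... | no  _ = 0

        ζS = ι.⟦ ζ ⟧

        ζS^p≈1 : ζS S.^ p S.≈ S.1#
        ζS^p≈1 = S.trans (S.sym (ι.^-homo ζ p)) (S.trans (ι.cong ζ^p≈1) ι.1-homo)

        ^-swap : ∀ a k → (ζS S.^ a) S.^ k S.≈ (ζS S.^ k) S.^ a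
        ^-swap a k = S.trans (S.^-assocʳ ζS a k) (S.trans (S.^-congʳ ζS (ℕ.*-comm a k)) (S.sym (S.^-assocʳ ζS k a)))

        geometric-S : ∀ r → r % p ≢ 0 → S.sum {p} (λ a → (ζS S.^ r) S.^ Fin.toℕ a) S.≈ S.0#
        geometric-S r p∤r = S.trans (S.sum-cong {p} (λ a → S.sym (S.trans (ι.^-homo (ζ B.^ r) (Fin.toℕ a)) (S.^-congˡ (Fin.toℕ a) (ι.^-homo ζ r)))))
          (S.trans (S.sym (ι.sum-homo {p} (λ a → (ζ B.^ r) B.^ Fin.toℕ a))) (S.trans (ι.cong (geometric r p∤r)) ι.0-homo))

        -- Discrete Fourier transform: v a is an eigenvector of τ g₀ with eigenvalue ζ^(-a).
        v : ℕ → Fin n → S.Carrier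
        v a i = S.sum {p} (λ k → (ζS S.^ a) S.^ Fin.toℕ k S.* u (fold i (τ g₀) (Fin.toℕ k)))

        fold-comm : ∀ g k i → fold (τ g i) (τ g₀) k ≡ τ g (fold i (τ g₀) k)
        fold-comm g zero    i = ≡.refl
        fold-comm g (suc k) i = ≡.trans (≡.cong (τ g₀) (fold-comm g k i)) (τ-comm g _)

        v-shift : ∀ a i → ζS S.^ a S.* v a (τ g₀ i) S.≈ v a i
        v-shift a i = begin
          ζS S.^ a S.* v a (τ g₀ i)
            ≈⟨ S.*-distribˡ-sum {p} (ζS S.^ a) _ ⟩
          S.sum {p} (λ k → ζS S.^ a S.* ((ζS S.^ a) S.^ Fin.toℕ k S.* u (fold (τ g₀ i) (τ g₀) (Fin.toℕ k))))
            ≈⟨ S.sum-cong {p} (λ k → S.trans (S.sym (S.*-assoc _ _ _)) (S.*-congˡ (S.reflexive (≡.cong u (fold-inner (τ g₀) (Fin.toℕ k) i))))) ⟩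
          S.sum {p} (λ k → h (suc (Fin.toℕ k)))
            ≈⟨ CyclicSum.sum-cyclic S.+-commutativeMonoid p h hₚ≈h₀ ⟩
          v a i ∎
          where
          open S.≈-Reasoning
          h : ℕ → S.Carrier
          h k = (ζS S.^ a) S.^ k S.* u (fold i (τ g₀) k)
          hₚ≈h₀ : h p S.≈ h 0
          hₚ≈h₀ = S.*-cong (S.trans (^-swap a p) (S.trans (S.^-congˡ a ζS^p≈1) (S.1^n≈1 a))) (S.reflexive (≡.cong u (τ^p i)))

        v-shift⁻¹ : ∀ a i → v a (τ g₀ i) S.≈ ζS S.^ (ℕ.pred p ℕ.* a) S.* v a i
        v-shift⁻¹ a i = begin
          v a (τ g₀ i)                                                    ≈⟨ S.*-identityˡ _ ⟨
          S.1# S.* v a (τ g₀ i)                                           ≈⟨ S.*-congʳ ζ-cancel ⟨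
          (ζS S.^ (ℕ.pred p ℕ.* a) S.* ζS S.^ a) S.* v a (τ g₀ i)         ≈⟨ S.*-assoc _ _ _ ⟩
          ζS S.^ (ℕ.pred p ℕ.* a) S.* (ζS S.^ a S.* v a (τ g₀ i))         ≈⟨ S.*-congˡ (v-shift a i) ⟩
          ζS S.^ (ℕ.pred p ℕ.* a) S.* v a i                               ∎
          where
          open S.≈-Reasoning
          ζ-cancel : ζS S.^ (ℕ.pred p ℕ.* a) S.* ζS S.^ a S.≈ S.1#
          ζ-cancel = S.trans (S.sym (S.^-homo-* ζS (ℕ.pred p ℕ.* a) a))
            (S.trans (S.^-congʳ ζS (≡.trans (ℕ.+-comm (ℕ.pred p ℕ.* a) a) (≡.cong (ℕ._* a) (ℕ.suc-pred p))))
              (S.trans (S.sym (S.^-assocʳ ζS p a)) (S.trans (S.^-congˡ a ζS^p≈1) (S.1^n≈1 a))))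

        -- For `g₀` this is the eigenvalue equation, as `σ g₀` is still trivial. For the earlier
        -- generators the weight is 0 and the equivariance of `u` applies termwise, because the `τ`
        -- commute.
        v-equi : ∀ {g} → g ∈ (g₀ ∷ gs) → ∀ a i → v a (τ g i) S.≈ ζS S.^ (w g ℕ.* a) S.* Hom.⟦ σ g ⟧ (v a i)
        v-equi {g} g∈ a i with g₀ ≟ g
        ... | yes ≡.refl = S.trans (v-shift⁻¹ a i) (S.*-congˡ (S.sym (σ-trivial g₀∉gs (v a i))))
        v-equi (here g≡g₀)  a i | no g₀≢g = contradiction (≡.sym g≡g₀) g₀≢g
        v-equi {g} (there g∈gs) a i | no _ = S.trans
          (S.sum-cong {p} (λ k → S.trans
            (S.*-cong
              (S.sym (S.trans (Hom.^-homo (σ g) (ζS S.^ a) (Fin.toℕ k)) (S.^-congˡ (Fin.toℕ k)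
                (S.trans (Hom.^-homo (σ g) ζS a) (S.^-congˡ a (σ-ι g ζ))))))
              (S.trans (S.reflexive (≡.cong u (fold-comm g (Fin.toℕ k) i))) (u-equi g∈gs _)))
            (S.sym (Hom.*-homo (σ g) _ _))))
          (S.trans (S.sym (Hom.sum-homo (σ g) {p} _)) (S.sym (S.*-identityˡ _)))

        -- Fourier inversion. No division occurs: the usual factor `p` is odd and hence equal to 1.
        -- The terms with `k` different from 0 vanish as full geometric sums.
        sum-v : ∀ i → S.sum {p} (λ a → v (Fin.toℕ a) i) S.≈ u i
        sum-v i = begin
          S.sum {p} (λ a → v (Fin.toℕ a) i)
            ≈⟨ S.∑-comm {p} {p} (λ a k → (ζS S.^ Fin.toℕ a) S.^ Fin.toℕ k S.* uₖ (Fin.toℕ k)) ⟩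
          S.sum {p} (λ k → S.sum {p} (λ a → (ζS S.^ Fin.toℕ a) S.^ Fin.toℕ k S.* uₖ (Fin.toℕ k)))
            ≈⟨ S.sum-cong {p} (λ k → S.trans (S.sum-cong {p} (λ a → S.*-congʳ (^-swap (Fin.toℕ a) (Fin.toℕ k))))
                 (S.sym (S.*-distribʳ-sum {p} (uₖ (Fin.toℕ k)) _))) ⟩
          S.sum {p} (λ k → γ (Fin.toℕ k) S.* uₖ (Fin.toℕ k))
            ≈⟨ only-first ⟩
          u i ∎
          where
          open S.≈-Reasoning
          uₖ : ℕ → S.Carrier
          uₖ k = u (fold i (τ g₀) k)
          γ : ℕ → S.Carrier
          γ k = S.sum {p} (λ a → (ζS S.^ k) S.^ Fin.toℕ a)
          γ₀ : γ 0 S.≈ S.1#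
          γ₀ = S.trans (S.sum-cong {p} (λ a → S.1^n≈1 (Fin.toℕ a))) (ConstantSums.sum-const-odd S p S.1# p-odd)
          0ᵖ : Fin p
          0ᵖ = 0 mod p
          toℕ-0ᵖ : Fin.toℕ 0ᵖ ≡ 0
          toℕ-0ᵖ = ≡.trans (toℕ-mod p 0) (m<n⇒m%n≡m (ℕ.>-nonZero⁻¹ p))
          only-first : S.sum {p} (λ k → γ (Fin.toℕ k) S.* uₖ (Fin.toℕ k)) S.≈ u i
          only-first = S.trans
            (S.sum-single {p} _ 0ᵖ (λ k k≢0 → S.trans (S.*-congʳ (geometric-S (Fin.toℕ k) (λ eq →
              k≢0 (Fin.toℕ-injective (≡.trans (≡.trans (≡.sym (toℕ%-id p k)) eq) (≡.sym toℕ-0ᵖ)))))) (S.zeroˡ _)))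
            (S.trans (S.reflexive (≡.cong (λ k → γ k S.* uₖ k) toℕ-0ᵖ)) (S.trans (S.*-congʳ γ₀) (S.*-identityˡ _)))

      open AdjoinVariable S ζS σ w hiding (rigid)
      private
        module A = Ring₂ algebra
        module const = Hom const
        module At1 = Evaluation (idHom S) (λ _ → S.1#) S.refl (λ _ _ → S.sym (S.*-identityˡ S.1#))
        open Linear (idHom S) using (lin)

        -- The eigencomponents of `u` spread over the powers of α: scaling α by ζ^(-1) now does what
        -- `τ g₀` does to the index, and α = 1 gives back `u`.
        u′ : Fin n → Alg
        u′ i = A.sum {p} (λ a → const.⟦ v (Fin.toℕ a) i ⟧ A.* mono (Fin.toℕ a))

        at1-u′ : ∀ i → Hom.⟦ At1.eval ⟧ (u′ i) S.≈ u i
        at1-u′ i = S.trans (Hom.sum-homo At1.eval {p} (λ a → const.⟦ v (Fin.toℕ a) i ⟧ A.* mono (Fin.toℕ a)))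
          (S.trans (S.sum-cong {p} (λ a → S.trans (Hom.*-homo At1.eval const.⟦ v (Fin.toℕ a) i ⟧ (mono (Fin.toℕ a)))
            (S.trans (S.*-cong (At1.eval-const (v (Fin.toℕ a) i)) (At1.eval-mono (Fin.toℕ a))) (S.*-identityʳ _))))
          (sum-v i))

        u′-equi : ∀ {g} → g ∈ (g₀ ∷ gs) → ∀ i → u′ (τ g i) A.≈ Hom.⟦ σ′ g ⟧ (u′ i)
        u′-equi {g} g∈ i = A.trans
          (A.sum-cong {p} {λ a → const.⟦ v (Fin.toℕ a) (τ g i) ⟧ A.* mono (Fin.toℕ a)} {λ a → Hom.⟦ σ′ g ⟧ (const.⟦ v (Fin.toℕ a) i ⟧ A.* mono (Fin.toℕ a))}
            (λ a → A.sym (term (Fin.toℕ a))))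
          (A.sym (Hom.sum-homo (σ′ g) {p} (λ a → const.⟦ v (Fin.toℕ a) i ⟧ A.* mono (Fin.toℕ a))))
          where
          term : ∀ a → Hom.⟦ σ′ g ⟧ (const.⟦ v a i ⟧ A.* mono a) A.≈ const.⟦ v a (τ g i) ⟧ A.* mono a
          term a = A.trans (Hom.*-homo (σ′ g) const.⟦ v a i ⟧ (mono a))
            (A.trans (A.*-cong (σ′-const g (v a i)) (σ′-mono g a))
            (A.trans (A.x*[y*z]≈y*[x*z] const.⟦ σv ⟧ const.⟦ z ⟧ (mono a))
            (A.trans (A.sym (A.*-assoc const.⟦ z ⟧ const.⟦ σv ⟧ (mono a)))
            (A.*-congʳ {mono a} (A.trans (A.sym (const.*-homo z σv)) (const.cong (S.sym (v-equi g∈ a i))))))))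
            where
            z  = ζS S.^ (w g ℕ.* a)
            σv = Hom.⟦ σ g ⟧ (v a i)

        σ′-trivial : ∀ {g} → g ∉ (g₀ ∷ gs) → ∀ s → Hom.⟦ σ′ g ⟧ s A.≈ s
        σ′-trivial {g} g∉ s = coeffs λ d → S.trans (coeff-σ′ g s d) (S.trans
          (S.*-cong (S.^-congʳ ζS (≡.cong (ℕ._* d) w≡0)) (σ-trivial (g∉ ∘ there) _)) (S.*-identityˡ _))
          where
          w≡0 : w g ≡ 0
          w≡0 with g₀ ≟ g
          ... | yes g₀≡g = contradiction (here (≡.sym g₀≡g)) g∉
          ... | no  _    = ≡.refl

      extend : Stage (g₀ ∷ gs)
      extend = record
        { S         = algebra
        ; ι         = const ∘ʰ ι
        ; spec      = spec ∘ʰ At1.eval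
        ; σ         = σ′
        ; spec-ι    = λ b → B.trans (Hom.cong spec (At1.eval-const ι.⟦ b ⟧)) (spec-ι b)
        ; σ-ι       = λ g b → A.trans (σ′-const g ι.⟦ b ⟧) (const.cong (σ-ι g b))
        ; σ-trivial = σ′-trivial
        ; u         = u′
        ; spec-u    = λ i → B.trans (Hom.cong spec (at1-u′ i)) (spec-u i)
        ; u-equi    = u′-equi
        ; rigid     = AdjoinVariable.rigid S ζS σ w rigid
        }

-- The action of two copies of (ℤ/p)^m on 2 p^m points.

module SumCombine {c ℓ} (R : Ring₂ c ℓ) where
  open Ring₂ R

  sum-++ : ∀ m n (h : Fin (m ℕ.+ n) → Carrier) → sum h ≈ sum (h ∘ (Fin._↑ˡ n)) + sum (h ∘ (m Fin.↑ʳ_))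
  sum-++ zero    n h = sym (+-identityˡ _)
  sum-++ (suc m) n h = trans (+-congˡ (sum-++ m n (h ∘ suc))) (sym (+-assoc _ _ _))

  sum-combine : ∀ m n (h : Fin (m ℕ.* n) → Carrier) → sum h ≈ sum {m} (λ i → sum {n} (λ j → h (combine i j)))
  sum-combine zero    n h = refl
  sum-combine (suc m) n h = trans (sum-++ n (m ℕ.* n) h) (+-congˡ (sum-combine m n (h ∘ (n Fin.↑ʳ_))))

module Blocks (m n : ℕ) where

  on : (Fin m → Fin m) → (Fin m → Fin n → Fin n) → Fin (m ℕ.* n) → Fin (m ℕ.* n)
  on f g x = combine (f (proj₁ (remQuot {m} n x))) (g (proj₁ (remQuot {m} n x)) (proj₂ (remQuot {m} n x)))

  on-combine : ∀ f g a b → on f g (combine a b) ≡ combine (f a) (g a b)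
  on-combine f g a b =
    ≡.cong (λ ab → combine (f (proj₁ ab)) (g (proj₁ ab) (proj₂ ab))) (Fin.remQuot-combine {m} {n} a b)

  combine-elim : ∀ {ℓ} (P : Fin (m ℕ.* n) → Set ℓ) → (∀ a b → P (combine {m} {n} a b)) → ∀ x → P x
  combine-elim P h x = ≡.subst P (Fin.combine-remQuot {m} n x) (h (proj₁ (remQuot {m} n x)) (proj₂ (remQuot {m} n x)))

module DigitShifts (p : ℕ) .{{_ : NonZero p}} where

  next : Fin p → Fin p
  next i = suc (Fin.toℕ i) mod p

  toℕ-fold-next : ∀ k i → Fin.toℕ (fold i next k) ≡ (k ℕ.+ Fin.toℕ i) % p
  toℕ-fold-next zero    i = ≡.sym (toℕ%-id p i)
  toℕ-fold-next (suc k) i = ≡.trans (toℕ-mod p _)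
    (≡.trans (≡.cong (λ t → suc t % p) (toℕ-fold-next k i)) (%-absorbʳ p 1 (k ℕ.+ Fin.toℕ i)))

  fold-next-p : ∀ i → fold i next p ≡ i
  fold-next-p i = Fin.toℕ-injective (≡.trans (toℕ-fold-next p i)
    (≡.trans (≡.cong (_% p) (ℕ.+-comm p (Fin.toℕ i))) (≡.trans ([m+n]%n≡m%n (Fin.toℕ i) p) (toℕ%-id p i))))

  -- With `Fin (p ^ m)` read as strings of `m` digits, leading digit first, these are the standard
  -- generators of (ℤ/p)^m in its regular action.
  shift : ∀ m → Fin m → Fin (p ℕ.^ m) → Fin (p ℕ.^ m)
  shift (suc m) zero    = Blocks.on p (p ℕ.^ m) next (λ _ → id)
  shift (suc m) (suc l) = Blocks.on p (p ℕ.^ m) id (λ _ → shift m l)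

  fold-on : ∀ {q} f g k a b → fold (combine {p} {q} a b) (Blocks.on p q f (λ _ → g)) k ≡ combine (fold a f k) (fold b g k)
  fold-on f g zero    a b = ≡.refl
  fold-on f g (suc k) a b = ≡.trans (≡.cong (Blocks.on p _ f (λ _ → g)) (fold-on f g k a b)) (Blocks.on-combine p _ f (λ _ → g) _ _)

  fold-id : ∀ {a} {A : Set a} (x : A) k → fold x id k ≡ x
  fold-id x zero    = ≡.refl
  fold-id x (suc k) = fold-id x k

  fold-shift-p : ∀ m l x → fold x (shift m l) p ≡ x
  fold-shift-p (suc m) zero    = Blocks.combine-elim p (p ℕ.^ m) _ λ a b →
    ≡.trans (fold-on next id p a b) (≡.cong₂ (combine {p} {p ℕ.^ m}) (fold-next-p a) (fold-id b p))
  fold-shift-p (suc m) (suc l) = Blocks.combine-elim p (p ℕ.^ m) _ λ a b →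
    ≡.trans (fold-on id (shift m l) p a b) (≡.cong₂ (combine {p} {p ℕ.^ m}) (fold-id a p) (fold-shift-p m l b))

  private
    on-comm : ∀ {q} f g f′ g′ → (∀ a → f (f′ a) ≡ f′ (f a)) → (∀ b → g (g′ b) ≡ g′ (g b)) → ∀ x →
      Blocks.on p q f (λ _ → g) (Blocks.on p q f′ (λ _ → g′) x) ≡ Blocks.on p q f′ (λ _ → g′) (Blocks.on p q f (λ _ → g) x)
    on-comm {q} f g f′ g′ ff gg = combine-elim _ λ a b →
      ≡.trans (≡.cong (on f (λ _ → g)) (on-combine f′ (λ _ → g′) a b))
      (≡.trans (on-combine f (λ _ → g) _ _)
      (≡.trans (≡.cong₂ combine (ff a) (gg b))
      (≡.sym (≡.trans (≡.cong (on f′ (λ _ → g′)) (on-combine f (λ _ → g) a b)) (on-combine f′ (λ _ → g′) _ _)))))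
      where open Blocks p q

  shift-comm : ∀ m l l′ x → shift m l (shift m l′ x) ≡ shift m l′ (shift m l x)
  shift-comm (suc m) zero    zero     x = ≡.refl
  shift-comm (suc m) zero    (suc l′) x = on-comm next id id (shift m l′) (λ _ → ≡.refl) (λ _ → ≡.refl) x
  shift-comm (suc m) (suc l) zero     x = on-comm id (shift m l) next id (λ _ → ≡.refl) (λ _ → ≡.refl) x
  shift-comm (suc m) (suc l) (suc l′) x = on-comm id (shift m l) id (shift m l′) (λ _ → ≡.refl) (shift-comm m l l′) x

  module _ {c ℓ} (S : Ring₂ c ℓ) where
    open Ring₂ S

    next-invariant : (h : Fin p → Carrier) → (∀ i → h (next i) ≈ h i) → ∀ i j → h i ≈ h j
    next-invariant h inv i j = trans (to-0 i) (sym (to-0 j))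
      where
      along : ∀ k i → h (fold i next k) ≈ h i
      along zero    i = refl
      along (suc k) i = trans (inv _) (along k i)
      to-0 : ∀ i → h i ≈ h (0 mod p)
      to-0 i = trans (reflexive (≡.cong h (Fin.toℕ-injective (≡.sym (≡.trans (toℕ-fold-next (Fin.toℕ i) (0 mod p))
          (≡.trans (≡.cong (λ t → (Fin.toℕ i ℕ.+ t) % p) (toℕ-mod p 0))
          (≡.trans (%-absorbʳ p (Fin.toℕ i) 0) (≡.trans (≡.cong (_% p) (ℕ.+-identityʳ _)) (toℕ%-id p i)))))))))
        (along (Fin.toℕ i) (0 mod p))

    -- Transitivity of the digit shifts, in the form in which it is used: digits can be aligned one
    -- at a time without changing `h`.
    shift-invariant : ∀ m (h : Fin (p ℕ.^ m) → Carrier) → (∀ l x → h (shift m l x) ≈ h x) → ∀ x y → h x ≈ h y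
    shift-invariant zero    h inv zero zero = refl
    shift-invariant (suc m) h inv = combine-elim _ λ a b → combine-elim _ λ a′ b′ →
      trans (next-invariant (λ a → h (combine {p} {p ℕ.^ m} a b))
              (λ a → trans (reflexive (≡.cong h (≡.sym (on-combine next (λ _ → id) a b)))) (inv zero _)) a a′)
            (shift-invariant m (λ b → h (combine {p} {p ℕ.^ m} a′ b))
              (λ l b → trans (reflexive (≡.cong h (≡.sym (on-combine id (λ _ → shift m l) a′ b)))) (inv (suc l) _)) b b′)
      where open Blocks p (p ℕ.^ m)

-- Two copies of (ℤ/p)^m acting on the two halves of Fin n, each half being a regular orbit.
record TwoOrbits (c ℓ : Level) (p m n : ℕ) : Set (lsuc (c ⊔ ℓ)) where
  field
    τ         : Fin 2 × Fin m → Fin n → Fin n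
    half      : Fin n → Fin 2
    point     : Fin 2 → Fin n
    τ^p       : ∀ g i → fold i (τ g) p ≡ i
    τ-comm    : ∀ g g′ i → τ g (τ g′ i) ≡ τ g′ (τ g i)
    τ-other   : ∀ g i → half i ≢ proj₁ g → τ g i ≡ i
    constant  : (S : Ring₂ c ℓ) → let open Ring₂ S in (h : Fin n → Carrier) → ∀ ε →
                (∀ l i → half i ≡ ε → h (τ (ε , l) i) ≈ h i) → ∀ i → half i ≡ ε → h i ≈ h (point ε)
    half-point : ∀ ε → half (point ε) ≡ ε
    sum-halves : (S : Ring₂ c ℓ) → let open Ring₂ S in (h : Fin n → Carrier) →
                (∀ i → h i ≈ h (point (half i))) → sum h ≈ h (point zero) + h (point (suc zero))

module _ {c ℓ : Level} (p m : ℕ) .{{nz : NonZero p}} (p-odd : p % 2 ≡ 1) where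
  private
    q = p ℕ.^ m
    open DigitShifts p {{nz}}
    open Blocks 2 q

    ^-odd : ∀ m → (p ℕ.^ m) % 2 ≡ 1
    ^-odd zero    = ≡.refl
    ^-odd (suc m) = ≡.trans (%-distribˡ-* p (p ℕ.^ m) 2) (≡.cong₂ (λ a b → (a ℕ.* b) % 2) p-odd (^-odd m))

    origin : Fin q
    origin = Fin.fromℕ< (ℕ.>-nonZero⁻¹ q {{ℕ.m^n≢0 p m {{nz}}}})

    only : Fin 2 → (Fin q → Fin q) → Fin 2 → Fin q → Fin q
    only ε f ε′ with ε Fin.≟ ε′
    ... | yes _ = f
    ... | no  _ = id

    only-≡ : ∀ ε f b → only ε f ε b ≡ f b
    only-≡ ε f b with ε Fin.≟ ε
    ... | yes _  = ≡.refl
    ... | no ε≢ε = contradiction ≡.refl ε≢ε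

    only-≢ : ∀ {ε ε′} f b → ε ≢ ε′ → only ε f ε′ b ≡ b
    only-≢ {ε} {ε′} f b ε≢ε′ with ε Fin.≟ ε′
    ... | yes ε≡ε′ = contradiction ε≡ε′ ε≢ε′
    ... | no  _    = ≡.refl

    τ : Fin 2 × Fin m → Fin (2 ℕ.* q) → Fin (2 ℕ.* q)
    τ (ε , l) = on id (only ε (shift m l))

    half : Fin (2 ℕ.* q) → Fin 2
    half x = proj₁ (remQuot {2} q x)

    half-combine : ∀ ε b → half (combine ε b) ≡ ε
    half-combine ε b = ≡.cong proj₁ (Fin.remQuot-combine {2} {q} ε b)

    fold-τ : ∀ ε l k ε′ b → fold (combine ε′ b) (τ (ε , l)) k ≡ combine ε′ (fold b (only ε (shift m l) ε′) k)
    fold-τ ε l zero    ε′ b = ≡.refl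
    fold-τ ε l (suc k) ε′ b = ≡.trans (≡.cong (τ (ε , l)) (fold-τ ε l k ε′ b)) (on-combine id (only ε (shift m l)) ε′ (fold b (only ε (shift m l) ε′) k))

    fold-only : ∀ ε l ε′ b → fold b (only ε (shift m l) ε′) p ≡ b
    fold-only ε l ε′ b with ε Fin.≟ ε′
    ... | yes _ = fold-shift-p m l b
    ... | no  _ = fold-id b p

    only-comm : ∀ ε l ε₁ l₁ ε′ b →
      only ε (shift m l) ε′ (only ε₁ (shift m l₁) ε′ b) ≡ only ε₁ (shift m l₁) ε′ (only ε (shift m l) ε′ b)
    only-comm ε l ε₁ l₁ ε′ b with ε Fin.≟ ε′ | ε₁ Fin.≟ ε′
    ... | yes _ | yes _ = shift-comm m l l₁ b
    ... | yes _ | no  _ = ≡.refl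
    ... | no  _ | yes _ = ≡.refl
    ... | no  _ | no  _ = ≡.refl

  twoOrbits : TwoOrbits c ℓ p m (2 ℕ.* p ℕ.^ m)
  twoOrbits = record
    { τ = τ ; half = half ; point = λ ε → combine ε origin
    ; τ^p = λ { (ε , l) → combine-elim _ λ ε′ b → ≡.trans (fold-τ ε l p ε′ b) (≡.cong (combine ε′) (fold-only ε l ε′ b)) }
    ; τ-comm = λ { (ε , l) (ε₁ , l₁) → combine-elim _ λ ε′ b →
        ≡.trans (≡.cong (τ (ε , l)) (on-combine id (only ε₁ (shift m l₁)) ε′ b))
        (≡.trans (on-combine id (only ε (shift m l)) ε′ _)
        (≡.trans (≡.cong (combine ε′) (only-comm ε l ε₁ l₁ ε′ b))
        (≡.sym (≡.trans (≡.cong (τ (ε₁ , l₁)) (on-combine id (only ε (shift m l)) ε′ b))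
          (on-combine id (only ε₁ (shift m l₁)) ε′ _))))) }
    ; τ-other = λ { (ε , l) → combine-elim _ λ ε′ b h≢ε → ≡.trans (on-combine id (only ε (shift m l)) ε′ b)
        (≡.cong (combine ε′) (only-≢ (shift m l) b (λ ε≡ε′ → h≢ε (≡.trans (half-combine ε′ b) (≡.sym ε≡ε′))))) }
    ; constant = constant
    ; half-point = λ ε → half-combine ε origin
    ; sum-halves = sum-halves
    }
    where
    constant : (S : Ring₂ c ℓ) → let open Ring₂ S in (h : Fin (2 ℕ.* q) → Carrier) → ∀ ε →
               (∀ l i → half i ≡ ε → h (τ (ε , l) i) ≈ h i) → ∀ i → half i ≡ ε → h i ≈ h (combine ε origin)
    constant S h ε inv = combine-elim _ λ { ε′ b half≡ε → S.trans
      (S.reflexive (≡.cong (λ ε → h (combine ε b)) (≡.trans (≡.sym (half-combine ε′ b)) half≡ε)))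
      (shift-invariant S m (λ b → h (combine ε b)) (λ l b → S.trans
        (S.reflexive (≡.cong h (≡.sym (≡.trans (on-combine id (only ε (shift m l)) ε b) (≡.cong (combine ε) (only-≡ ε (shift m l) b))))))
        (inv l (combine ε b) (half-combine ε b))) b origin) }
      where module S = Ring₂ S

    -- A constant summed over the odd number p^m of points in one half is that constant, since the
    -- ring has characteristic 2.
    sum-halves : (S : Ring₂ c ℓ) → let open Ring₂ S in (h : Fin (2 ℕ.* q) → Carrier) →
      (∀ i → h i ≈ h (combine {2} (half i) origin)) → sum h ≈ h (combine {2} zero origin) + h (combine {2} (suc zero) origin)
    sum-halves S h eq = S.trans (SumCombine.sum-combine S 2 q h)
      (S.+-cong (block zero) (S.trans (S.+-identityʳ _) (block (suc zero))))
      where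
      module S = Ring₂ S
      block : ∀ ε → S.sum {q} (λ b → h (combine ε b)) S.≈ h (combine ε origin)
      block ε = S.trans
        (S.sum-cong {q} (λ b → S.trans (eq (combine ε b)) (S.reflexive (≡.cong (λ ε → h (combine ε origin)) (half-combine ε b)))))
        (ConstantSums.sum-const-odd S q _ (^-odd m))

-- Rigidity over the ring with trivial action.

module BaseRigidity {c ℓ} {p m n : ℕ} .{{_ : NonZero p}} (orbits : TwoOrbits c ℓ p m n)
  (B : Ring₂ c ℓ) (red : Ring₂.Reduced B) (root : RootOfUnity B p) where
  open TwoOrbits orbits
  open Ring₂ B
  open RootOfUnity root
  open Equivariance {c} {ℓ} n p (Fin 2 × Fin m) τ

  private
    ζ^≈1 : ∀ r → r % p ≡ 0 → ζ ^ r ≈ 1#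
    ζ^≈1 r r≡0 = trans (GeometricSums.^-periodic B p ζ^p≈1 r) (^-congʳ ζ r≡0)

    module _ (r : Fin 2 × Fin m → ℕ) (f : Fin n → Carrier)
             (equi : ∀ g i → f (τ g i) ≈ ζ ^ r g * f i)
             (powers : ∀ s → sum (λ i → (f i + s) ^ p) ≈ 0#) (sum-f : sum f ≈ 0#) where

      invariant-case : (∀ g → r g % p ≡ 0) → ∀ i j → f i ≈ f j
      invariant-case r≡0 i j = trans (trans (to-point i) (between (half i) (half j))) (sym (to-point j))
        where
        to-point : ∀ i → f i ≈ f (point (half i))
        to-point i = constant B f (half i)
          (λ l i _ → trans (equi _ i) (trans (*-congʳ (ζ^≈1 _ (r≡0 _))) (*-identityˡ _))) i ≡.refl
        points : f (point zero) ≈ f (point (suc zero))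
        points = +≈0⇒≈ (trans (sym (sum-halves B f to-point)) sum-f)
        between : ∀ ε ε′ → f (point ε) ≈ f (point ε′)
        between zero       zero       = refl
        between zero       (suc zero) = points
        between (suc zero) zero       = sym points
        between (suc zero) (suc zero) = refl

      moved-case : ∀ g → r g % p ≢ 0 → ∀ i → f i ≈ 0#
      moved-case (ε , l) r≢0 i = f≈0 i
        where
        elsewhere : ∀ i → half i ≢ ε → f i ≈ 0#
        elsewhere i half≢ε = regular (r (ε , l)) (f i) r≢0 (trans (distribʳ _ _ _)
          (≈⇒+≈0 (trans (*-identityˡ _) (trans (reflexive (≡.cong f (≡.sym (τ-other (ε , l) i half≢ε)))) (equi (ε , l) i)))))
        -- The `p`-th power removes every twist, not only that of the generator known to be
        -- nontrivial; so `f ^ p` is constant along the whole half `ε`.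
        powers-invariant : ∀ l′ i → f (τ (ε , l′) i) ^ p ≈ f i ^ p
        powers-invariant l′ i = trans (^-congˡ p (equi _ i)) (trans (^-distrib-* _ _ p) (trans (*-congʳ
          (trans (^-assocʳ ζ (r (ε , l′)) p) (ζ^≈1 (r (ε , l′) ℕ.* p) (≡.trans (≡.cong (_% p) (ℕ.*-comm (r (ε , l′)) p)) (m*n%m≡0 (r (ε , l′))))))) (*-identityˡ _)))
          where
          m*n%m≡0 : ∀ k → (p ℕ.* k) % p ≡ 0
          m*n%m≡0 k = ≡.trans (≡.cong (_% p) (ℕ.*-comm p k)) (m*n%n≡0 k p)
        0^p≈0 : 0# ^ p ≈ 0#
        0^p≈0 = trans (^-congʳ 0# (≡.sym (ℕ.suc-pred p))) (zeroˡ _)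
        elsewhere^p : ∀ i → half i ≢ ε → f i ^ p ≈ 0#
        elsewhere^p i half≢ε = trans (^-congˡ p (elsewhere i half≢ε)) 0^p≈0
        to-point : ∀ i → f i ^ p ≈ f (point (half i)) ^ p
        to-point i with half i Fin.≟ ε
        ... | yes half≡ε = trans (constant B (λ i → f i ^ p) ε (λ l i _ → powers-invariant l i) i half≡ε)
                (reflexive (≡.cong (λ ε → f (point ε) ^ p) (≡.sym half≡ε)))
        ... | no  half≢ε = trans (elsewhere^p i half≢ε)
                (sym (elsewhere^p _ (λ eq → half≢ε (≡.trans (≡.sym (half-point (half i))) eq))))
        points : f (point zero) ^ p + f (point (suc zero)) ^ p ≈ 0#
        points = trans (sym (sum-halves B (λ i → f i ^ p) to-point))
          (trans (sum-cong (λ i → ^-congˡ p (sym (+-identityʳ (f i))))) (powers 0#))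
        opposite-points : ∀ ε′ → f (point ε′) ^ p ≈ f (point (Fin.opposite ε′)) ^ p
        opposite-points zero       = +≈0⇒≈ points
        opposite-points (suc zero) = sym (+≈0⇒≈ points)
        opposite≢ : ∀ (ε′ : Fin 2) → Fin.opposite ε′ ≢ ε′
        opposite≢ zero       ()
        opposite≢ (suc zero) ()
        at-point : ∀ ε′ → f (point ε′) ^ p ≈ 0#
        at-point ε′ with ε′ Fin.≟ ε
        ... | no  ε′≢ε = elsewhere^p _ (λ eq → ε′≢ε (≡.trans (≡.sym (half-point ε′)) eq))
        ... | yes ε′≡ε = trans (opposite-points ε′)
                (elsewhere^p _ (λ eq → opposite≢ ε′ (≡.trans (≡.trans (≡.sym (half-point _)) eq) (≡.sym ε′≡ε))))
        f≈0 : ∀ i → f i ≈ 0#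
        f≈0 i = reduced⇒powers red p (f i) (trans (to-point i) (at-point (half i)))

  base-rigid : Rigid B ζ (λ _ → idHom B)
  base-rigid r f equi powers sum-f i j
    -- The case distinction concerns the residues of finitely many natural numbers, so it is
    -- decidable although equality in `B` is not.
    with Fin.any? {n = 2} (λ ε → Fin.any? (λ l → ¬? (r (ε , l) % p ℕ.≟ 0)))
  ... | yes (ε , l , r≢0) = trans (moved-case r f equi powers sum-f (ε , l) r≢0 i) (sym (moved-case r f equi powers sum-f (ε , l) r≢0 j))
  ... | no none = invariant-case r f equi powers sum-f r≡0 i j
    where
    r≡0 : ∀ g → r g % p ≡ 0
    r≡0 (ε , l) with r (ε , l) % p ℕ.≟ 0
    ... | yes eq = eq
    ... | no neq = contradiction (ε , l , neq) none

  module _ (p-odd : p % 2 ≡ 1) (x : Fin n → Carrier) where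
    open Generic B root x

    private
      generators : List (Fin 2 × Fin m)
      generators = cartesianProduct (allFin 2) (allFin m)

      stages : ∀ gs → Unique gs → Stage gs
      stages []       _                = initial base-rigid
      stages (g ∷ gs) (g≢gs ∷ unique) = Extend.extend (≡-dec Fin._≟_ Fin._≟_) g p-odd (τ^p g) (τ-comm g)
        (λ g∈gs → All.lookup g≢gs g∈gs ≡.refl) (stages gs unique)

    generic-stage : Stage generators
    generic-stage = stages generators (Unique.cartesianProduct⁺ (Unique.allFin⁺ 2) (Unique.allFin⁺ m))

    ∈-generators : ∀ g → g ∈ generators
    ∈-generators (ε , l) = ∈-cartesianProduct⁺ (∈-allFin ε) (∈-allFin l)

-- Polynomials in several variables: renaming and substitution.

module Products {c ℓ} (R : Ring₂ c ℓ) where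
  open Ring₂ R
  open Algebra.Properties.CommutativeMonoid.Sum *-commutativeMonoid public
    using () renaming (sum to prod; sum-cong-≋ to prod-cong; ∑-distrib-+ to prod-distrib-*; sum-permute to prod-permute)

  prod-1 : ∀ {n} (t : Fin n → Carrier) → (∀ i → t i ≈ 1#) → prod t ≈ 1#
  prod-1 {zero}  t t≈1 = refl
  prod-1 {suc n} t t≈1 = trans (*-cong (t≈1 zero) (prod-1 (t ∘ suc) (t≈1 ∘ suc))) (*-identityˡ 1#)

prod-homo : ∀ {a ℓ₁ b ℓ₂} {A : Ring₂ a ℓ₁} {B : Ring₂ b ℓ₂} (h : Hom A B) {n} (t : Fin n → Ring₂.Carrier A) →
            Ring₂._≈_ B (Hom.⟦ h ⟧ (Products.prod A t)) (Products.prod B (Hom.⟦ h ⟧ ∘ t))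
prod-homo h {zero}  t = Hom.1-homo h
prod-homo {B = B} h {suc n} t = trans (Hom.*-homo h _ _) (*-congˡ (prod-homo h (t ∘ suc)))
  where open Ring₂ B

Vec-ext : ∀ {n} {x y : Vec ℕ n} → (∀ i → lookup x i ≡ lookup y i) → x ≡ y
Vec-ext {x = x} {y} eq = ≡.trans (≡.sym (Vec.tabulate∘lookup x)) (≡.trans (Vec.tabulate-cong eq) (Vec.tabulate∘lookup y))

module Polynomials {c ℓ} (R : Ring₂ c ℓ) (n : ℕ) where
  open MonoidAlgebra R (Vec-monoid n) public
  private
    module R = Ring₂ R
    module E = DecMonoid (Vec-monoid n)
  open E using (_∙_)

  -- Pulling exponents back along a bijection `π` renames the variables along its inverse. A
  -- permutation `σ` therefore acts through `σ ⟨$⟩ˡ_`.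
  renameᵉ : (Fin n → Fin n) → Vec ℕ n → Vec ℕ n
  renameᵉ π e = tabulate (λ j → lookup e (π j))

  rename : (Fin n → Fin n) → Alg → Alg
  rename π = map (λ t → (proj₁ t , renameᵉ π (proj₂ t)))

  lin-rename : ∀ {d ℓ′} {T : Ring₂ d ℓ′} (h : Hom R T) φ π p →
               Linear.lin h φ (rename π p) ≡ Linear.lin h (φ ∘ renameᵉ π) p
  lin-rename         h φ π []            = ≡.refl
  lin-rename {T = T} h φ π ((a , m) ∷ p) = ≡.cong (Hom.⟦ h ⟧ a * φ (renameᵉ π m) +_) (lin-rename h φ π p)
    where open Ring₂ T

  renameᵉ-∙ : ∀ π x y → renameᵉ π (x ∙ y) ≡ renameᵉ π x ∙ renameᵉ π y
  renameᵉ-∙ π x y = Vec-ext λ i → ≡.trans (Vec.lookup∘tabulate _ i) (≡.trans (Vec.lookup-zipWith ℕ._+_ (π i) x y)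
    (≡.sym (≡.trans (Vec.lookup-zipWith ℕ._+_ i (renameᵉ π x) (renameᵉ π y))
      (≡.cong₂ ℕ._+_ (Vec.lookup∘tabulate (lookup x ∘ π) i) (Vec.lookup∘tabulate (lookup y ∘ π) i)))))

  renameᵉ-0 : ∀ π → renameᵉ π (replicate n 0) ≡ replicate n 0
  renameᵉ-0 π = Vec-ext λ i → ≡.trans (Vec.lookup∘tabulate _ i) (≡.trans (Vec.lookup-replicate (π i) 0) (≡.sym (Vec.lookup-replicate i 0)))

  private
    module A = Ring₂ algebra
    module L = Linear (idHom R)

  rename-++ : ∀ π p q → rename π (p ++ q) ≡ rename π p ++ rename π q
  rename-++ π []      q = ≡.refl
  rename-++ π (t ∷ p) q = ≡.cong (_ ∷_) (rename-++ π p q)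

  renaming-hom : (Fin n → Fin n) → Hom algebra algebra
  renaming-hom π = record
    { ⟦_⟧    = rename π
    ; cong   = λ {p} {q} p≈q → coeffs λ e → R.trans (R.reflexive (lin-rename (idHom R) (δ e) π p))
                 (R.trans (L.lin-resp (δ e ∘ renameᵉ π) p≈q) (R.reflexive (≡.sym (lin-rename (idHom R) (δ e) π q))))
    ; +-homo = λ p q → A.reflexive (rename-++ π p q)
    ; *-homo = λ p q → coeffs λ e → begin
        coeff (rename π (p *ᴬ q)) e
          ≡⟨ lin-rename (idHom R) (δ e) π (p *ᴬ q) ⟩
        L.lin (δ e ∘ renameᵉ π) (p *ᴬ q)
          ≈⟨ L.lin-* (δ e ∘ renameᵉ π) p q ⟩
        L.lin (λ s → L.lin (λ t → δ e (renameᵉ π (s ∙ t))) q) p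
          ≈⟨ L.lin-cong (λ s → L.lin-cong (λ t → R.reflexive (≡.cong (δ e) (renameᵉ-∙ π s t))) q) p ⟩
        L.lin (λ s → L.lin (λ t → δ e (renameᵉ π s ∙ renameᵉ π t)) q) p
          ≈⟨ L.lin-cong (λ s → R.reflexive (lin-rename (idHom R) (λ t → δ e (renameᵉ π s ∙ t)) π q)) p ⟨
        L.lin (λ s → L.lin (λ t → δ e (renameᵉ π s ∙ t)) (rename π q)) p
          ≡⟨ lin-rename (idHom R) (λ s → L.lin (λ t → δ e (s ∙ t)) (rename π q)) π p ⟨
        L.lin (λ s → L.lin (λ t → δ e (s ∙ t)) (rename π q)) (rename π p)
          ≈⟨ L.lin-* (δ e) (rename π p) (rename π q) ⟨
        coeff (rename π p *ᴬ rename π q) e ∎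
    ; 0-homo = A.refl
    ; 1-homo = A.reflexive (≡.cong mono (renameᵉ-0 π))
    }
    where open R.≈-Reasoning

  multiple : Fin n → ℕ → Vec ℕ n
  multiple j k = tabulate (λ i → if does (j Fin.≟ i) then k else 0)

  var : Fin n → Alg
  var j = mono (multiple j 1)

  private
    lookup-multiple : ∀ j k i → lookup (multiple j k) i ≡ (if does (j Fin.≟ i) then k else 0)
    lookup-multiple j k i = Vec.lookup∘tabulate _ i

    multiple-0 : ∀ j → multiple j 0 ≡ replicate n 0
    multiple-0 j = Vec-ext λ i → ≡.trans (lookup-multiple j 0 i) (≡.trans (const-if i) (≡.sym (Vec.lookup-replicate i 0)))
      where
      const-if : ∀ i → (if does (j Fin.≟ i) then 0 else 0) ≡ 0
      const-if i with j Fin.≟ i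
      ... | yes _ = ≡.refl
      ... | no  _ = ≡.refl

    multiple-suc : ∀ j k → multiple j (suc k) ≡ multiple j 1 ∙ multiple j k
    multiple-suc j k = Vec-ext λ i → ≡.trans (lookup-multiple j (suc k) i) (≡.trans (split i)
      (≡.sym (≡.trans (Vec.lookup-zipWith ℕ._+_ i (multiple j 1) (multiple j k)) (≡.cong₂ ℕ._+_ (lookup-multiple j 1 i) (lookup-multiple j k i)))))
      where
      split : ∀ i → (if does (j Fin.≟ i) then suc k else 0) ≡ (if does (j Fin.≟ i) then 1 else 0) ℕ.+ (if does (j Fin.≟ i) then k else 0)
      split i with j Fin.≟ i
      ... | yes _ = ≡.refl
      ... | no  _ = ≡.refl

    var^ : ∀ j k → var j A.^ k A.≈ mono (multiple j k)
    var^ j zero    = A.reflexive (≡.cong mono (≡.sym (multiple-0 j)))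
    var^ j (suc k) = A.trans (A.*-congˡ {var j} (var^ j k))
      (A.trans (A.sym (mono-∙ (multiple j 1) (multiple j k))) (A.reflexive (≡.cong mono (≡.sym (multiple-suc j k)))))

    total : ∀ {m} → (Fin m → Vec ℕ n) → Vec ℕ n
    total {zero}  t = replicate n 0
    total {suc m} t = t zero ∙ total (t ∘ suc)

    prod-mono : ∀ {m} (t : Fin m → Vec ℕ n) → Products.prod algebra (mono ∘ t) A.≈ mono (total t)
    prod-mono {zero}  t = A.refl
    prod-mono {suc m} t = A.trans (A.*-congˡ {mono (t zero)} (prod-mono (t ∘ suc))) (A.sym (mono-∙ (t zero) (total (t ∘ suc))))

    total-off : ∀ {m} (t : Fin m → Vec ℕ n) i → (∀ j → lookup (t j) i ≡ 0) → lookup (total t) i ≡ 0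
    total-off {zero}  t i t≡0 = Vec.lookup-replicate i 0
    total-off {suc m} t i t≡0 = ≡.trans (Vec.lookup-zipWith ℕ._+_ i (t zero) (total (t ∘ suc))) (≡.cong₂ ℕ._+_ (t≡0 zero) (total-off (t ∘ suc) i (t≡0 ∘ suc)))

    total-at : ∀ {m} (t : Fin m → Vec ℕ n) i j → (∀ j′ → j′ ≢ j → lookup (t j′) i ≡ 0) → lookup (total t) i ≡ lookup (t j) i
    total-at {suc m} t i zero    off = ≡.trans (Vec.lookup-zipWith ℕ._+_ i (t zero) (total (t ∘ suc)))
      (≡.trans (≡.cong (lookup (t zero) i ℕ.+_) (total-off (t ∘ suc) i (λ j′ → off (suc j′) λ ()))) (ℕ.+-identityʳ _))
    total-at {suc m} t i (suc j) off = ≡.trans (Vec.lookup-zipWith ℕ._+_ i (t zero) (total (t ∘ suc)))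
      (≡.trans (≡.cong (ℕ._+ lookup (total (t ∘ suc)) i) (off zero λ ()))
        (total-at (t ∘ suc) i j (λ j′ j′≢j → off (suc j′) λ { ≡.refl → j′≢j ≡.refl })))

    total-multiple : ∀ e → total (λ j → multiple j (lookup e j)) ≡ e
    total-multiple e = Vec-ext λ i → ≡.trans (total-at (λ j → multiple j (lookup e j)) i i (λ j j≢i → ≡.trans (lookup-multiple j _ i) (off j i j≢i)))
      (≡.trans (lookup-multiple i _ i) (on i))
      where
      off : ∀ j i → j ≢ i → (if does (j Fin.≟ i) then lookup e j else 0) ≡ 0
      off j i j≢i with j Fin.≟ i
      ... | yes j≡i = contradiction j≡i j≢i
      ... | no  _   = ≡.refl
      on : ∀ i → (if does (i Fin.≟ i) then lookup e i else 0) ≡ lookup e i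
      on i with i Fin.≟ i
      ... | yes _  = ≡.refl
      ... | no i≢i = contradiction ≡.refl i≢i

  mono-factor : ∀ e → Products.prod algebra (λ j → var j A.^ lookup e j) A.≈ mono e
  mono-factor e = A.trans (Products.prod-cong algebra {x = λ j → var j A.^ lookup e j} {λ j → mono (multiple j (lookup e j))} (λ j → var^ j (lookup e j)))
    (A.trans (prod-mono (λ j → multiple j (lookup e j))) (A.reflexive (≡.cong mono (total-multiple e))))

  module Substitution {d ℓ′} {T : Ring₂ d ℓ′} (h : Hom R T) where
    private module T = Ring₂ T
    open Products T

    monomial : (Fin n → T.Carrier) → Vec ℕ n → T.Carrier
    monomial u e = prod (λ j → u j T.^ lookup e j)

    private
      monomial-0 : ∀ u → monomial u (replicate n 0) T.≈ T.1#
      monomial-0 u = prod-1 _ (λ j → T.^-congʳ (u j) (Vec.lookup-replicate j 0))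

      monomial-∙ : ∀ u x y → monomial u (x ∙ y) T.≈ monomial u x T.* monomial u y
      monomial-∙ u x y = T.trans
        (prod-cong (λ j → T.trans (T.^-congʳ (u j) (Vec.lookup-zipWith ℕ._+_ j x y)) (T.^-homo-* (u j) (lookup x j) (lookup y j))))
        (prod-distrib-* (λ j → u j T.^ lookup x j) (λ j → u j T.^ lookup y j))

    substitute : (Fin n → T.Carrier) → Hom algebra T
    substitute u = Evaluation.eval h (monomial u) (monomial-0 u) (monomial-∙ u)

    monomial-cong : ∀ {u v} → (∀ i → u i T.≈ v i) → ∀ e → monomial u e T.≈ monomial v e
    monomial-cong u≈v e = prod-cong (λ j → T.^-congˡ (lookup e j) (u≈v j))

    substitute-cong : ∀ {u v} → (∀ i → u i T.≈ v i) → ∀ p → Hom.⟦ substitute u ⟧ p T.≈ Hom.⟦ substitute v ⟧ p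
    substitute-cong u≈v p = Linear.lin-cong h (monomial-cong u≈v) p

    substitute-rename : ∀ (π : Permutation′ n) u p →
      Hom.⟦ substitute u ⟧ (rename (π ⟨$⟩ˡ_) p) T.≈ Hom.⟦ substitute (λ i → u (π ⟨$⟩ʳ i)) ⟧ p
    substitute-rename π u p = T.trans (T.reflexive (lin-rename h (monomial u) (π ⟨$⟩ˡ_) p)) (Linear.lin-cong h permuted p)
      where
      permuted : ∀ e → monomial u (renameᵉ (π ⟨$⟩ˡ_) e) T.≈ monomial (λ i → u (π ⟨$⟩ʳ i)) e
      permuted e = T.trans (prod-permute (λ j → u j T.^ lookup (renameᵉ (π ⟨$⟩ˡ_) e) j) π)
        (prod-cong (λ i → T.^-congʳ (u (π ⟨$⟩ʳ i))
          (≡.trans (Vec.lookup∘tabulate _ (π ⟨$⟩ʳ i)) (≡.cong (lookup e) (inverseˡ π)))))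

  substitute-natural : ∀ {d ℓ₁ d′ ℓ₂} {T : Ring₂ d ℓ₁} {T′ : Ring₂ d′ ℓ₂} (h : Hom R T) (h′ : Hom R T′) (k : Hom T T′) →
    (∀ a → Ring₂._≈_ T′ (Hom.⟦ k ⟧ (Hom.⟦ h ⟧ a)) (Hom.⟦ h′ ⟧ a)) → ∀ u p →
    Ring₂._≈_ T′ (Hom.⟦ k ⟧ (Hom.⟦ Substitution.substitute h u ⟧ p)) (Hom.⟦ Substitution.substitute h′ (Hom.⟦ k ⟧ ∘ u) ⟧ p)
  substitute-natural {T = T} {T′} h h′ k k∘h u []            = Hom.0-homo k
  substitute-natural {T = T} {T′} h h′ k k∘h u ((a , m) ∷ p) = T′.trans (Hom.+-homo k _ _)
    (T′.+-cong (T′.trans (Hom.*-homo k _ _) (T′.*-cong (k∘h a) (T′.trans (prod-homo k (λ j → u j T.^ lookup m j))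
                 (Products.prod-cong T′ (λ j → Hom.^-homo k (u j) (lookup m j))))))
               (substitute-natural h h′ k k∘h u p))
    where
    module T = Ring₂ T
    module T′ = Ring₂ T′

  substitute-vars : ∀ {d ℓ′} {T : Ring₂ d ℓ′} (k : Hom algebra T) p →
    Ring₂._≈_ T (Hom.⟦ Substitution.substitute (k ∘ʰ const) (Hom.⟦ k ⟧ ∘ var) ⟧ p) (Hom.⟦ k ⟧ p)
  substitute-vars {T = T} k []            = T.sym (Hom.0-homo k)
    where module T = Ring₂ T
  substitute-vars {T = T} k ((a , m) ∷ p) = T.trans
    (T.+-cong (T.trans (T.*-congˡ (T.trans (Products.prod-cong T (λ j → T.sym (Hom.^-homo k (var j) (lookup m j))))
                (T.trans (T.sym (prod-homo k (λ j → var j A.^ lookup m j))) (Hom.cong k (mono-factor m)))))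
                (T.trans (T.sym (Hom.*-homo k (Hom.⟦ const ⟧ a) (mono m))) (Hom.cong k (A.sym (term≈const*mono a m)))))
              (substitute-vars k p))
    (T.sym (Hom.+-homo k ((a , m) ∷ []) p))
    where module T = Ring₂ T

module PowerSums {c ℓ} (S : Ring₂ c ℓ) {n} (f : Fin n → Ring₂.Carrier S) where
  open Ring₂ S

  shifted-power-sums : ∀ p → (∀ j → j ℕ.≤ p → sum {n} (λ i → f i ^ j) ≈ 0#) → ∀ s → sum {n} (λ i → (f i + s) ^ p) ≈ 0#
  shifted-power-sums p power-sum s = trans (sum-cong {n} (λ i → sym (*-identityˡ ((f i + s) ^ p)))) (mixed p 0 (ℕ.≤-reflexive (ℕ.+-identityʳ p)))
    where
    -- Generalising to mixed products lets the factors `f i + s` be expanded one at a time, with no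
    -- binomial coefficients.
    mixed : ∀ b a → b ℕ.+ a ℕ.≤ p → sum {n} (λ i → f i ^ a * (f i + s) ^ b) ≈ 0#
    mixed zero    a a≤p   = trans (sum-cong {n} (λ i → *-identityʳ (f i ^ a))) (power-sum a a≤p)
    mixed (suc b) a b+a<p = begin
      sum {n} (λ i → f i ^ a * ((f i + s) * (f i + s) ^ b))
        ≈⟨ sum-cong {n} (λ i → expand (f i) ((f i + s) ^ b) (f i ^ a)) ⟩
      sum {n} (λ i → f i ^ suc a * (f i + s) ^ b + s * (f i ^ a * (f i + s) ^ b))
        ≈⟨ ∑-distrib-+ (λ i → f i ^ suc a * (f i + s) ^ b) (λ i → s * (f i ^ a * (f i + s) ^ b)) ⟩
      sum {n} (λ i → f i ^ suc a * (f i + s) ^ b) + sum {n} (λ i → s * (f i ^ a * (f i + s) ^ b))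
        ≈⟨ +-cong (mixed b (suc a) (≡.subst (ℕ._≤ p) (≡.sym (ℕ.+-suc b a)) b+a<p))
             (trans (sym (*-distribˡ-sum {n} s _)) (trans (*-congˡ (mixed b a (ℕ.<⇒≤ b+a<p))) (zeroʳ s))) ⟩
      0# + 0#
        ≈⟨ +-identityˡ 0# ⟩
      0# ∎
      where
      open ≈-Reasoning
      expand : ∀ x y z → z * ((x + s) * y) ≈ (x * z) * y + s * (z * y)
      expand x y z = trans (*-congˡ (distribʳ y x s)) (trans (distribˡ z _ _)
        (+-cong (trans (sym (*-assoc z x y)) (*-congʳ (*-comm z x))) (x*[y*z]≈y*[x*z] z s y)))

-- Equivariant families of polynomials with vanishing power sums.

module EquivariantPolynomials {c ℓ} (R : Ring₂ c ℓ) (red : Ring₂.Reduced R)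
  {p m n : ℕ} (pr : Prime p) (p-odd : p % 2 ≡ 1) (n-even : n % 2 ≡ 0) .{{_ : NonZero p}} (orbits : TwoOrbits c ℓ p m n) where
  open TwoOrbits orbits using (τ)
  open Polynomials R n
  private
    module P = Ring₂ algebra

    module OverExtension (B : Ring₂ c ℓ) (B-red : Ring₂.Reduced B) (root : RootOfUnity B p)
      (embed : Hom algebra B) (embed-injective : ∀ a → Ring₂._≈_ B (Hom.⟦ embed ⟧ a) (Ring₂.0# B) → a P.≈ P.0#) where
      private module B = Ring₂ B
      open BaseRigidity orbits B B-red root
      x : Fin n → B.Carrier
      x i = Hom.⟦ embed ⟧ (var i)
      open Equivariance {c} {ℓ} n p (Fin 2 × Fin m) τ
      open Generic.Stage (generic-stage p-odd x)
      private module S = Ring₂ S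

      κ : Hom R S
      κ = ι ∘ʰ embed ∘ʰ const

      open Substitution κ

      module _ (f : Fin n → Alg) (π : Fin 2 × Fin m → Permutation′ n) (π≗τ : ∀ g i → π g ⟨$⟩ʳ i ≡ τ g i)
        (equi : ∀ g i → rename (π g ⟨$⟩ˡ_) (f i) P.≈ f (τ g i))
        (power-sums : ∀ j → 1 ℕ.≤ j → j ℕ.≤ p → P.sum (λ i → f i P.^ j) P.≈ P.0#) where

        value : Fin n → S.Carrier
        value i = Hom.⟦ substitute u ⟧ (f i)

        -- Permuting the variables before substituting `u` amounts to applying `σ g` afterwards,
        -- because `u` is equivariant and `σ g` fixes the image of `κ`.
        value-equi : ∀ g i → value (τ g i) S.≈ Hom.⟦ σ g ⟧ (value i)
        value-equi g i = begin
          Hom.⟦ substitute u ⟧ (f (τ g i))                          ≈⟨ Hom.cong (substitute u) (equi g i) ⟨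
          Hom.⟦ substitute u ⟧ (rename (π g ⟨$⟩ˡ_) (f i))           ≈⟨ substitute-rename (π g) u (f i) ⟩
          Hom.⟦ substitute (λ i → u (π g ⟨$⟩ʳ i)) ⟧ (f i)           ≈⟨ substitute-cong (λ i → S.trans (S.reflexive (≡.cong u (π≗τ g i))) (u-equi (∈-generators p-odd x g) i)) (f i) ⟩
          Hom.⟦ substitute (Hom.⟦ σ g ⟧ ∘ u) ⟧ (f i)                ≈⟨ substitute-natural κ κ (σ g) (λ a → σ-ι g _) u (f i) ⟨
          Hom.⟦ σ g ⟧ (value i)                                     ∎
          where open S.≈-Reasoning

        value-power-sums : ∀ j → j ℕ.≤ p → S.sum (λ i → value i S.^ j) S.≈ S.0#
        -- The exponent 0 counts the indices, an even number; this sum is the coefficient of s^p in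
        -- the expanded shifted power sum.
        value-power-sums zero    _   = ConstantSums.sum-const-even S n S.1# n-even
        value-power-sums (suc j) j<p = begin
          S.sum (λ i → value i S.^ suc j)                             ≈⟨ S.sum-cong (λ i → Hom.^-homo (substitute u) (f i) (suc j)) ⟨
          S.sum (λ i → Hom.⟦ substitute u ⟧ (f i P.^ suc j))          ≈⟨ Hom.sum-homo (substitute u) (λ i → f i P.^ suc j) ⟨
          Hom.⟦ substitute u ⟧ (P.sum (λ i → f i P.^ suc j))          ≈⟨ Hom.cong (substitute u) (power-sums (suc j) (s≤s z≤n) j<p) ⟩
          S.0#                                                        ∎
          where open S.≈-Reasoning

        values-agree : ∀ i j → value i S.≈ value j
        values-agree = rigid (λ _ → 0) value (λ g i → S.trans (value-equi g i) (S.sym (S.*-identityˡ _)))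
          (PowerSums.shifted-power-sums S value p value-power-sums)
          (S.trans (S.sum-cong (λ i → S.sym (S.*-identityʳ (value i)))) (value-power-sums 1 (ℕ.>-nonZero⁻¹ p)))

        -- Setting every α to 1 turns `u` back into the variables, so agreement of the values in `S`
        -- yields agreement of the polynomials.
        spec-value : ∀ i → Hom.⟦ spec ⟧ (value i) B.≈ Hom.⟦ embed ⟧ (f i)
        spec-value i = B.trans (substitute-natural κ (embed ∘ʰ const) spec (λ a → spec-ι _) u (f i))
          (B.trans (Substitution.substitute-cong (embed ∘ʰ const) spec-u (f i)) (substitute-vars embed (f i)))

        all-equal : ∀ i j → f i P.≈ f j
        all-equal i j = P.+≈0⇒≈ (embed-injective (f i P.+ f j) (B.trans (Hom.+-homo embed (f i) (f j))
          (B.≈⇒+≈0 (B.trans (B.sym (spec-value i)) (B.trans (Hom.cong spec (values-agree i j)) (spec-value j))))))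

    private
      h : ℕ
      h = suc (p / 2)

      2h≡1+p : h ℕ.+ h ≡ suc p
      2h≡1+p = ≡.cong suc (≡.trans (ℕ.+-suc (p / 2) (p / 2)) (≡.sym (≡.trans (m≡m%n+[m/n]*n p 2)
        (≡.cong₂ ℕ._+_ p-odd (≡.trans (ℕ.*-comm (p / 2) 2) (≡.cong (p / 2 ℕ.+_) (ℕ.+-identityʳ (p / 2))))))))

      module Z = Adjoin-ζ algebra (algebra-reduced ∙-injective-Vec red) pr h 2h≡1+p

  open OverExtension Z.extension Z.extension-reduced Z.extension-root Z.embed Z.embed-injective public using (all-equal)

-- Fields of fractions without decidable equality.

module Fractions {c ℓ} (R : Ring₂ c ℓ) (1≉0 : ¬ (Ring₂._≈_ R (Ring₂.1# R) (Ring₂.0# R)))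
  (cancel : ∀ {x y} → Ring₂._≈_ R (Ring₂._*_ R x y) (Ring₂.0# R) → ¬ (Ring₂._≈_ R y (Ring₂.0# R)) → Ring₂._≈_ R x (Ring₂.0# R)) where
  private module R = Ring₂ R
  open R using (_≈_; _+_; _*_; 0#; 1#)
  open Algebra.Solver.Ring.NaturalCoefficients.Default R.commutativeSemiring using (solve; _:=_; _:+_; _:*_)

  *-nonzero : ∀ {x y} → ¬ (x ≈ 0#) → ¬ (y ≈ 0#) → ¬ (x * y ≈ 0#)
  *-nonzero x≉0 y≉0 xy≈0 = x≉0 (cancel xy≈0 y≉0)

  *-cancelʳ : ∀ {x y z} → ¬ (z ≈ 0#) → x * z ≈ y * z → x ≈ y
  *-cancelʳ {x} {y} {z} z≉0 xz≈yz = R.+≈0⇒≈ (cancel (R.trans (R.distribʳ z x y) (R.≈⇒+≈0 xz≈yz)) z≉0)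

  record Frac : Set (c ⊔ ℓ) where
    constructor frac
    field
      num den : R.Carrier
      den≉0   : ¬ (den ≈ 0#)
  open Frac public

  infix 4 _≈ᶠ_
  record _≈ᶠ_ (x y : Frac) : Set ℓ where
    constructor cross
    field crossed : num x * den y ≈ num y * den x
  open _≈ᶠ_ public

  private
    _+ᶠ_ _*ᶠ_ : Frac → Frac → Frac
    x +ᶠ y = frac (num x * den y + num y * den x) (den x * den y) (*-nonzero (den≉0 x) (den≉0 y))
    x *ᶠ y = frac (num x * num y) (den x * den y) (*-nonzero (den≉0 x) (den≉0 y))

    0ᶠ 1ᶠ : Frac
    0ᶠ = frac 0# 1# 1≉0
    1ᶠ = frac 1# 1# 1≉0

    ≈ᶠ-isEquivalence : IsEquivalence _≈ᶠ_
    ≈ᶠ-isEquivalence = record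
      { refl  = cross R.refl
      ; sym   = λ e → cross (R.sym (crossed e))
      ; trans = λ {x} {y} {z} e f → cross (*-cancelʳ (den≉0 y) (begin
          (num x * den z) * den y  ≈⟨ solve 3 (λ a b c → (a :* b) :* c := (a :* c) :* b) R.refl (num x) (den z) (den y) ⟩
          (num x * den y) * den z  ≈⟨ R.*-congʳ (crossed e) ⟩
          (num y * den x) * den z  ≈⟨ solve 3 (λ a b c → (a :* b) :* c := (a :* c) :* b) R.refl (num y) (den x) (den z) ⟩
          (num y * den z) * den x  ≈⟨ R.*-congʳ (crossed f) ⟩
          (num z * den y) * den x  ≈⟨ solve 3 (λ a b c → (a :* b) :* c := (a :* c) :* b) R.refl (num z) (den y) (den x) ⟩
          (num z * den x) * den y  ∎))
      }
      where open R.≈-Reasoning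

    +ᶠ-cong : ∀ {x x′ y y′} → x ≈ᶠ x′ → y ≈ᶠ y′ → (x +ᶠ y) ≈ᶠ (x′ +ᶠ y′)
    +ᶠ-cong {frac a d _} {frac a′ d′ _} {frac b e _} {frac b′ e′ _} (cross f) (cross g) = cross (begin
      (a * e + b * d) * (d′ * e′)
        ≈⟨ solve 6 (λ a e b d d′ e′ → (a :* e :+ b :* d) :* (d′ :* e′) := (a :* d′) :* (e :* e′) :+ (b :* e′) :* (d :* d′)) R.refl a e b d d′ e′ ⟩
      (a * d′) * (e * e′) + (b * e′) * (d * d′)
        ≈⟨ R.+-cong (R.*-congʳ f) (R.*-congʳ g) ⟩
      (a′ * d) * (e * e′) + (b′ * e) * (d * d′)
        ≈⟨ solve 6 (λ a e b d d′ e′ → (a :* d) :* (e :* e′) :+ (b :* e) :* (d :* d′) := (a :* e′ :+ b :* d′) :* (d :* e)) R.refl a′ e b′ d d′ e′ ⟩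
      (a′ * e′ + b′ * d′) * (d * e) ∎)
      where open R.≈-Reasoning

    *ᶠ-cong : ∀ {x x′ y y′} → x ≈ᶠ x′ → y ≈ᶠ y′ → (x *ᶠ y) ≈ᶠ (x′ *ᶠ y′)
    *ᶠ-cong (cross f) (cross g) = cross (R.trans (R.*-interchange _ _ _ _) (R.trans (R.*-cong f g) (R.*-interchange _ _ _ _)))

  fractions : Ring₂ (c ⊔ ℓ) ℓ
  fractions = record
    { commutativeSemiring = record
      { Carrier = Frac ; _≈_ = _≈ᶠ_ ; _+_ = _+ᶠ_ ; _*_ = _*ᶠ_ ; 0# = 0ᶠ ; 1# = 1ᶠ
      ; isCommutativeSemiring = isCommutativeSemiringˡ record
        { +-isCommutativeMonoid = record
          { isMonoid = record
            { isSemigroup = record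
              { isMagma = record { isEquivalence = ≈ᶠ-isEquivalence ; ∙-cong = +ᶠ-cong }
              ; assoc = λ { (frac a d _) (frac b e _) (frac c f _) → cross (solve 6
                  (λ a b c d e f → ((a :* e :+ b :* d) :* f :+ c :* (d :* e)) :* (d :* (e :* f))
                                := (a :* (e :* f) :+ (b :* f :+ c :* e) :* d) :* ((d :* e) :* f)) R.refl a b c d e f) } }
            ; identity = (λ x → +ᶠ-identityˡ x) , λ x → IsEquivalence.trans ≈ᶠ-isEquivalence (+ᶠ-comm x 0ᶠ) (+ᶠ-identityˡ x) }
          ; comm = +ᶠ-comm }
        ; *-isCommutativeMonoid = record
          { isMonoid = record
            { isSemigroup = record
              { isMagma = record { isEquivalence = ≈ᶠ-isEquivalence ; ∙-cong = *ᶠ-cong }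
              ; assoc = λ { (frac a d _) (frac b e _) (frac c f _) → cross (solve 6
                  (λ a b c d e f → ((a :* b) :* c) :* (d :* (e :* f)) := (a :* (b :* c)) :* ((d :* e) :* f)) R.refl a b c d e f) } }
            ; identity = (λ { (frac a d _) → cross (R.*-cong (R.*-identityˡ a) (R.sym (R.*-identityˡ d))) })
                       , (λ { (frac a d _) → cross (R.*-cong (R.*-identityʳ a) (R.sym (R.*-identityʳ d))) }) }
          ; comm = λ { (frac a d _) (frac b e _) → cross (R.*-cong (R.*-comm a b) (R.*-comm e d)) } }
        ; distribʳ = λ { (frac a d _) (frac b e _) (frac c f _) → cross (solve 6
            (λ a b c d e f → ((b :* f :+ c :* e) :* a) :* ((e :* d) :* (f :* d))
                          := ((b :* a) :* (f :* d) :+ (c :* a) :* (e :* d)) :* ((e :* f) :* d)) R.refl a b c d e f) }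
        ; zeroˡ = λ { (frac a d _) → cross (R.trans (R.*-congʳ (R.zeroˡ a)) (R.trans (R.zeroˡ _) (R.sym (R.zeroˡ _)))) }
        } }
    ; x+x≈0 = λ { (frac a d _) → cross (R.trans (R.*-congʳ (R.x+x≈0 _)) (R.trans (R.zeroˡ _) (R.sym (R.zeroˡ _)))) }
    }
    where
    open import Algebra.Structures.Biased _≈ᶠ_ using (isCommutativeSemiringˡ)
    +ᶠ-comm : ∀ x y → (x +ᶠ y) ≈ᶠ (y +ᶠ x)
    +ᶠ-comm x y = cross (R.*-cong (R.+-comm _ _) (R.*-comm _ _))
    +ᶠ-identityˡ : ∀ x → (0ᶠ +ᶠ x) ≈ᶠ x
    +ᶠ-identityˡ (frac a d _) = cross (R.*-cong (R.trans (R.+-congʳ (R.zeroˡ d)) (R.trans (R.+-identityˡ _) (R.*-identityʳ a))) (R.sym (R.*-identityˡ d)))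

  private module K = Ring₂ fractions

  fromRing : Hom R fractions
  fromRing = record
    { ⟦_⟧    = λ a → frac a 1# 1≉0
    ; cong   = λ a≈b → cross (R.*-congʳ a≈b)
    ; +-homo = λ a b → cross (R.*-cong (R.sym (R.+-cong (R.*-identityʳ a) (R.*-identityʳ b))) (R.*-identityʳ 1#))
    ; *-homo = λ a b → cross (R.*-congˡ (R.*-identityʳ 1#))
    ; 0-homo = K.refl
    ; 1-homo = K.refl
    }

  fromRing-injective : ∀ {a b} → Hom.⟦ fromRing ⟧ a K.≈ Hom.⟦ fromRing ⟧ b → a ≈ b
  fromRing-injective (cross e) = R.trans (R.sym (R.*-identityʳ _)) (R.trans e (R.*-identityʳ _))

  inverse : ∀ x → ¬ (num x ≈ 0#) → ∃[ y ] x K.* y K.≈ K.1#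
  inverse (frac a d d≉0) a≉0 = frac d a a≉0 , cross (R.trans (R.*-identityʳ _) (R.trans (R.*-comm a d) (R.sym (R.*-identityˡ _))))

  extendHom : (h : Hom R R) → (∀ {a} → Hom.⟦ h ⟧ a ≈ 0# → a ≈ 0#) → Hom fractions fractions
  extendHom h h-injective = record
    { ⟦_⟧    = λ x → frac h.⟦ num x ⟧ h.⟦ den x ⟧ (den≉0 x ∘ h-injective)
    ; cong   = λ {x} {y} e → cross (R.trans (R.sym (h.*-homo (num x) (den y))) (R.trans (h.cong (crossed e)) (h.*-homo (num y) (den x))))
    ; +-homo = λ x y → cross (R.*-cong
        (R.trans (h.+-homo (num x * den y) (num y * den x)) (R.+-cong (h.*-homo (num x) (den y)) (h.*-homo (num y) (den x))))
        (R.sym (h.*-homo (den x) (den y))))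
    ; *-homo = λ x y → cross (R.*-cong (h.*-homo (num x) (num y)) (R.sym (h.*-homo (den x) (den y))))
    ; 0-homo = cross (R.*-cong h.0-homo (R.sym h.1-homo))
    ; 1-homo = cross (R.*-cong h.1-homo (R.sym h.1-homo))
    }
    where module h = Hom h

-- Lagrange interpolation and the trace as a sum of conjugates.

module Interpolation {c ℓ} (K : Ring₂ c ℓ) where
  open Ring₂ K
  open Algebra.Solver.Ring.NaturalCoefficients.Default commutativeSemiring using (solve; _:=_; _:+_; _:*_)

  value : ∀ {n} → (Fin n → Carrier) → Carrier → Carrier
  value {n} f t = sum {n} (λ j → f j * t ^ Fin.toℕ j)

  private
    horner : ∀ {n} (f : Fin (suc n) → Carrier) t → value f t ≈ f zero + t * value (f ∘ suc) t
    horner {n} f t = +-cong (*-identityʳ (f zero))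
      (trans (sum-cong {n} (λ j → x*[y*z]≈y*[x*z] (f (suc j)) t (t ^ Fin.toℕ j)))
             (sym (*-distribˡ-sum {n} t (λ j → f (suc j) * t ^ Fin.toℕ j))))

    -- Synthetic division: the coefficients of (f(t) + f(a)) / (t + a).
    quotient : ∀ {n} → (Fin (suc n) → Carrier) → Carrier → Fin n → Carrier
    quotient {suc n} f a zero    = value (f ∘ suc) a
    quotient {suc n} f a (suc j) = quotient (f ∘ suc) a j

    quotient-value : ∀ {n} (f : Fin (suc n) → Carrier) a t → value f t + value f a ≈ (t + a) * value (quotient f a) t
    quotient-value {zero}  f a t = trans (x+x≈0 _) (sym (zeroʳ _))
    quotient-value {suc n} f a t = begin
      value f t + value f a
        ≈⟨ +-cong (horner f t) (horner f a) ⟩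
      (f zero + t * g t) + (f zero + a * g a)
        ≈⟨ trans (+-interchange _ _ _ _) (trans (+-congʳ (x+x≈0 _)) (+-identityˡ _)) ⟩
      t * g t + a * g a
        ≈⟨ trans (+-congˡ (x+x≈0 (t * g a))) (+-identityʳ _) ⟨
      (t * g t + a * g a) + (t * g a + t * g a)
        ≈⟨ solve 4 (λ t a gt ga → (t :* gt :+ a :* ga) :+ (t :* ga :+ t :* ga) := (t :+ a) :* ga :+ t :* (gt :+ ga)) refl t a (g t) (g a) ⟩
      (t + a) * g a + t * (g t + g a)
        ≈⟨ +-congˡ (*-congˡ (quotient-value (f ∘ suc) a t)) ⟩
      (t + a) * g a + t * ((t + a) * value (quotient (f ∘ suc) a) t)
        ≈⟨ trans (+-congˡ (x*[y*z]≈y*[x*z] t (t + a) _)) (sym (distribˡ (t + a) _ _)) ⟩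
      (t + a) * (g a + t * value (quotient (f ∘ suc) a) t)
        ≈⟨ *-congˡ (horner (quotient f a) t) ⟨
      (t + a) * value (quotient f a) t ∎
      where
      open ≈-Reasoning
      g = value (f ∘ suc)

    value-0 : ∀ {n} (f : Fin n → Carrier) t → (∀ j → f j ≈ 0#) → value f t ≈ 0#
    value-0 {n} f t f≈0 = sum-0 {n} _ (λ j → trans (*-congʳ (f≈0 j)) (zeroˡ _))

    -- Division loses only the constant term: each coefficient of the quotient is one of `f` plus a
    -- combination of higher ones, so the vanishing propagates from the top downwards.
    quotient-0 : ∀ {n} (f : Fin (suc n) → Carrier) a → (∀ j → quotient f a j ≈ 0#) → ∀ j → f (suc j) ≈ 0#
    quotient-0 {suc n} f a q≈0 = all
      where
      later : ∀ j → f (suc (suc j)) ≈ 0#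
      later = quotient-0 (f ∘ suc) a (q≈0 ∘ suc)
      all : ∀ j → f (suc j) ≈ 0#
      all zero    = trans (sym (trans (horner (f ∘ suc) a)
        (trans (+-congˡ (trans (*-congˡ (value-0 (λ j → f (suc (suc j))) a later)) (zeroʳ a))) (+-identityʳ _)))) (q≈0 zero)
      all (suc j) = later j

    times-linear : ∀ {n} (f : Fin n → Carrier) a → ∃[ g ] (∀ t → value {suc n} g t ≈ (t + a) * value f t)
    times-linear {zero}  f a = (λ _ → 0#) , λ t → trans (value-0 {1} (λ _ → 0#) t (λ _ → refl)) (sym (zeroʳ _))
    times-linear {suc n} f a with g , g-value ← times-linear (f ∘ suc) a = g′ , λ t → begin
      value g′ t
        ≈⟨ trans (horner g′ t) (+-congˡ (*-congˡ (horner (g′ ∘ suc) t))) ⟩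
      a * f zero + t * ((g zero + f zero) + t * value (g ∘ suc) t)
        ≈⟨ solve 5 (λ a f0 t g0 v → a :* f0 :+ t :* ((g0 :+ f0) :+ t :* v) := (t :+ a) :* f0 :+ t :* (g0 :+ t :* v)) refl a (f zero) t (g zero) (value (g ∘ suc) t) ⟩
      (t + a) * f zero + t * (g zero + t * value (g ∘ suc) t)
        ≈⟨ +-congˡ (*-congˡ (trans (sym (horner g t)) (g-value t))) ⟩
      (t + a) * f zero + t * ((t + a) * value (f ∘ suc) t)
        ≈⟨ trans (+-congˡ (x*[y*z]≈y*[x*z] t (t + a) _)) (sym (distribˡ (t + a) _ _)) ⟩
      (t + a) * (f zero + t * value (f ∘ suc) t)
        ≈⟨ *-congˡ (horner f t) ⟨
      (t + a) * value f t ∎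
      where
      open ≈-Reasoning
      g′ : Fin (suc (suc n)) → Carrier
      g′ zero          = a * f zero
      g′ (suc zero)    = g zero + f zero
      g′ (suc (suc j)) = g (suc j)

  -- Differences of nodes come with explicit inverses, so that interpolation never has to test an
  -- element for zero.
  Separated : ∀ {n} → (Fin n → Carrier) → Set (c ⊔ ℓ)
  Separated x = ∀ i j → i ≢ j → ∃[ y ] (x i + x j) * y ≈ 1#

  private
    tail-separated : ∀ {n} (x : Fin (suc n) → Carrier) → Separated x → Separated (x ∘ suc)
    tail-separated x sep i j i≢j = sep (suc i) (suc j) λ { ≡.refl → i≢j ≡.refl }

    suc≢zero : ∀ {n} {k : Fin n} → Fin.suc k ≢ zero
    suc≢zero ()

  -- Dividing out the first root lowers the number of coefficients by one, and the invertible
  -- differences pass the other roots on to the quotient.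
  roots⇒0 : ∀ {n} (x : Fin n → Carrier) → Separated x → (f : Fin n → Carrier) → (∀ k → value f (x k) ≈ 0#) → ∀ j → f j ≈ 0#
  roots⇒0 {zero}  x sep f roots ()
  roots⇒0 {suc n} x sep f roots = all
    where
    q = quotient f (x zero)
    q-roots : ∀ k → value q (x (suc k)) ≈ 0#
    q-roots k with y , inv ← sep (suc k) zero suc≢zero = begin
      value q (x (suc k))                                    ≈⟨ *-identityʳ _ ⟨
      value q (x (suc k)) * 1#                               ≈⟨ *-congˡ inv ⟨
      value q (x (suc k)) * ((x (suc k) + x zero) * y)       ≈⟨ solve 3 (λ v d y → v :* (d :* y) := (d :* v) :* y) refl _ _ y ⟩
      ((x (suc k) + x zero) * value q (x (suc k))) * y       ≈⟨ *-congʳ (quotient-value f (x zero) (x (suc k))) ⟨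
      (value f (x (suc k)) + value f (x zero)) * y           ≈⟨ *-congʳ (trans (+-cong (roots (suc k)) (roots zero)) (+-identityˡ 0#)) ⟩
      0# * y                                                 ≈⟨ zeroˡ y ⟩
      0#                                                     ∎
      where open ≈-Reasoning
    later : ∀ j → f (suc j) ≈ 0#
    later = quotient-0 f (x zero) (roots⇒0 (x ∘ suc) (tail-separated x sep) q q-roots)
    all : ∀ j → f j ≈ 0#
    all zero    = trans (sym (trans (horner f (x zero)) (trans (+-congˡ (trans (*-congˡ (value-0 (f ∘ suc) (x zero) later)) (zeroʳ _))) (+-identityʳ _)))) (roots zero)
    all (suc j) = later j

  -- Newton's form: v₀ plus t + x₀ times the polynomial that interpolates the divided differences at
  -- the remaining nodes.
  interpolate : ∀ {n} (x : Fin n → Carrier) → Separated x → (v : Fin n → Carrier) → ∃[ f ] (∀ k → value {n} f (x k) ≈ v k)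
  interpolate {zero}  x sep v = (λ ()) , λ ()
  interpolate {suc n} x sep v
    with f , f-value ← interpolate (x ∘ suc) (tail-separated x sep) (λ k → (v (suc k) + v zero) * proj₁ (sep (suc k) zero suc≢zero))
    with g , g-value ← times-linear f (x zero) = g′ , g′-value
    where
    open ≈-Reasoning
    g′ : Fin (suc n) → Carrier
    g′ zero    = g zero + v zero
    g′ (suc j) = g (suc j)
    g′-at : ∀ t → value g′ t ≈ (t + x zero) * value f t + v zero
    g′-at t = trans (horner g′ t) (trans (trans (+-assoc _ _ _) (trans (+-congˡ (+-comm _ _)) (sym (+-assoc _ _ _))))
      (+-congʳ (trans (sym (horner g t)) (g-value t))))
    g′-value : ∀ k → value g′ (x k) ≈ v k
    g′-value zero    = trans (g′-at (x zero)) (trans (+-congʳ (trans (*-congʳ (x+x≈0 _)) (zeroˡ _))) (+-identityˡ _))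
    g′-value (suc k) = begin
      value g′ (x (suc k))
        ≈⟨ g′-at (x (suc k)) ⟩
      (x (suc k) + x zero) * value f (x (suc k)) + v zero
        ≈⟨ +-congʳ (*-congˡ (f-value k)) ⟩
      (x (suc k) + x zero) * ((v (suc k) + v zero) * proj₁ (sep (suc k) zero suc≢zero)) + v zero
        ≈⟨ +-congʳ (trans (x*[y*z]≈y*[x*z] _ _ _) (trans (*-congˡ (proj₂ (sep (suc k) zero suc≢zero))) (*-identityʳ _))) ⟩
      (v (suc k) + v zero) + v zero
        ≈⟨ trans (+-assoc _ _ _) (trans (+-congˡ (x+x≈0 _)) (+-identityʳ _)) ⟩
      v (suc k) ∎

  -- Lagrange interpolation identifies row i of C, and its diagonal entries add up to Σ z.
  trace≈sum : ∀ {n} (x : Fin n → Carrier) → Separated x → (z : Fin n → Carrier) (C : Fin n → Fin n → Carrier) →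
    (∀ i k → z k * x k ^ Fin.toℕ i ≈ value (C i) (x k)) → sum (λ i → C i i) ≈ sum z
  trace≈sum {n} x sep z C rows = begin
    sum {n} (λ i → C i i)                                                ≈⟨ sum-cong {n} (λ i → C≈C′ i i) ⟩
    sum {n} (λ i → sum {n} (λ l → (z l * x l ^ Fin.toℕ i) * W l i))      ≈⟨ ∑-comm {n} {n} (λ i l → (z l * x l ^ Fin.toℕ i) * W l i) ⟩
    sum {n} (λ l → sum {n} (λ i → (z l * x l ^ Fin.toℕ i) * W l i))      ≈⟨ sum-cong {n} (λ l → trans
                                                                              (sum-cong {n} (λ i → trans (*-assoc _ _ _) (*-congˡ (*-comm _ _))))
                                                                              (sym (*-distribˡ-sum {n} (z l) (λ i → W l i * x l ^ Fin.toℕ i)))) ⟩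
    sum {n} (λ l → z l * value (W l) (x l))                              ≈⟨ sum-cong {n} (λ l → trans (*-congˡ (trans (W-value l l) (ind-refl l))) (*-identityʳ _)) ⟩
    sum {n} z                                                            ∎
    where
    open ≈-Reasoning
    ind : Fin n → Fin n → Carrier
    ind l k = if does (l Fin.≟ k) then 1# else 0#
    ind-refl : ∀ l → ind l l ≈ 1#
    ind-refl l with l Fin.≟ l
    ... | yes _  = refl
    ... | no l≢l = contradiction ≡.refl l≢l
    ind-≢ : ∀ l k → l ≢ k → ind l k ≈ 0#
    ind-≢ l k l≢k with l Fin.≟ k
    ... | yes l≡k = contradiction l≡k l≢k
    ... | no  _   = refl
    -- `W l` is the `l`-th Lagrange basis polynomial. In the trace the sum over `i` evaluates it at
    -- its own node, where it is 1, which leaves `z l`.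
    W : Fin n → Fin n → Carrier
    W l = proj₁ (interpolate x sep (ind l))
    W-value : ∀ l k → value (W l) (x k) ≈ ind l k
    W-value l = proj₂ (interpolate x sep (ind l))
    C′ : Fin n → Fin n → Carrier
    C′ i j = sum {n} (λ l → (z l * x l ^ Fin.toℕ i) * W l j)
    C′-value : ∀ i k → value (C′ i) (x k) ≈ z k * x k ^ Fin.toℕ i
    C′-value i k = begin
      sum {n} (λ j → sum {n} (λ l → (z l * x l ^ Fin.toℕ i) * W l j) * x k ^ Fin.toℕ j)
        ≈⟨ sum-cong {n} (λ j → *-distribʳ-sum {n} (x k ^ Fin.toℕ j) (λ l → (z l * x l ^ Fin.toℕ i) * W l j)) ⟩
      sum {n} (λ j → sum {n} (λ l → (z l * x l ^ Fin.toℕ i) * W l j * x k ^ Fin.toℕ j))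
        ≈⟨ ∑-comm {n} {n} (λ j l → (z l * x l ^ Fin.toℕ i) * W l j * x k ^ Fin.toℕ j) ⟩
      sum {n} (λ l → sum {n} (λ j → (z l * x l ^ Fin.toℕ i) * W l j * x k ^ Fin.toℕ j))
        ≈⟨ sum-cong {n} (λ l → trans (sum-cong {n} (λ j → *-assoc _ _ _))
             (trans (sym (*-distribˡ-sum {n} (z l * x l ^ Fin.toℕ i) (λ j → W l j * x k ^ Fin.toℕ j))) (*-congˡ (W-value l k)))) ⟩
      sum {n} (λ l → (z l * x l ^ Fin.toℕ i) * ind l k)
        ≈⟨ sum-single {n} (λ l → (z l * x l ^ Fin.toℕ i) * ind l k) k (λ l l≢k → trans (*-congˡ (ind-≢ l k l≢k)) (zeroʳ _)) ⟩
      (z k * x k ^ Fin.toℕ i) * ind k k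
        ≈⟨ trans (*-congˡ (ind-refl k)) (*-identityʳ _) ⟩
      z k * x k ^ Fin.toℕ i ∎
    C≈C′ : ∀ i j → C i j ≈ C′ i j
    C≈C′ i j = +≈0⇒≈ (roots⇒0 x sep (λ j → C i j + C′ i j) (λ k → begin
      sum {n} (λ j → (C i j + C′ i j) * x k ^ Fin.toℕ j)
        ≈⟨ sum-cong {n} (λ j → distribʳ (x k ^ Fin.toℕ j) (C i j) (C′ i j)) ⟩
      sum {n} (λ j → C i j * x k ^ Fin.toℕ j + C′ i j * x k ^ Fin.toℕ j)
        ≈⟨ ∑-distrib-+ {n} (λ j → C i j * x k ^ Fin.toℕ j) (λ j → C′ i j * x k ^ Fin.toℕ j) ⟩
      value (C i) (x k) + value (C′ i) (x k)
        ≈⟨ ≈⇒+≈0 (trans (sym (rows i k)) (sym (C′-value i k))) ⟩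
      0# ∎) j)

-- Double negation over finite index sets, and the field with stabilised equality.

¬¬-Fin : ∀ {a n} {Q : Fin n → Set a} → (∀ i → ¬ ¬ Q i) → ¬ ¬ (∀ i → Q i)
¬¬-Fin {n = zero}  h k = k λ ()
¬¬-Fin {n = suc n} h k = h zero λ q₀ → ¬¬-Fin (h ∘ suc) λ qs → k λ { zero → q₀ ; (suc i) → qs i }

¬¬-Vec : ∀ {a n m} {Q : Vec (Fin n) m → Set a} → (∀ t → ¬ ¬ Q t) → ¬ ¬ (∀ t → Q t)
¬¬-Vec {m = zero}  h k = h [] λ q → k λ { [] → q }
¬¬-Vec {m = suc m} h k = ¬¬-Fin (λ i → ¬¬-Vec (λ t → h (i ∷ t))) λ qs → k λ { (i ∷ t) → qs i t }

¬¬-List : ∀ {a b} {A : Set a} {Q : A → Set b} (xs : List A) → (∀ x → ¬ ¬ Q x) → ¬ ¬ (∀ x → x ∈ xs → Q x)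
¬¬-List []       h k = k λ x ()
¬¬-List (x ∷ xs) h k = h x λ q → ¬¬-List xs h λ qs → k λ { y (here ≡.refl) → q ; y (there y∈xs) → qs y y∈xs }

module Stabilisation {c ℓ} (F : Field c ℓ) (char2 : Char2 F) where
  private module F = Field F
  open F using (_*_; _+_; 0#; 1#)

  infix 4 _≈¬¬_
  _≈¬¬_ : F.Carrier → F.Carrier → Set ℓ
  x ≈¬¬ y = ¬ ¬ (x F.≈ y)

  η : ∀ {x y} → x F.≈ y → x ≈¬¬ y
  η x≈y k = k x≈y

  private
    lift₂ : ∀ {w x y z u v} → (w F.≈ x → y F.≈ z → u F.≈ v) → w ≈¬¬ x → y ≈¬¬ z → u ≈¬¬ v
    lift₂ f ¬¬p ¬¬q k = ¬¬p λ p → ¬¬q λ q → k (f p q)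

    isEquivalence : IsEquivalence _≈¬¬_
    isEquivalence = record { refl = η F.refl ; sym = ¬¬-map F.sym ; trans = lift₂ F.trans }

  F¬¬ : Ring₂ c ℓ
  F¬¬ = record
    { commutativeSemiring = record
      { Carrier = F.Carrier ; _≈_ = _≈¬¬_ ; _+_ = F._+_ ; _*_ = F._*_ ; 0# = F.0# ; 1# = F.1#
      ; isCommutativeSemiring = isCommutativeSemiringˡ record
        { +-isCommutativeMonoid = record
          { isMonoid = record
            { isSemigroup = record
              { isMagma = record { isEquivalence = isEquivalence ; ∙-cong = lift₂ F.+-cong }
              ; assoc = λ x y z → η (F.+-assoc x y z) }
            ; identity = (λ x → η (F.+-identityˡ x)) , (λ x → η (F.+-identityʳ x)) }
          ; comm = λ x y → η (F.+-comm x y) }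
        ; *-isCommutativeMonoid = record
          { isMonoid = record
            { isSemigroup = record
              { isMagma = record { isEquivalence = isEquivalence ; ∙-cong = lift₂ F.*-cong }
              ; assoc = λ x y z → η (F.*-assoc x y z) }
            ; identity = (λ x → η (F.*-identityˡ x)) , (λ x → η (F.*-identityʳ x)) }
          ; comm = λ x y → η (F.*-comm x y) }
        ; distribʳ = λ x y z → η (F.distribʳ x y z)
        ; zeroˡ = λ x → η (F.zeroˡ x)
        } }
    ; x+x≈0 = λ x → η (F.trans (F.sym (F.+-cong (F.*-identityʳ x) (F.*-identityʳ x)))
        (F.trans (F.sym (F.distribˡ x 1# 1#)) (F.trans (F.*-congˡ char2) (F.zeroʳ x))))
    }
    where open import Algebra.Structures.Biased _≈¬¬_ using (isCommutativeSemiringˡ)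

  F¬¬-stable : ∀ {x} → ¬ ¬ (x ≈¬¬ 0#) → x ≈¬¬ 0#
  F¬¬-stable h k = h λ ¬¬x≈0 → ¬¬x≈0 k

  -- The goal is a negation, so `y` may be taken to be nonzero in `F` itself and be inverted there.
  F¬¬-cancel : ∀ {x y} → x * y ≈¬¬ 0# → ¬ (y ≈¬¬ 0#) → x ≈¬¬ 0#
  F¬¬-cancel {x} {y} xy≈0 y≉0 k = y≉0 λ y≉0 → xy≈0 λ xy≈0 → k (cancel (F.inverse y y≉0) xy≈0)
    where
    cancel : ∃ (λ z → y * z F.≈ 1#) → x * y F.≈ 0# → x F.≈ 0#
    cancel (z , yz≈1) xy≈0 = F.trans (F.sym (F.*-identityʳ x)) (F.trans (F.*-congˡ (F.sym yz≈1))
      (F.trans (F.sym (F.*-assoc x y z)) (F.trans (F.*-congʳ xy≈0) (F.zeroˡ z))))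

  F¬¬-reduced : Ring₂.Reduced F¬¬
  F¬¬-reduced x xx≈0 = F¬¬-stable λ x≉0 → x≉0 (F¬¬-cancel xx≈0 x≉0)

  F¬¬-1≉0 : ¬ (1# ≈¬¬ 0#)
  F¬¬-1≉0 1≈0 = 1≈0 λ 1≈0 → F.0≉1 (F.sym 1≈0)

-- Rational functions and the action of the symmetric group.

module RationalFunctions {c ℓ} (R : Ring₂ c ℓ)
  (1≉0 : ¬ (Ring₂._≈_ R (Ring₂.1# R) (Ring₂.0# R)))
  (stable : ∀ {x} → ¬ ¬ (Ring₂._≈_ R x (Ring₂.0# R)) → Ring₂._≈_ R x (Ring₂.0# R))
  (cancel : ∀ {x y} → Ring₂._≈_ R (Ring₂._*_ R x y) (Ring₂.0# R) → ¬ (Ring₂._≈_ R y (Ring₂.0# R)) → Ring₂._≈_ R x (Ring₂.0# R))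
  (n : ℕ) where
  open Polynomials R n public
  private module R = Ring₂ R
  module P = Ring₂ algebra
  open LowestTerms R (Vec-order n) using (algebra-cancel)

  P-1≉0 : ¬ (P.1# P.≈ P.0#)
  P-1≉0 eq = 1≉0 (R.trans (R.sym (R.trans (coeff-term R.1# 0ᵉ 0ᵉ) (R.trans (R.*-identityˡ _) (δ-refl 0ᵉ)))) (coeff≈ eq 0ᵉ))
    where 0ᵉ = replicate n 0

  open Fractions algebra P-1≉0 (λ {p} {q} → algebra-cancel stable cancel {p} {q}) public
  module K = Ring₂ fractions

  private
    cross-≡ : ∀ {x y : Frac} → num x ≡ num y → den x ≡ den y → x K.≈ y
    cross-≡ num≡ den≡ = cross (P.reflexive (≡.cong₂ P._*_ num≡ (≡.sym den≡)))

    rename-∘ : ∀ π ρ p → rename π (rename ρ p) ≡ rename (ρ ∘ π) p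
    rename-∘ π ρ []            = ≡.refl
    rename-∘ π ρ ((a , m) ∷ p) = ≡.cong₂ _∷_ (≡.cong (a ,_) (Vec.tabulate-cong λ j → Vec.lookup∘tabulate _ (π j))) (rename-∘ π ρ p)

  rename-cong : ∀ {π ρ} → (∀ i → π i ≡ ρ i) → ∀ p → rename π p ≡ rename ρ p
  rename-cong π≗ρ []            = ≡.refl
  rename-cong π≗ρ ((a , m) ∷ p) = ≡.cong₂ _∷_ (≡.cong (a ,_) (Vec.tabulate-cong λ j → ≡.cong (lookup m) (π≗ρ j))) (rename-cong π≗ρ p)

  rename-agree : ∀ {π ρ π′ ρ′} → (∀ j → ρ (π j) ≡ ρ′ (π′ j)) → ∀ p → rename π (rename ρ p) ≡ rename π′ (rename ρ′ p)
  rename-agree {π} {ρ} {π′} {ρ′} eq p = ≡.trans (rename-∘ π ρ p) (≡.trans (rename-cong eq p) (≡.sym (rename-∘ π′ ρ′ p)))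

  rename-id : ∀ {π} → (∀ i → π i ≡ i) → ∀ p → rename π p ≡ p
  rename-id π≗id []            = ≡.refl
  rename-id π≗id ((a , m) ∷ p) = ≡.cong₂ _∷_
    (≡.cong (a ,_) (≡.trans (Vec.tabulate-cong λ j → ≡.cong (lookup m) (π≗id j)) (Vec.tabulate∘lookup m))) (rename-id π≗id p)

  fold-rename : ∀ π k p → fold p (rename π) k ≡ rename (λ i → fold i π k) p
  fold-rename π zero    p = ≡.sym (rename-id (λ _ → ≡.refl) p)
  fold-rename π (suc k) p = ≡.trans (≡.cong (rename π) (fold-rename π k p))
    (≡.trans (rename-∘ π (λ i → fold i π k) p) (rename-cong (fold-inner π k) p))

  ren : Permutation′ n → Hom algebra algebra
  ren σ = renaming-hom (σ ⟨$⟩ˡ_)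

  ren-injective : ∀ σ {p} → Hom.⟦ ren σ ⟧ p P.≈ P.0# → p P.≈ P.0#
  ren-injective σ {p} σp≈0 = P.trans
    (P.reflexive (≡.sym (≡.trans (rename-∘ (σ ⟨$⟩ʳ_) (σ ⟨$⟩ˡ_) p) (rename-id (λ _ → inverseˡ σ) p))))
    (Hom.cong (renaming-hom (σ ⟨$⟩ʳ_)) σp≈0)

  aut : Permutation′ n → Hom fractions fractions
  aut σ = extendHom (ren σ) (ren-injective σ)

  aut-agree : ∀ σ ρ σ′ ρ′ → (∀ j → ρ ⟨$⟩ˡ (σ ⟨$⟩ˡ j) ≡ ρ′ ⟨$⟩ˡ (σ′ ⟨$⟩ˡ j)) → ∀ x →
    Hom.⟦ aut σ ⟧ (Hom.⟦ aut ρ ⟧ x) K.≈ Hom.⟦ aut σ′ ⟧ (Hom.⟦ aut ρ′ ⟧ x)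
  aut-agree σ ρ σ′ ρ′ eq x = cross-≡ (rename-agree eq (num x)) (rename-agree eq (den x))

  ren-var : ∀ σ i → Hom.⟦ ren σ ⟧ (var i) ≡ var (σ ⟨$⟩ʳ i)
  ren-var σ i = ≡.cong (λ e → (R.1# , e) ∷ []) (Vec.tabulate-cong λ j → ≡.trans (Vec.lookup∘tabulate _ (σ ⟨$⟩ˡ j)) (indicator j))
    where
    indicator : ∀ j → (if does (i Fin.≟ (σ ⟨$⟩ˡ j)) then 1 else 0) ≡ (if does ((σ ⟨$⟩ʳ i) Fin.≟ j) then 1 else 0)
    indicator j with i Fin.≟ (σ ⟨$⟩ˡ j) | (σ ⟨$⟩ʳ i) Fin.≟ j
    ... | yes _      | yes _      = ≡.refl
    ... | yes ≡.refl | no  σi≢j   = contradiction (inverseʳ σ) σi≢j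
    ... | no  i≢     | yes ≡.refl = contradiction (≡.sym (inverseˡ σ)) i≢
    ... | no  _      | no  _      = ≡.refl

  varᴷ : Fin n → Frac
  varᴷ i = Hom.⟦ fromRing ⟧ (var i)

  aut-var : ∀ σ i → Hom.⟦ aut σ ⟧ (varᴷ i) K.≈ varᴷ (σ ⟨$⟩ʳ i)
  aut-var σ i = K.trans (cross (P.*-congˡ {Hom.⟦ ren σ ⟧ (var i)} (P.sym (Hom.1-homo (ren σ))))) (Hom.cong fromRing (P.reflexive (ren-var σ i)))

  -- The sum of two distinct variables has coefficient 1 at the first of them, so it is nonzero and
  -- invertible as a fraction.
  vars-separated : Interpolation.Separated fractions varᴷ
  vars-separated i j i≢j =
    proj₁ inv , K.trans (K.*-congʳ {proj₁ inv} (K.sym (Hom.+-homo fromRing (var i) (var j)))) (proj₂ inv)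
    where
    e = multiple i 1
    e≢ : e ≢ multiple j 1
    e≢ eq with i Fin.≟ i | j Fin.≟ i | ≡.trans (≡.sym (Vec.lookup∘tabulate _ i)) (≡.trans (≡.cong (λ v → lookup v i) eq) (Vec.lookup∘tabulate (λ l → if does (j Fin.≟ l) then 1 else 0) i))
    ... | no i≢i | _        | _ = i≢i ≡.refl
    ... | yes _  | yes j≡i  | _ = i≢j (≡.sym j≡i)
    ... | yes _  | no _     | ()
    var+var≉0 : ¬ (var i P.+ var j P.≈ P.0#)
    var+var≉0 eq = 1≉0 (begin
      R.1#                              ≈⟨ R.+-identityʳ R.1# ⟨
      R.1# R.+ R.0#                     ≈⟨ R.+-cong (R.trans (coeff-term R.1# e e) (R.trans (R.*-identityˡ _) (δ-refl e)))
                                             (R.trans (coeff-term R.1# (multiple j 1) e) (R.trans (R.*-identityˡ _) (δ-≢ e≢))) ⟨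
      coeff (var i) e R.+ coeff (var j) e ≈⟨ coeff-++ (var i) (var j) e ⟨
      coeff (var i P.+ var j) e         ≈⟨ coeff≈ eq e ⟩
      R.0#                              ∎)
      where open R.≈-Reasoning
    inv = inverse (Hom.⟦ fromRing ⟧ (var i P.+ var j)) var+var≉0

-- From conjugates of y to equivariant polynomials and back.

module CommutingCycles {A : Set} where

  fold-inverse : ∀ {f g : A → A} → (∀ x → g (f x) ≡ x) → ∀ k x → fold (fold x f k) g k ≡ x
  fold-inverse         gf zero    x = ≡.refl
  fold-inverse {f} {g} gf (suc k) x = ≡.trans (≡.sym (fold-inner g k (f (fold x f k))))
    (≡.trans (≡.cong (λ z → fold z g k) (gf (fold x f k))) (fold-inverse gf k x))

  inverse-period : ∀ {f g : A → A} → (∀ x → g (f x) ≡ x) → ∀ k → (∀ x → fold x f k ≡ x) → ∀ x → fold x g k ≡ x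
  inverse-period {g = g} gf k fᵏ x = ≡.trans (≡.cong (λ z → fold z g k) (≡.sym (fᵏ x))) (fold-inverse gf k x)

  inverse-comm : ∀ {f g f′ g′ : A → A} → (∀ x → g (f x) ≡ x) → (∀ x → f (g x) ≡ x) → (∀ x → g′ (f′ x) ≡ x) → (∀ x → f′ (g′ x) ≡ x) →
                 (∀ x → f (f′ x) ≡ f′ (f x)) → ∀ x → g (g′ x) ≡ g′ (g x)
  inverse-comm {f} {g} {f′} {g′} gf fg gf′ fg′ comm x = ≡.sym (begin
    g′ (g x)                    ≡⟨ ≡.cong (λ z → g′ (g z)) (≡.sym (≡.trans (≡.cong f′ (fg (g′ x))) (fg′ x))) ⟩
    g′ (g (f′ (f (g (g′ x)))))  ≡⟨ ≡.cong (λ z → g′ (g z)) (≡.sym (comm (g (g′ x)))) ⟩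
    g′ (g (f (f′ (g (g′ x)))))  ≡⟨ ≡.cong g′ (gf _) ⟩
    g′ (f′ (g (g′ x)))          ≡⟨ gf′ _ ⟩
    g (g′ x)                    ∎)
    where open ≡.≡-Reasoning

module Descent {c ℓ} (R : Ring₂ c ℓ)
  (1≉0 : ¬ (Ring₂._≈_ R (Ring₂.1# R) (Ring₂.0# R)))
  (stable : ∀ {x} → ¬ ¬ (Ring₂._≈_ R x (Ring₂.0# R)) → Ring₂._≈_ R x (Ring₂.0# R))
  (cancel : ∀ {x y} → Ring₂._≈_ R (Ring₂._*_ R x y) (Ring₂.0# R) → ¬ (Ring₂._≈_ R y (Ring₂.0# R)) → Ring₂._≈_ R x (Ring₂.0# R))
  (red : Ring₂.Reduced R)
  {p m k : ℕ} (pr : Prime p) (p-odd : p % 2 ≡ 1) (n-even : suc k % 2 ≡ 0) .{{nz : NonZero p}} (orbits : TwoOrbits c ℓ p m (suc k)) where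
  open RationalFunctions R 1≉0 stable cancel (suc k) public
  open TwoOrbits orbits
  open CommutingCycles

  private
    τ⁻¹ : Fin 2 × Fin m → Fin (suc k) → Fin (suc k)
    τ⁻¹ g i = fold i (τ g) (ℕ.pred p)

    fold-pred : ∀ g i → τ g (τ⁻¹ g i) ≡ i
    fold-pred g i = ≡.trans (≡.cong (fold i (τ g)) (ℕ.suc-pred p {{nz}})) (τ^p g i)

    π : Fin 2 × Fin m → Permutation′ (suc k)
    π g = permutation (τ g) (τ⁻¹ g) (fold-pred g)
      (λ i → ≡.trans (fold-inner (τ g) (ℕ.pred p) i) (fold-pred g i))

    πˡ^p : ∀ g i → fold i (π g ⟨$⟩ˡ_) p ≡ i
    πˡ^p g = inverse-period {f = τ g} (λ _ → inverseˡ (π g)) p (τ^p g)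

    πˡ-comm : ∀ g g′ i → π g ⟨$⟩ˡ (π g′ ⟨$⟩ˡ i) ≡ π g′ ⟨$⟩ˡ (π g ⟨$⟩ˡ i)
    πˡ-comm g g′ = inverse-comm {f = τ g} {f′ = τ g′} (λ _ → inverseˡ (π g)) (λ _ → inverseʳ (π g)) (λ _ → inverseˡ (π g′)) (λ _ → inverseʳ (π g′)) (τ-comm g g′)

  -- Multiply, one generator at a time, over the orbit of the multiple found so far.
  module _ (d : Fin (suc k) → Alg) (d≉0 : ∀ i → ¬ (d i P.≈ P.0#)) where

    record CommonMultiple (gs : List (Fin 2 × Fin m)) : Set (c ⊔ ℓ) where
      field
        multiple-of : Alg
        nonzero     : ¬ (multiple-of P.≈ P.0#)
        cofactor    : Fin (suc k) → Alg
        divides     : ∀ i → multiple-of P.≈ d i P.* cofactor i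
        invariant   : ∀ {g} → g ∈ gs → Hom.⟦ ren (π g) ⟧ multiple-of P.≈ multiple-of

    private
      open Products algebra

      prod-nonzero : ∀ {j} (t : Fin j → Alg) → (∀ i → ¬ (t i P.≈ P.0#)) → ¬ (prod t P.≈ P.0#)
      prod-nonzero {zero}  t t≉0 = P-1≉0
      prod-nonzero {suc j} t t≉0 = *-nonzero (t≉0 zero) (prod-nonzero (t ∘ suc) (t≉0 ∘ suc))

      prod-divides : ∀ {j} (t : Fin j → Alg) i → ∃[ q ] prod t P.≈ t i P.* q
      prod-divides {suc j} t zero    = prod (t ∘ suc) , P.refl
      prod-divides {suc j} t (suc i) with q , eq ← prod-divides (t ∘ suc) i =
        t zero P.* q , P.trans (P.*-congˡ {t zero} eq) (P.x*[y*z]≈y*[x*z] (t zero) (t (suc i)) q)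

    commonMultiple : ∀ gs → CommonMultiple gs
    commonMultiple [] = record
      { multiple-of = prod d
      ; nonzero     = prod-nonzero d d≉0
      ; cofactor    = λ i → proj₁ (prod-divides d i)
      ; divides     = λ i → proj₂ (prod-divides d i)
      ; invariant   = λ ()
      }
    commonMultiple (g ∷ gs) = record
      { multiple-of = N
      ; nonzero     = prod-nonzero {p} conjugate (λ j → conjugate≉0 (Fin.toℕ j))
      ; cofactor    = λ i → C.cofactor i P.* rest
      ; divides     = λ i → P.trans N≈ (P.trans (P.*-congʳ {rest} (C.divides i)) (P.*-assoc (d i) (C.cofactor i) rest))
      ; invariant   = λ { (here ≡.refl) → g-invariant ; (there g′∈gs) → old-invariant g′∈gs }
      }
      where
      module C = CommonMultiple (commonMultiple gs)
      ρ = Hom.⟦ ren (π g) ⟧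
      power : ℕ → Alg
      power j = fold C.multiple-of ρ j
      conjugate : Fin p → Alg
      conjugate j = power (Fin.toℕ j)
      N : Alg
      N = prod {p} conjugate
      conjugate≉0 : ∀ j → ¬ (power j P.≈ P.0#)
      conjugate≉0 zero    = C.nonzero
      conjugate≉0 (suc j) = conjugate≉0 j ∘ ren-injective (π g) {power j}
      0ᵖ : Fin p
      0ᵖ = 0 mod p
      rest : Alg
      rest = proj₁ (prod-divides {p} conjugate 0ᵖ)
      N≈ : N P.≈ C.multiple-of P.* rest
      N≈ = P.trans (proj₂ (prod-divides {p} conjugate 0ᵖ)) (P.*-congʳ {rest} (P.reflexive (≡.cong power
        (≡.trans (toℕ-mod p 0) (m<n⇒m%n≡m (ℕ.>-nonZero⁻¹ p {{nz}}))))))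
      g-invariant : ρ N P.≈ N
      g-invariant = P.trans (prod-homo (ren (π g)) {p} conjugate)
        (CyclicSum.sum-cyclic P.*-commutativeMonoid p power
          (P.reflexive (≡.trans (fold-rename (π g ⟨$⟩ˡ_) p C.multiple-of) (rename-id (πˡ^p g) C.multiple-of))))
      -- The generators commute, so every conjugate under `π g` inherits the invariance gained in
      -- earlier rounds.
      old-invariant : ∀ {g′} → g′ ∈ gs → Hom.⟦ ren (π g′) ⟧ N P.≈ N
      old-invariant {g′} g′∈gs = P.trans (prod-homo (ren (π g′)) {p} conjugate)
        (prod-cong {p} {x = λ j → Hom.⟦ ren (π g′) ⟧ (conjugate j)} {conjugate} (λ j → power-invariant (Fin.toℕ j)))
        where
        power-invariant : ∀ j → Hom.⟦ ren (π g′) ⟧ (power j) P.≈ power j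
        power-invariant zero    = C.invariant g′∈gs
        power-invariant (suc j) = P.trans (P.reflexive (rename-agree {π g′ ⟨$⟩ˡ_} {π g ⟨$⟩ˡ_} {π g ⟨$⟩ˡ_} {π g′ ⟨$⟩ˡ_} (πˡ-comm g g′) (power j)))
          (Hom.cong (ren (π g)) {Hom.⟦ ren (π g′) ⟧ (power j)} {power j} (power-invariant j))

  equivariant⇒equal : (f : Fin (suc k) → Alg) →
    (∀ g i → Hom.⟦ ren (π g) ⟧ (f i) P.≈ f (τ g i)) →
    (∀ j → 1 ℕ.≤ j → j ℕ.≤ p → P.sum (λ i → f i P.^ j) P.≈ P.0#) →
    ∀ i j → f i P.≈ f j
  equivariant⇒equal f = EquivariantPolynomials.all-equal R red pr p-odd n-even orbits f π (λ _ _ → ≡.refl)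

  -- For `y` in L any permutation that sends 0 to `i` gives the same fraction; the transposition is
  -- a convenient representative.
  conj : Frac → Fin (suc k) → Frac
  conj y i = Hom.⟦ aut (transpose zero i) ⟧ y

  module _ (y : Frac) (y∈L : ∀ σ → σ ⟨$⟩ʳ zero ≡ zero → Hom.⟦ aut σ ⟧ y K.≈ y) where

    aut-conj : ∀ σ i → Hom.⟦ aut σ ⟧ (conj y i) K.≈ conj y (σ ⟨$⟩ʳ i)
    aut-conj σ i = K.trans
      (aut-agree σ (transpose zero i) (transpose zero (σ ⟨$⟩ʳ i)) fixing
        (λ j → ≡.cong (λ l → transpose zero i ⟨$⟩ˡ (σ ⟨$⟩ˡ l)) (≡.sym (inverseʳ (transpose zero (σ ⟨$⟩ʳ i)))))
        y)
      (Hom.cong (aut (transpose zero (σ ⟨$⟩ʳ i))) (y∈L fixing (inverseˡ (transpose zero (σ ⟨$⟩ʳ i)))))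
      where
      -- It sends 0 to `i`, then to `σ i`, then back to 0, so it leaves `y` fixed and accounts for
      -- the difference between `σ` after one transposition and the other transposition alone.
      fixing : Permutation′ (suc k)
      fixing = transpose zero i ∘ₚ (σ ∘ₚ flip (transpose zero (σ ⟨$⟩ʳ i)))

    module _ (power-sums : ∀ j → 1 ℕ.≤ j → j ℕ.≤ p → K.sum (λ i → conj y i K.^ j) K.≈ K.0#) where

      private
        generators : List (Fin 2 × Fin m)
        generators = cartesianProduct (allFin 2) (allFin m)

        open CommonMultiple (commonMultiple (λ i → den (conj y i)) (λ i → den≉0 (conj y i)) generators)
          renaming (multiple-of to G)

        module ι = Hom fromRing

        f : Fin (suc k) → Alg
        f i = num (conj y i) P.* cofactor i

        f≈G*conj : ∀ i → ι.⟦ f i ⟧ K.≈ ι.⟦ G ⟧ K.* conj y i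
        f≈G*conj i = cross (begin
          (a P.* h) P.* (P.1# P.* b)  ≈⟨ P.*-congˡ {a P.* h} (P.*-identityˡ b) ⟩
          (a P.* h) P.* b             ≈⟨ P.*-assoc a h b ⟩
          a P.* (h P.* b)             ≈⟨ P.*-comm a (h P.* b) ⟩
          (h P.* b) P.* a             ≈⟨ P.*-congʳ {a} (P.*-comm h b) ⟩
          (b P.* h) P.* a             ≈⟨ P.*-congʳ {a} (divides i) ⟨
          G P.* a                     ≈⟨ P.*-identityʳ (G P.* a) ⟨
          (G P.* a) P.* P.1#          ∎)
          where
          open P.≈-Reasoning
          a = num (conj y i)
          b = den (conj y i)
          h = cofactor i

        aut-ι : ∀ σ q → Hom.⟦ aut σ ⟧ ι.⟦ q ⟧ K.≈ ι.⟦ Hom.⟦ ren σ ⟧ q ⟧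
        aut-ι σ q = cross (P.*-congˡ {Hom.⟦ ren σ ⟧ q} (P.sym (Hom.1-homo (ren σ))))

        f-equi : ∀ g i → Hom.⟦ ren (π g) ⟧ (f i) P.≈ f (τ g i)
        f-equi g@(ε , l) i = fromRing-injective (begin
          ι.⟦ Hom.⟦ ren (π g) ⟧ (f i) ⟧
            ≈⟨ aut-ι (π g) (f i) ⟨
          Hom.⟦ aut (π g) ⟧ ι.⟦ f i ⟧
            ≈⟨ Hom.cong (aut (π g)) (f≈G*conj i) ⟩
          Hom.⟦ aut (π g) ⟧ (ι.⟦ G ⟧ K.* conj y i)
            ≈⟨ Hom.*-homo (aut (π g)) ι.⟦ G ⟧ (conj y i) ⟩
          Hom.⟦ aut (π g) ⟧ ι.⟦ G ⟧ K.* Hom.⟦ aut (π g) ⟧ (conj y i)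
            ≈⟨ K.*-cong (K.trans (aut-ι (π g) G) (ι.cong (invariant (∈-cartesianProduct⁺ (∈-allFin ε) (∈-allFin l))))) (aut-conj (π g) i) ⟩
          ι.⟦ G ⟧ K.* conj y (τ g i)
            ≈⟨ f≈G*conj (τ g i) ⟨
          ι.⟦ f (τ g i) ⟧ ∎)
          where open K.≈-Reasoning

        -- Power sums are homogeneous: the common factor `G` comes out as its `j`-th power.
        f-power-sums : ∀ j → 1 ℕ.≤ j → j ℕ.≤ p → P.sum (λ i → f i P.^ j) P.≈ P.0#
        f-power-sums j 1≤j j≤p = fromRing-injective (begin
          ι.⟦ P.sum (λ i → f i P.^ j) ⟧
            ≈⟨ ι.sum-homo (λ i → f i P.^ j) ⟩
          K.sum (λ i → ι.⟦ f i P.^ j ⟧)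
            ≈⟨ K.sum-cong (λ i → K.trans (ι.^-homo (f i) j) (K.trans (K.^-congˡ j (f≈G*conj i)) (K.^-distrib-* ι.⟦ G ⟧ (conj y i) j))) ⟩
          K.sum (λ i → ι.⟦ G ⟧ K.^ j K.* conj y i K.^ j)
            ≈⟨ K.*-distribˡ-sum (ι.⟦ G ⟧ K.^ j) (λ i → conj y i K.^ j) ⟨
          ι.⟦ G ⟧ K.^ j K.* K.sum (λ i → conj y i K.^ j)
            ≈⟨ K.*-congˡ {ι.⟦ G ⟧ K.^ j} (power-sums j 1≤j j≤p) ⟩
          ι.⟦ G ⟧ K.^ j K.* K.0#
            ≈⟨ K.zeroʳ (ι.⟦ G ⟧ K.^ j) ⟩
          ι.⟦ P.0# ⟧ ∎)
          where open K.≈-Reasoning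

        f-equal : ∀ i j → f i P.≈ f j
        f-equal = equivariant⇒equal f f-equi f-power-sums

        conj-equal : ∀ i j → conj y i K.≈ conj y j
        conj-equal i j = K.trans (recover i) (K.trans (K.*-congˡ {G⁻¹} (ι.cong (f-equal i j))) (K.sym (recover j)))
          where
          G⁻¹ : Frac
          G⁻¹ = proj₁ (inverse ι.⟦ G ⟧ nonzero)
          inv : ι.⟦ G ⟧ K.* G⁻¹ K.≈ K.1#
          inv = proj₂ (inverse ι.⟦ G ⟧ nonzero)
          recover : ∀ i → conj y i K.≈ G⁻¹ K.* ι.⟦ f i ⟧
          recover i = K.sym (K.trans (K.*-congˡ {G⁻¹} (f≈G*conj i)) (K.trans (K.sym (K.*-assoc G⁻¹ ι.⟦ G ⟧ (conj y i)))
            (K.trans (K.*-congʳ {conj y i} (K.trans (K.*-comm G⁻¹ ι.⟦ G ⟧) inv)) (K.*-identityˡ (conj y i)))))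

      symmetric : ∀ σ → Hom.⟦ aut σ ⟧ y K.≈ y
      symmetric σ = K.trans (Hom.cong (aut σ) (K.sym conj₀)) (K.trans (aut-conj σ zero)
        (K.trans (conj-equal (σ ⟨$⟩ʳ zero) zero) conj₀))
        where
        conj₀ : conj y zero K.≈ y
        conj₀ = y∈L (transpose zero zero) ≡.refl

-- Passage between the given rational functions and the field of fractions.

module Translation {c ℓ} (F : Field c ℓ) (char2 : Char2 F) (k : ℕ) where
  private
    module D = RatFuns F k
    module F = Field F
  open Stabilisation F char2
  open RationalFunctions F¬¬ F¬¬-1≉0 F¬¬-stable F¬¬-cancel (suc k)
  open D using (_≈ₚ_; _≈ᵣ_; _^ᵣ_; Σᵣ)

  private
    coeff-agree : ∀ p e → D.coeff p e F.≈ coeff p e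
    coeff-agree []            e = F.refl
    coeff-agree ((a , m) ∷ p) e with Vec.≡-dec ℕ._≟_ m e | Vec.≡-dec ℕ._≟_ e m
    ... | yes _   | yes _   = F.+-cong (F.sym (F.*-identityʳ a)) (coeff-agree p e)
    ... | yes m≡e | no  e≢m = contradiction (≡.sym m≡e) e≢m
    ... | no  m≢e | yes e≡m = contradiction (≡.sym e≡m) m≢e
    ... | no  _   | no  _   = F.trans (coeff-agree p e) (F.sym (F.trans (F.+-congʳ (F.zeroʳ a)) (F.+-identityˡ _)))

    coeff-outside : ∀ p e → e ∉ map proj₂ p → D.coeff p e ≡ F.0#
    coeff-outside []            e _  = ≡.refl
    coeff-outside ((a , m) ∷ p) e e∉ with Vec.≡-dec ℕ._≟_ m e
    ... | yes m≡e = contradiction (here (≡.sym m≡e)) e∉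
    ... | no  _   = coeff-outside p e (e∉ ∘ there)

    ≈ₚ⇒≈ : ∀ {p q} → p ≈ₚ q → p P.≈ q
    ≈ₚ⇒≈ {p} {q} p≈q = coeffs λ e → η (F.trans (F.sym (coeff-agree p e)) (F.trans (p≈q e) (coeff-agree q e)))

    -- Outside the finitely many exponents that occur in either list both coefficients are literally
    -- zero, so only finitely many double negations have to be combined.
    ≈⇒¬¬≈ₚ : ∀ {p q} → p P.≈ q → ¬ ¬ (p ≈ₚ q)
    ≈⇒¬¬≈ₚ {p} {q} p≈q p≉q = ¬¬-List support at λ on-support → p≉q λ e → everywhere on-support e
      where
      open DecMembership (Vec.≡-dec {n = suc k} ℕ._≟_) using (_∈?_)
      support = map proj₂ p ++ map proj₂ q
      at : ∀ e → ¬ ¬ (D.coeff p e F.≈ D.coeff q e)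
      at e k = coeff≈ p≈q e λ eq → k (F.trans (coeff-agree p e) (F.trans eq (F.sym (coeff-agree q e))))
      everywhere : (∀ e → e ∈ support → D.coeff p e F.≈ D.coeff q e) → ∀ e → D.coeff p e F.≈ D.coeff q e
      everywhere on-support e with e ∈? support
      ... | yes e∈ = on-support e e∈
      ... | no  e∉ = F.reflexive (≡.trans (coeff-outside p e (e∉ ∘ ∈-++⁺ˡ)) (≡.sym (coeff-outside q e (e∉ ∘ ∈-++⁺ʳ (map proj₂ p)))))

    -- Forgets the proof that the denominator is nonzero. Both sides compute numerators and
    -- denominators by the same list operations, so powers and sums are preserved up to
    -- propositional equality.
    toRatFun : Frac → D.RatFun
    toRatFun x = num x D./ den x

    toRatFun-^ : ∀ x j → toRatFun (x K.^ j) ≡ toRatFun x ^ᵣ j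
    toRatFun-^ x zero    = ≡.refl
    toRatFun-^ x (suc j) = ≡.cong (toRatFun x D.*ᵣ_) (toRatFun-^ x j)

    toRatFun-sum : ∀ {j} (t : Fin j → Frac) {s : Fin j → D.RatFun} → (∀ i → toRatFun (t i) ≡ s i) → toRatFun (K.sum t) ≡ Σᵣ s
    toRatFun-sum {zero}  t eq = ≡.refl
    toRatFun-sum {suc j} t eq = ≡.cong₂ D._+ᵣ_ (eq zero) (toRatFun-sum (t ∘ suc) (eq ∘ suc))

    ≈ᵣ⇒≈ : ∀ x y {r s} → toRatFun x ≡ r → toRatFun y ≡ s → r ≈ᵣ s → x K.≈ y
    ≈ᵣ⇒≈ x y ≡.refl ≡.refl r≈s = cross (≈ₚ⇒≈ {num x P.* den y} {num y P.* den x} r≈s)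

  fromRatFun : ∀ r → D.WF r → Frac
  fromRatFun r wf = frac (D.num r) (D.den r) λ den≈0 → ≈⇒¬¬≈ₚ den≈0 wf

  InL⇒ : ∀ r wf → D.InL r → ∀ σ → σ ⟨$⟩ʳ zero ≡ zero → Hom.⟦ aut σ ⟧ (fromRatFun r wf) K.≈ fromRatFun r wf
  InL⇒ r wf r∈L σ σ0≡0 = ≈ᵣ⇒≈ (Hom.⟦ aut σ ⟧ (fromRatFun r wf)) (fromRatFun r wf) ≡.refl ≡.refl (r∈L σ σ0≡0)

  InK⇒ : ∀ r wf → D.InK r → ∀ σ → Hom.⟦ aut σ ⟧ (fromRatFun r wf) K.≈ fromRatFun r wf
  InK⇒ r wf r∈K σ = ≈ᵣ⇒≈ (Hom.⟦ aut σ ⟧ (fromRatFun r wf)) (fromRatFun r wf) ≡.refl ≡.refl (r∈K σ)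

  -- Only finitely many tables describe a permutation, so the double negation can be pulled out of InK.
  ⇒¬¬InK : ∀ r wf → (∀ σ → Hom.⟦ aut σ ⟧ (fromRatFun r wf) K.≈ fromRatFun r wf) → ¬ ¬ D.InK r
  ⇒¬¬InK r wf symmetric r∉K = ¬¬-Vec {Q = FixedBy} fixed λ all → r∉K λ σ →
    all (tabulate (σ ⟨$⟩ˡ_)) σ (λ j → ≡.sym (Vec.lookup∘tabulate (σ ⟨$⟩ˡ_) j))
    where
    FixedBy : Vec (Fin (suc k)) (suc k) → Set ℓ
    FixedBy t = ∀ σ → (∀ j → σ ⟨$⟩ˡ j ≡ lookup t j) → D.renᵣ σ r ≈ᵣ r
    -- It is never decided whether `t` is the table of a permutation. If one permutation with this
    -- table exists, its equation holds for all of them, since renaming depends on the table alone;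
    -- if none exists, the claim is vacuous.
    fixed : ∀ t → ¬ ¬ FixedBy t
    fixed t ¬fixed = ¬fixed λ σ σ≗t → ⊥-elim
      (≈⇒¬¬≈ₚ (crossed (symmetric σ)) λ σr≈r → ¬fixed λ σ′ σ′≗t →
        ≡.subst (_≈ᵣ r) (≡.cong₂ D._/_ (same σ σ′ σ≗t σ′≗t (D.num r)) (same σ σ′ σ≗t σ′≗t (D.den r))) σr≈r)
      where
      same : ∀ σ σ′ → (∀ j → σ ⟨$⟩ˡ j ≡ lookup t j) → (∀ j → σ′ ⟨$⟩ˡ j ≡ lookup t j) → ∀ q → D.renₚ σ q ≡ D.renₚ σ′ q
      same σ σ′ σ≗t σ′≗t = rename-cong (λ j → ≡.trans (σ≗t j) (≡.sym (σ′≗t j)))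

  -- The matrix entries lie in K, so the transposition of 0 and `l` turns each row identity at the
  -- first variable into the same identity at the `l`-th one. These are the interpolation conditions
  -- that `trace≈sum` requires.
  trace⇒conjugate-sum : ∀ r wf j → D.TraceIs (r ^ᵣ j) D.0ᵣ →
    K.sum {suc k} (λ i → Hom.⟦ aut (transpose zero i) ⟧ (fromRatFun r wf) K.^ j) K.≈ K.0#
  trace⇒conjugate-sum r wf j (C , C∈K , rows , trace) = K.trans
    (K.sym (Interpolation.trace≈sum fractions varᴷ vars-separated (λ i → conj i K.^ j) Cᴷ conj-rows))
    (K.sym (≈ᵣ⇒≈ K.0# (K.sum (λ i → Cᴷ i i)) ≡.refl (toRatFun-sum (λ i → Cᴷ i i) (λ _ → ≡.refl)) trace))
    where
    z = fromRatFun r wf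
    conj : Fin (suc k) → Frac
    conj i = Hom.⟦ aut (transpose zero i) ⟧ z
    Cᴷ : Fin (suc k) → Fin (suc k) → Frac
    Cᴷ i l = fromRatFun (C i l) (proj₁ (C∈K i l))
    x₀ = varᴷ zero
    row : ∀ i → (z K.^ j) K.* (x₀ K.^ Fin.toℕ i) K.≈ K.sum {suc k} (λ l → Cᴷ i l K.* x₀ K.^ Fin.toℕ l)
    row i = ≈ᵣ⇒≈ ((z K.^ j) K.* (x₀ K.^ Fin.toℕ i)) (K.sum (λ l → Cᴷ i l K.* x₀ K.^ Fin.toℕ l))
      (≡.cong₂ D._*ᵣ_ (toRatFun-^ z j) (toRatFun-^ x₀ (Fin.toℕ i)))
      (toRatFun-sum (λ l → Cᴷ i l K.* x₀ K.^ Fin.toℕ l) (λ l → ≡.cong (C i l D.*ᵣ_) (toRatFun-^ x₀ (Fin.toℕ l))))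
      (rows i)
    conj-rows : ∀ i l → (conj l K.^ j) K.* (varᴷ l K.^ Fin.toℕ i) K.≈ Interpolation.value fractions (Cᴷ i) (varᴷ l)
    conj-rows i l = begin
      (conj l K.^ j) K.* (varᴷ l K.^ Fin.toℕ i)
        ≈⟨ K.*-cong (α.^-homo z j) (α-power (Fin.toℕ i)) ⟨
      α.⟦ z K.^ j ⟧ K.* α.⟦ x₀ K.^ Fin.toℕ i ⟧
        ≈⟨ α.*-homo (z K.^ j) (x₀ K.^ Fin.toℕ i) ⟨
      α.⟦ (z K.^ j) K.* (x₀ K.^ Fin.toℕ i) ⟧
        ≈⟨ α.cong (row i) ⟩
      α.⟦ K.sum (λ l → Cᴷ i l K.* x₀ K.^ Fin.toℕ l) ⟧
        ≈⟨ α.sum-homo (λ l → Cᴷ i l K.* x₀ K.^ Fin.toℕ l) ⟩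
      K.sum (λ l → α.⟦ Cᴷ i l K.* x₀ K.^ Fin.toℕ l ⟧)
        ≈⟨ K.sum-cong (λ l → K.trans (α.*-homo (Cᴷ i l) (x₀ K.^ Fin.toℕ l))
             (K.*-cong (InK⇒ (C i l) (proj₁ (C∈K i l)) (proj₂ (C∈K i l)) τ) (α-power (Fin.toℕ l)))) ⟩
      Interpolation.value fractions (Cᴷ i) (varᴷ l) ∎
      where
      open K.≈-Reasoning
      τ : Permutation′ (suc k)
      τ = transpose zero l
      module α = Hom (aut τ)
      α-power : ∀ e → α.⟦ x₀ K.^ e ⟧ K.≈ varᴷ l K.^ e
      α-power e = K.trans (α.^-homo x₀ e) (K.^-congˡ e (aut-var τ zero))

open import Data.Nat using (_≤_; _*_; _^_)

theorem3 : ∀ {c ℓ} (F : Field c ℓ) → Char2 F →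
    (m p k : ℕ) → 1 ≤ m → Prime p → p % 2 ≡ 1 → suc k ≡ 2 * p ^ m →
    let open RatFuns F k in
    ¬ (∃ λ (y : RatFun) → WF y × InL y × ¬ InK y ×
        (∀ (j : ℕ) → 1 ≤ j → j ≤ p → TraceIs (y ^ᵣ j) 0ᵣ))
theorem3 {c} {ℓ} F char2 m p k 1≤m pr p-odd n≡2p^m (y , wf , y∈L , y∉K , traces) =
  ⇒¬¬InK y wf symmetric′ y∉K
  where
  instance _ = prime⇒nonZero pr
  open Stabilisation F char2
  open Translation F char2 k
  orbits : TwoOrbits c ℓ p m (suc k)
  orbits = ≡.subst (TwoOrbits c ℓ p m) (≡.sym n≡2p^m) (twoOrbits p m p-odd)
  n-even : suc k % 2 ≡ 0
  n-even = ≡.trans (≡.cong (_% 2) (≡.trans n≡2p^m (ℕ.*-comm 2 (p ^ m)))) (m*n%n≡0 (p ^ m) 2)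
  open Descent F¬¬ F¬¬-1≉0 F¬¬-stable F¬¬-cancel F¬¬-reduced pr p-odd n-even orbits
  symmetric′ : ∀ σ → Hom.⟦ aut σ ⟧ (fromRatFun y wf) K.≈ fromRatFun y wf
  symmetric′ = symmetric (fromRatFun y wf) (InL⇒ y wf y∈L)
    (λ j 1≤j j≤p → trace⇒conjugate-sum y wf j (traces j 1≤j j≤p))
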